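{- Fix integers $k,r,d\geq 2$, a graph $H$ on $r$ vertices, and a subset $S\subseteq \mathbb{S}^{d-1} \subseteq \mathbb{R}^d$ of size $k$. Then there is a constant $C=C_{S,r}$, depending only on $S$ and $r$, such that the following holds. For every positive integer $n$, positive real number $\alpha > 0$, and colouring $c\colon E(K_{nr}) \to S$ such that $\left\|\sum_{e\in E(K_{nr})} c(e)\right\| \leq \alpha$, there is an $H$-factor $F$ of $K_{nr}$ such that $$\left\|\sum_{e\in E(F)} c(e)\right\| \leq C + \frac{2\alpha}{n}.$$ Moreover, if $S$ is the vertex set of a regular simplex with $d+1$ vertices inscribed in $\mathbb{S}^{d-1}$ (so $k=d+1$), then one may take $C = (8dr)^{(8dr)^{d+1}}$.
   Context: $\|\cdot\|$ is the Euclidean norm on $\mathbb{R}^d$ and $\mathbb{S}^{d-1}$ is the unit sphere in $\mathbb{R}^d$. $K_N$ denotes the complete graph on $N$ vertices. For a graph $H$ on $r$ vertices, an $H$-factor of $K_{nr}$ is a subgraph consisting of $n$ vertex-disjoint copies of $H$, together covering all $nr$ vertices. Colourings are arbitrary functions on edges. -}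

module Defs where

open import Algebra.Bundles using (CommutativeRing)
import Algebra.Definitions.RawMonoid as RawMonoidDefinitions
import Algebra.Properties.Group as GroupProperties
import Algebra.Properties.Ring as RingProperties
import Algebra.Solver.Ring.NaturalCoefficients.Default as NatSolver
open import Data.Empty using (⊥; ⊥-elim)
open import Data.Fin as Fin using (Fin; zero; suc)
import Data.Fin.Properties as Fin
open import Data.List using (List; foldr; filter; mapMaybe; cartesianProduct; allFin)
open import Data.Maybe as Maybe using (Maybe)
open import Data.Nat as ℕ using (ℕ; zero; suc)
open import Data.Product using (∃; ∃-syntax; _×_; _,_; proj₁; proj₂)
open import Data.Sum using (inj₁; inj₂)
open import Data.Vec.Functional using (Vector; zipWith; replicate; map)
open import Function using (_∘_; _↔_; _⇔_; Inverse)
open import Level using (0ℓ)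
open import Relation.Binary using (Rel; IsDecTotalOrder; Irreflexive; Symmetric; Decidable)
import Relation.Binary.Construct.NonStrictToStrict as ToStrict
open import Relation.Binary.PropositionalEquality using (_≡_; _≢_; ≢-sym)
open import Relation.Nullary using (¬_; yes; no; ¬?; dec⇒maybe)
open import Relation.Unary using (Pred; Satisfiable)

-- The reals are axiomatised as a complete ordered field, which is unique up
-- to isomorphism.  Equality is a setoid equality, as quotients are not
-- available.
--
-- Classically, IsSup is the usual notion of least upper bound: the second
-- clause says that no b < s is an upper bound.  As it provides a witness,
-- and since the order is decidable, the existence of the supremum of
-- { x ∣ x = 0, or x = 1 and Q } decides any Q : Set, so classical reasoning
-- about sets is available over any such field without a further hypothesis.

record CompleteOrderedField : Set₁ where
  infix 4 _≤_
  infix 8 _⁻¹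
  field
    commutativeRing : CommutativeRing 0ℓ 0ℓ
  open CommutativeRing commutativeRing public
  field
    _≤_             : Rel Carrier 0ℓ
    isDecTotalOrder : IsDecTotalOrder _≈_ _≤_
    +-monoˡ-≤       : ∀ {x y} z → x ≤ y → x + z ≤ y + z
    *-nonNegative   : ∀ {x y} → 0# ≤ x → 0# ≤ y → 0# ≤ x * y
    0≉1             : ¬ 0# ≈ 1#
    -- The value of 0# ⁻¹ is unspecified.
    _⁻¹             : Carrier → Carrier
    *-inverseʳ      : ∀ {x} → ¬ x ≈ 0# → x * x ⁻¹ ≈ 1#

  open ToStrict _≈_ _≤_ public using (_<_)

  IsUpperBound : Pred Carrier 0ℓ → Carrier → Set
  IsUpperBound P b = ∀ {x} → P x → x ≤ b

  IsSup : Pred Carrier 0ℓ → Carrier → Set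
  IsSup P s = IsUpperBound P s × (∀ {b} → b < s → ∃[ x ] (P x × b < x))

  field
    complete : ∀ P → Satisfiable P → ∃ (IsUpperBound P) → ∃ (IsSup P)

  open IsDecTotalOrder isDecTotalOrder public
    using (_≟_; _≤?_; total; antisym)
    renaming (refl to ≤-refl; reflexive to ≤-reflexive; trans to ≤-trans)

module SquareRoot (ℝ : CompleteOrderedField) where
  open CompleteOrderedField ℝ
  open RingProperties ring using (-‿distribˡ-*)

  private
    module S = NatSolver commutativeSemiring
    open S using (solve; _:=_; _:+_; _:*_)

    ≈-≤ : ∀ {x y} → x ≈ y → x ≤ y
    ≈-≤ = ≤-reflexive

    ≥-≈ : ∀ {x y} → x ≈ y → y ≤ x
    ≥-≈ = ≤-reflexive ∘ sym

    ≰⇒> : ∀ {x y} → ¬ x ≤ y → y < x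
    ≰⇒> = ToStrict.≰⇒> _≈_ _≤_ sym ≤-reflexive total

    <⇒≱ : ∀ {x y} → x < y → ¬ y ≤ x
    <⇒≱ = ToStrict.<⇒≱ _≈_ _≤_ antisym

    +-monoʳ-≤ : ∀ {x y} z → x ≤ y → z + x ≤ z + y
    +-monoʳ-≤ z p = ≤-trans (≈-≤ (+-comm _ _)) (≤-trans (+-monoˡ-≤ z p) (≈-≤ (+-comm _ _)))

    +-mono-≤ : ∀ {x y u v} → x ≤ y → u ≤ v → x + u ≤ y + v
    +-mono-≤ p q = ≤-trans (+-monoˡ-≤ _ p) (+-monoʳ-≤ _ q)

    cancelʳ : ∀ x z → (x + z) + - z ≈ x
    cancelʳ x z = trans (+-assoc x z (- z)) (trans (+-congˡ (-‿inverseʳ z)) (+-identityʳ x))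

    restore : ∀ x z → (x + - z) + z ≈ x
    restore x z = trans (+-assoc x (- z) z) (trans (+-congˡ (-‿inverseˡ z)) (+-identityʳ x))

    +-cancelʳ-≤ : ∀ {x y} z → x + z ≤ y + z → x ≤ y
    +-cancelʳ-≤ {x} {y} z p =
      ≤-trans (≥-≈ (cancelʳ x z)) (≤-trans (+-monoˡ-≤ (- z) p) (≈-≤ (cancelʳ y z)))

    0≤y-x : ∀ {x y} → x ≤ y → 0# ≤ y + - x
    0≤y-x {x} p = ≤-trans (≥-≈ (-‿inverseʳ x)) (+-monoˡ-≤ (- x) p)

    difference : ∀ {x y} → x ≤ y → ∃[ e ] (0# ≤ e × y ≈ e + x)
    difference {x} {y} p = y + - x , 0≤y-x p , sym (restore y x)

    x≤y+x : ∀ {x y} → 0# ≤ y → x ≤ y + x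
    x≤y+x {x} p = ≤-trans (≥-≈ (+-identityˡ x)) (+-monoˡ-≤ x p)

    +-nonNegative : ∀ {x y} → 0# ≤ x → 0# ≤ y → 0# ≤ x + y
    +-nonNegative p q = ≤-trans q (x≤y+x p)

    *-monoˡ-≤ : ∀ {x y z} → 0# ≤ z → x ≤ y → x * z ≤ y * z
    *-monoˡ-≤ {x} {y} {z} 0≤z p with difference p
    ... | e , 0≤e , y≈e+x =
      ≤-trans (x≤y+x (*-nonNegative 0≤e 0≤z))
              (≥-≈ (trans (*-congʳ y≈e+x) (distribʳ z e x)))

    *-monoʳ-≤ : ∀ {x y z} → 0# ≤ z → x ≤ y → z * x ≤ z * y
    *-monoʳ-≤ 0≤z p = ≤-trans (≈-≤ (*-comm _ _)) (≤-trans (*-monoˡ-≤ 0≤z p) (≈-≤ (*-comm _ _)))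

  square-nonNegative : ∀ x → 0# ≤ x * x
  square-nonNegative x with total 0# x
  ... | inj₁ 0≤x = *-nonNegative 0≤x 0≤x
  ... | inj₂ x≤0 = ≤-trans (*-nonNegative 0≤-x 0≤-x) (≈-≤ (trans (sym (-‿distribˡ-* x (- x)))
                     (trans (-‿cong (trans (*-comm x (- x)) (sym (-‿distribˡ-* x x)))) (-‿involutive (x * x)))))
    where
    open GroupProperties +-group using () renaming (⁻¹-involutive to -‿involutive)
    0≤-x : 0# ≤ - x
    0≤-x = ≤-trans (0≤y-x x≤0) (≈-≤ (+-identityˡ (- x)))

  private
    0≤1 : 0# ≤ 1#
    0≤1 = ≤-trans (square-nonNegative 1#) (≈-≤ (*-identityˡ 1#))

    pos-≉0 : ∀ {x} → 0# < x → ¬ x ≈ 0#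
    pos-≉0 (_ , 0≉x) = 0≉x ∘ sym

    *-cancelʳ-0 : ∀ {x z} → 0# < z → x * z ≈ 0# → x ≈ 0#
    *-cancelʳ-0 {x} {z} 0<z p =
      trans (sym (*-identityʳ x))
        (trans (*-congˡ (sym (*-inverseʳ (pos-≉0 0<z))))
          (trans (sym (*-assoc x z (z ⁻¹))) (trans (*-congʳ p) (zeroˡ (z ⁻¹)))))

    *-cancelʳ-≤ : ∀ {x y z} → 0# < z → x * z ≤ y * z → x ≤ y
    *-cancelʳ-≤ {x} {y} {z} 0<z p with total x y
    ... | inj₁ x≤y = x≤y
    ... | inj₂ y≤x with difference y≤x
    ... | e , 0≤e , x≈e+y = ≈-≤ (trans x≈e+y (trans (+-congʳ e≈0) (+-identityˡ y)))
      where
      ez≤0 : e * z ≤ 0#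
      ez≤0 = +-cancelʳ-≤ (y * z)
        (≤-trans (≈-≤ (trans (sym (distribʳ z e y)) (*-congʳ (sym x≈e+y))))
          (≤-trans p (≥-≈ (+-identityˡ _))))
      e≈0 : e ≈ 0#
      e≈0 = *-cancelʳ-0 0<z (antisym ez≤0 (*-nonNegative 0≤e (proj₁ 0<z)))

    divide : ∀ {z} → 0# < z → ∀ x → (x * z ⁻¹) * z ≈ x
    divide {z} 0<z x =
      trans (*-assoc x (z ⁻¹) z)
        (trans (*-congˡ (trans (*-comm (z ⁻¹) z) (*-inverseʳ (pos-≉0 0<z)))) (*-identityʳ x))

    square-+ : ∀ s ε → (s + ε) * (s + ε) ≈ ε * (ε + (s + s)) + s * s
    square-+ s ε = solve 2 (λ s ε → (s :+ ε) :* (s :+ ε)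
      := (ε :* (ε :+ (s :+ s))) :+ (s :* s)) refl s ε

    am-gm-ordered : ∀ {a b} → a ≤ b → a * (b + b) ≤ a * a + b * b × b * (a + a) ≤ b * b + a * a
    am-gm-ordered {a} {b} a≤b with difference a≤b
    ... | e , 0≤e , b≈e+a =
        ≤-trans (x≤y+x (square-nonNegative e)) (≈-≤ (trans (+-congˡ (*-congˡ (+-cong b≈e+a b≈e+a)))
          (trans (solve 2 (λ a e → (e :* e) :+ (a :* ((e :+ a) :+ (e :+ a)))
                    := (a :* a) :+ ((e :+ a) :* (e :+ a))) refl a e)
                 (+-congˡ (sym (*-cong b≈e+a b≈e+a))))))
      , ≤-trans (x≤y+x (square-nonNegative e)) (≈-≤ (trans (+-congˡ (*-congʳ b≈e+a))
          (trans (solve 2 (λ a e → (e :* e) :+ ((e :+ a) :* (a :+ a))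
                    := ((e :+ a) :* (e :+ a)) :+ (a :* a)) refl a e)
                 (+-congʳ (sym (*-cong b≈e+a b≈e+a))))))

    am-gm : ∀ a b → a * (b + b) ≤ a * a + b * b
    am-gm a b with total a b
    ... | inj₁ a≤b = proj₁ (am-gm-ordered a≤b)
    ... | inj₂ b≤a = proj₂ (am-gm-ordered b≤a)

    increase : ∀ {x s} → 0# ≤ x → 0# ≤ s → s * s < x →
               ∃[ ε ] (¬ ε ≤ 0# × (s + ε) * (s + ε) ≤ x)
    increase {x} {s} 0≤x 0≤s ss<x = ε , ε≰0 , bound (≰⇒≥ ε≰0) εD+ss
      where
      D ε : Carrier
      D = (1# + x) + (s + s)
      ε = (x + - (s * s)) * D ⁻¹
      1≤D : 1# ≤ D
      1≤D = ≤-trans (x≤y+x 0≤x) (≤-trans (≈-≤ (+-comm x 1#))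
              (≤-trans (x≤y+x (+-nonNegative 0≤s 0≤s)) (≈-≤ (+-comm (s + s) (1# + x)))))
      0<D : 0# < D
      0<D = ≰⇒> λ D≤0 → 0≉1 (antisym 0≤1 (≤-trans 1≤D D≤0))
      εD+ss : ε * D + s * s ≈ x
      εD+ss = trans (+-congʳ (divide 0<D (x + - (s * s)))) (restore x (s * s))
      ≰⇒≥ : ∀ {a b} → ¬ a ≤ b → b ≤ a
      ≰⇒≥ p = proj₁ (≰⇒> p)
      ε≰0 : ¬ ε ≤ 0#
      ε≰0 ε≤0 = <⇒≱ ss<x (≤-trans (≥-≈ εD+ss)
        (≤-trans (+-monoˡ-≤ (s * s) (*-monoˡ-≤ (proj₁ 0<D) ε≤0))
                 (≈-≤ (trans (+-congʳ (zeroˡ D)) (+-identityˡ (s * s))))))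
      bound : ∀ {ε} → 0# ≤ ε → ε * D + s * s ≈ x → (s + ε) * (s + ε) ≤ x
      bound {ε} 0≤ε e =
        ≤-trans (≈-≤ (square-+ s ε))
        (≤-trans (+-monoˡ-≤ (s * s) (*-monoʳ-≤ 0≤ε (+-monoˡ-≤ (s + s) ε≤1+x))) (≈-≤ e))
        where
        ε≤1+x : ε ≤ 1# + x
        ε≤1+x = *-cancelʳ-≤ 0<D
          (≤-trans (x≤y+x (square-nonNegative s))
          (≤-trans (≈-≤ (trans (+-comm (s * s) (ε * D)) e))
          (≤-trans (x≤y+x 0≤1)
          (≤-trans (≥-≈ (*-identityʳ (1# + x)))
                   (*-monoʳ-≤ (+-nonNegative 0≤1 0≤x) 1≤D)))))

    decrease : ∀ {x s} → 0# ≤ x → 0# ≤ s → x < s * s →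
               ∃[ b ] (b < s × (∀ {t} → t * t ≤ x → t ≤ b))
    decrease {x} {s} 0≤x 0≤s x<ss = b , b<s , b-bound
      where
      0<s+s : 0# < s + s
      0<s+s = ≰⇒> λ q → <⇒≱ x<ss
        (≤-trans (*-monoˡ-≤ 0≤s (≤-trans (x≤y+x 0≤s) q)) (≤-trans (≈-≤ (zeroˡ s)) 0≤x))
      b : Carrier
      b = (s * s + x) * (s + s) ⁻¹
      b[s+s] : b * (s + s) ≈ x + s * s
      b[s+s] = trans (divide 0<s+s (s * s + x)) (+-comm (s * s) x)
      b<s : b < s
      b<s = ≰⇒> λ s≤b → <⇒≱ x<ss (+-cancelʳ-≤ (s * s)
        (≤-trans (≥-≈ (distribˡ s s s))
        (≤-trans (*-monoˡ-≤ (proj₁ 0<s+s) s≤b) (≈-≤ b[s+s]))))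
      b-bound : ∀ {t} → t * t ≤ x → t ≤ b
      b-bound {t} tt≤x = *-cancelʳ-≤ 0<s+s
        (≤-trans (am-gm t s) (≤-trans (+-monoˡ-≤ (s * s) tt≤x) (≥-≈ b[s+s])))

    sup-is-root : ∀ {x s} → 0# ≤ x → 0# ≤ s → IsSup (λ t → t * t ≤ x) s → s * s ≈ x
    sup-is-root {x} {s} 0≤x 0≤s (upper , approx) = antisym ss≤x x≤ss
      where
      x≤ss : x ≤ s * s
      x≤ss with x ≤? s * s
      ... | yes p = p
      ... | no ¬p with increase 0≤x 0≤s (≰⇒> ¬p)
      ...   | ε , ε≰0 , s+ε-below = ⊥-elim (ε≰0 (+-cancelʳ-≤ s
                (≤-trans (≈-≤ (+-comm ε s)) (≤-trans (upper s+ε-below) (≥-≈ (+-identityˡ s))))))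
      ss≤x : s * s ≤ x
      ss≤x with s * s ≤? x
      ... | yes p = p
      ... | no ¬p with decrease 0≤x 0≤s (≰⇒> ¬p)
      ...   | b , b<s , b-bound with approx b<s
      ...     | t , tt≤x , b<t = ⊥-elim (<⇒≱ b<t (b-bound tt≤x))

    0<1+1 : 0# < 1# + 1#
    0<1+1 = ≰⇒> λ 1+1≤0 → 0≉1 (antisym 0≤1 (≤-trans (x≤y+x 0≤1) 1+1≤0))

    roots-bounded : ∀ {x t} → 0# ≤ x → t * t ≤ x → t ≤ 1# + x
    roots-bounded {x} {t} 0≤x tt≤x = *-cancelʳ-≤ 0<1+1
      (≤-trans (am-gm t 1#)
      (≤-trans (+-mono-≤ tt≤x (≈-≤ (*-identityˡ 1#)))
      (≤-trans (x≤y+x (+-nonNegative 0≤x 0≤1)) (≈-≤ (double x)))))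
      where
      double : ∀ x → (x + 1#) + (x + 1#) ≈ (1# + x) * (1# + 1#)
      double x = sym (trans (distribˡ (1# + x) 1# 1#)
        (+-cong (trans (*-identityʳ (1# + x)) (+-comm 1# x))
                (trans (*-identityʳ (1# + x)) (+-comm 1# x))))

  sqrt-exists : ∀ {x} → 0# ≤ x → ∃[ y ] (0# ≤ y × y * y ≈ x)
  sqrt-exists {x} 0≤x = fromSup (complete (λ t → t * t ≤ x) (0# , 0-below) (1# + x , roots-bounded 0≤x))
    where
    0-below : 0# * 0# ≤ x
    0-below = ≤-trans (≈-≤ (zeroˡ 0#)) 0≤x
    fromSup : ∃ (IsSup (λ t → t * t ≤ x)) → ∃[ y ] (0# ≤ y × y * y ≈ x)
    fromSup (s , isSup) = s , proj₁ isSup 0-below , sup-is-root 0≤x (proj₁ isSup 0-below) isSup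

  √ : ∀ {x} → 0# ≤ x → Carrier
  √ 0≤x = proj₁ (sqrt-exists 0≤x)

record Graph (N : ℕ) : Set₁ where
  infix 4 _~_ _~?_
  field
    _~_    : Rel (Fin N) 0ℓ
    sym    : Symmetric _~_
    irrefl : Irreflexive _≡_ _~_
    _~?_   : Decidable _~_

K : ∀ N → Graph N
K N = record
  { _~_    = _≢_
  ; sym    = ≢-sym
  ; irrefl = λ u≡v u≢v → u≢v u≡v
  ; _~?_   = λ u v → ¬? (u Fin.≟ v)
  }

-- The edge {u,v} of the complete graph is represented by the unique
-- ordered pair of its endpoints with u < v.
record Edge (N : ℕ) : Set where
  constructor edge
  field
    u v  : Fin N
    .u<v : u Fin.< v

allEdges : ∀ N → List (Edge N)
allEdges N = mapMaybe toEdge (cartesianProduct (allFin N) (allFin N))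
  where
  toEdge : Fin N × Fin N → Maybe (Edge N)
  toEdge (u , v) = Maybe.map (λ u<v → edge u v u<v) (dec⇒maybe (u Fin.<? v))

E : ∀ {N} → Graph N → List (Edge N)
E G = filter (λ e → Edge.u e ~? Edge.v e) (allEdges _)
  where open Graph G

-- The bijection φ packages n injective maps φ (i , _) : Fin r → Fin (n * r)
-- with pairwise disjoint images which together cover Fin (n * r); the edges
-- of F are exactly those of the n resulting copies of H.
IsFactor : ∀ {n r} → Graph r → Graph (n ℕ.* r) → Set
IsFactor {n} {r} H F =
  ∃[ φ ] ∀ u v → u F.~ v ⇔ Covered φ u v
  where
  module H = Graph H
  module F = Graph F
  Covered : (Fin n × Fin r) ↔ Fin (n ℕ.* r) → Rel (Fin (n ℕ.* r)) 0ℓ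
  Covered φ u v =
    ∃[ i ] ∃[ a ] ∃[ b ] (a H.~ b × Inverse.to φ (i , a) ≡ u × Inverse.to φ (i , b) ≡ v)

module Euclidean (ℝ : CompleteOrderedField) where
  open CompleteOrderedField ℝ public
    using (Carrier; _≈_; _≤_; _<_; _+_; _*_; _⁻¹; 0#; 1#)
  open CompleteOrderedField ℝ using (_-_; ≤-refl; ≤-trans; ≤-reflexive; +-monoˡ-≤; +-identityˡ; +-rawMonoid)
  open RawMonoidDefinitions +-rawMonoid public using (sum) renaming (_×_ to _·_)
  open SquareRoot ℝ using (√; square-nonNegative)

  fromℕ : ℕ → Carrier
  fromℕ n = n · 1#

  ℝ^ : ℕ → Set
  ℝ^ d = Vector Carrier d

  infix 4 _≈ᵥ_
  _≈ᵥ_ : ∀ {d} → Rel (ℝ^ d) 0ℓ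
  x ≈ᵥ y = ∀ i → x i ≈ y i

  0ᵥ : ∀ {d} → ℝ^ d
  0ᵥ = replicate _ 0#

  infixl 6 _+ᵥ_ _-ᵥ_
  _+ᵥ_ _-ᵥ_ : ∀ {d} → ℝ^ d → ℝ^ d → ℝ^ d
  _+ᵥ_ = zipWith _+_
  _-ᵥ_ = zipWith _-_

  infixr 7 _*ᵥ_
  _*ᵥ_ : ∀ {d} → Carrier → ℝ^ d → ℝ^ d
  a *ᵥ x = map (a *_) x

  sumOfSquares : ∀ {d} → ℝ^ d → Carrier
  sumOfSquares x = sum (λ i → x i * x i)

  sumOfSquares-nonNegative : ∀ {d} (x : ℝ^ d) → 0# ≤ sumOfSquares x
  sumOfSquares-nonNegative {zero}  x = ≤-refl
  sumOfSquares-nonNegative {suc d} x =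
    ≤-trans (sumOfSquares-nonNegative (x ∘ suc))
      (≤-trans (≤-reflexive (CompleteOrderedField.sym ℝ (+-identityˡ _)))
               (+-monoˡ-≤ _ (square-nonNegative (x zero))))

  ‖_‖ : ∀ {d} → ℝ^ d → Carrier
  ‖ x ‖ = √ (sumOfSquares-nonNegative x)

  ∑ᵥ : ∀ {A : Set} {d} → List A → (A → ℝ^ d) → ℝ^ d
  ∑ᵥ as f = foldr (λ a → f a +ᵥ_) 0ᵥ as

  AffinelyIndependent : ∀ {k d} → (Fin k → ℝ^ d) → Set
  AffinelyIndependent {k} S =
    ∀ (a : Fin k → Carrier) → sum a ≈ 0# → ∑ᵥ (allFin k) (λ i → a i *ᵥ S i) ≈ᵥ 0ᵥ →
    ∀ i → a i ≈ 0#

  IsRegularSimplex : ∀ {k d} → (Fin k → ℝ^ d) → Set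
  IsRegularSimplex {k} {d} S =
    k ≡ suc d × AffinelyIndependent S ×
    ∃[ ℓ ] (∀ i j → i ≢ j → ‖ S i -ᵥ S j ‖ ≈ ℓ)

  -- A colouring with colour set { S i ∣ i : Fin k } is given by the index
  -- of the colour of each edge.
  HasBalancedFactors : ∀ {k r d} → (Fin k → ℝ^ d) → Graph r → Carrier → Set₁
  HasBalancedFactors {k} {r} S H C =
    ∀ (n : ℕ) → 1 ℕ.≤ n → (α : Carrier) → 0# < α →
    (c : Edge (n ℕ.* r) → Fin k) →
    ‖ ∑ᵥ (E (K (n ℕ.* r))) (λ e → S (c e)) ‖ ≤ α →
    ∃[ F ] (IsFactor {n} H F ×
            ‖ ∑ᵥ (E F) (λ e → S (c e)) ‖ ≤ C + (fromℕ 2 * α) * fromℕ n ⁻¹)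

{-# OPTIONS --safe #-}

-- Take an H-factor whose colour sum σ has nearly minimal norm, and compare it
-- with its local rearrangements: every such change a of the colour counts
-- satisfies ⟨σ, S a⟩ ≥ −const, where S a is the sum of the colours weighted
-- by a.  Averaging over all rearrangements puts Y − Bσ, where
-- Y is controlled by the colour sum of the whole graph, into the cone generated
-- by the vectors S a.  There are finitely many of these, so eliminating
-- coordinates one at a time (Fourier–Motzkin) turns the bounds on the generators
-- into ⟨σ, x⟩ ≥ −M ‖x‖ for all x in that cone; with x = Y − Bσ, completing the
-- square gives B‖σ‖ ≤ ‖Y‖ + BM.
--
-- This is done twice.  Permuting the 2r vertices of two blocks, with H complete,
-- balances the sum over n disjoint cliques; permuting the vertices inside
-- single blocks then balances the copies of H against the cliques.  For a
-- simplex the elimination takes place among integer vectors of colour counts,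
-- where all constants are explicit.
module Submission where

-- The obstacle is uniformity in `n`. Averaging over all rearrangements puts weights on the
-- generators that grow with `n`, while the error term may not grow. Hence the cone bound has to be
-- independent of the weights and to depend on the set of generators alone. That set is fixed by `S`
-- and `r`: a move touches at most two blocks, so it changes each colour count by at most `2 r²`,
-- counting ordered pairs. What could spoil such a bound is cancellation between generators of
-- opposite sign, and elimination makes this cancellation explicit, one coordinate at a time.
--
-- Two rounds are needed because the average over moves between two blocks contains, besides the
-- colour sum of the whole graph, the clique sum of the current blocks with a weight of order `n`.
-- For complete `H` this clique sum is the quantity being minimised and merges with the term `Bσ`;
-- for any other `H` it would be an uncontrolled part of `Y`. Moves inside a single block leave the
-- clique sum unchanged, so the second round can take it for `Y`, with the bound from the first.

open import Defs
open import Algebra.Bundles using (CommutativeRing; RawRing)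
import Algebra.Properties.AbelianGroup as AbelianGroupProperties
import Algebra.Properties.Group as GroupProperties
import Algebra.Properties.Monoid.Mult.TCOptimised as OptimisedMult
import Algebra.Properties.Ring as RingProperties
import Algebra.Properties.Semiring.Mult as SemiringMult
import Algebra.Properties.Semiring.Sum as SemiringSum
import Algebra.Solver.Ring as RingSolver
import Algebra.Solver.Ring.NaturalCoefficients.Default as NatSolver
open import Algebra.Solver.Ring.AlmostCommutativeRing
  using (fromCommutativeRing; _-Raw-AlmostCommutative⟶_)
open import Data.Bool using (if_then_else_; true; false)
open import Data.Empty using (⊥-elim)
open import Data.Fin as Fin using (Fin; zero; suc; punchIn; _↑ˡ_; _↑ʳ_; combine; remQuot; splitAt)
open import Data.Fin.Permutation as Perm using (Permutation; _⟨$⟩ʳ_; _⟨$⟩ˡ_; insert; insert-punchIn)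
import Data.Fin.Properties as Fin
open import Data.List as List using (List; []; _∷_; _++_; allFin; mapMaybe; filter; cartesianProduct)
open import Data.List.Relation.Unary.Any as Any using (Any; here; there)
import Data.List.Relation.Unary.Any.Properties as Any
open import Data.Maybe as Maybe using (Maybe; just; nothing; maybe)
open import Data.Nat as ℕ using (ℕ; zero; suc; z≤n; s≤s; _!; _^_) renaming (_≤_ to _≤ℕ_; _*_ to _*ℕ_)
import Data.Nat.Properties as ℕ
import Data.Nat.Solver as ℕSolver
open import Data.Product using (∃; ∃-syntax; _×_; _,_; proj₁; proj₂)
open import Data.Product.Function.NonDependent.Propositional using (_×-↔_)
open import Data.Sum using (_⊎_; inj₁; inj₂; [_,_]′)
open import Data.Unit using (⊤; tt)
open import Data.Vec.Functional using (insertAt)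
import Data.Vec.Functional.Properties as Vector
open import Function using (_∘_; _↔_; Inverse; Injection; mk↔ₛ′; mk⇔)
open import Function.Construct.Composition using (_↔-∘_)
open import Function.Construct.Identity using (↔-id)
open import Function.Construct.Symmetry using (↔-sym)
open import Function.Definitions using (Injective)
open import Function.Properties.Inverse using (↔⇒↣)
open import Level using (0ℓ)
open import Relation.Binary using (tri<; tri≈; tri>)
import Relation.Binary.Construct.NonStrictToStrict as ToStrict
open import Relation.Binary.PropositionalEquality as ≡ using (_≡_; _≢_)
open import Relation.Nullary using (¬_; Dec; yes; no; does; ¬?; _×-dec_; dec⇒maybe)
open import Relation.Nullary.Decidable using (decidable-stable)
open import Relation.Unary using (Decidable)

-- Ring identities with integer coefficients

-- The coefficients of the solver are formal differences p − q of natural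
-- numbers, for which the morphism into the ring needs no case analysis on signs.
module DifferenceSolver (R : CommutativeRing 0ℓ 0ℓ) where
  open CommutativeRing R
  open RingProperties ring using (-‿distribˡ-*; -‿distribʳ-*)
  open GroupProperties +-group using (ε⁻¹≈ε) renaming (⁻¹-involutive to -‿involutive)
  open SemiringMult semiring using (×-homo-+; ×1-homo-*) renaming (_×_ to _·_)
  open AbelianGroupProperties +-abelianGroup using (⁻¹-∙-comm)
  open import Algebra.Definitions.RawMonoid +-rawMonoid using (_×′_)
  open OptimisedMult +-monoid using (×ᵤ≈×)
  open import Relation.Binary.Reasoning.Setoid setoid
  private
    module S = NatSolver commutativeSemiring
    open S using (solve; _:=_; _:+_; _:*_)

    Diff : Set
    Diff = ℕ × ℕ

    -- Removing the common part gives each integer a single representative, so that the two normal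
    -- forms of a true identity coincide and `refl` closes the goal.
    reduce : ℕ → ℕ → Diff
    reduce p q = p ℕ.∸ q , q ℕ.∸ p

    ∸-exchange : ∀ p q → p ℕ.∸ q ℕ.+ q ≡ p ℕ.+ (q ℕ.∸ p)
    ∸-exchange p q with ℕ.≤-total p q
    ... | inj₁ p≤q = ≡.trans (≡.cong (ℕ._+ q) (ℕ.m≤n⇒m∸n≡0 p≤q)) (≡.sym (ℕ.m+[n∸m]≡n p≤q))
    ... | inj₂ q≤p = ≡.trans (ℕ.m∸n+n≡m q≤p) (≡.sym (≡.trans (≡.cong (p ℕ.+_) (ℕ.m≤n⇒m∸n≡0 q≤p)) (ℕ.+-identityʳ p)))

    diffRing : RawRing 0ℓ 0ℓ
    diffRing = record
      { Carrier = Diff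
      ; _≈_     = _≡_
      ; _+_     = λ (p , q) (p′ , q′) → reduce (p ℕ.+ p′) (q ℕ.+ q′)
      ; _*_     = λ (p , q) (p′ , q′) → reduce (p ℕ.* p′ ℕ.+ q ℕ.* q′) (p ℕ.* q′ ℕ.+ q ℕ.* p′)
      ; -_      = λ (p , q) → q , p
      ; 0#      = 0 , 0
      ; 1#      = 1 , 0
      }

    ι : ℕ → Carrier
    ι n = n · 1#

    -- The separate clause for `zero`, together with `×′`, lets `⟦ 0 , 0 ⟧` and `⟦ 1 , 0 ⟧` compute
    -- to `0#` and `1#`.
    ⟦_⟧ : Diff → Carrier
    ⟦ p , zero ⟧  = p ×′ 1#
    ⟦ p , suc q ⟧ = p ×′ 1# - suc q ×′ 1#

    -0≈0 : - 0# ≈ 0#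
    -0≈0 = ε⁻¹≈ε

    ⟦⟧-diff : ∀ p q → ⟦ p , q ⟧ ≈ ι p - ι q
    ⟦⟧-diff p zero    = trans (sym (×ᵤ≈× p 1#)) (sym (trans (+-congˡ -0≈0) (+-identityʳ _)))
    ⟦⟧-diff p (suc q) = +-cong (sym (×ᵤ≈× p 1#)) (-‿cong (sym (×ᵤ≈× (suc q) 1#)))

    equal-differences : ∀ {a b c d} → a + d ≈ c + b → a - b ≈ c - d
    equal-differences {a} {b} {c} {d} e = begin
      a - b               ≈⟨ +-identityʳ _ ⟨
      (a - b) + 0#        ≈⟨ +-congˡ (-‿inverseʳ d) ⟨
      (a - b) + (d - d)   ≈⟨ solve 4 (λ a b d e → (a :+ b) :+ (d :+ e) := (a :+ d) :+ (b :+ e)) refl a (- b) d (- d) ⟩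
      (a + d) + (- b - d) ≈⟨ +-congʳ e ⟩
      (c + b) + (- b - d) ≈⟨ solve 4 (λ c b b′ d → (c :+ b) :+ (b′ :+ d) := (c :+ d) :+ (b :+ b′)) refl c b (- b) (- d) ⟩
      (c - d) + (b - b)   ≈⟨ +-congˡ (-‿inverseʳ b) ⟩
      (c - d) + 0#        ≈⟨ +-identityʳ _ ⟩
      c - d               ∎

    +-difference : ∀ a b c d → (a + c) - (b + d) ≈ (a - b) + (c - d)
    +-difference a b c d = begin
      (a + c) - (b + d)     ≈⟨ +-congˡ (⁻¹-∙-comm b d) ⟨
      (a + c) + (- b - d)   ≈⟨ solve 4 (λ a b c d → (a :+ c) :+ (b :+ d) := (a :+ b) :+ (c :+ d)) refl a (- b) c (- d) ⟩
      (a - b) + (c - d)     ∎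

    *-difference : ∀ a b c d → (a * c + b * d) - (a * d + b * c) ≈ (a - b) * (c - d)
    *-difference a b c d = begin
      (a * c + b * d) - (a * d + b * c)                   ≈⟨ +-congˡ (⁻¹-∙-comm _ _) ⟨
      (a * c + b * d) + (- (a * d) + - (b * c))           ≈⟨ +-cong (+-congˡ (sym neg-neg)) (+-cong (-‿distribʳ-* a d) (-‿distribˡ-* b c)) ⟩
      (a * c + (- b) * (- d)) + (a * (- d) + (- b) * c)   ≈⟨ solve 4 (λ a b c d → (a :* c :+ b :* d) :+ (a :* d :+ b :* c) := (a :+ b) :* (c :+ d)) refl a (- b) c (- d) ⟩
      (a - b) * (c - d)                                   ∎
      where
      neg-neg : (- b) * (- d) ≈ b * d
      neg-neg = begin
        (- b) * (- d) ≈⟨ -‿distribˡ-* b (- d) ⟨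
        - (b * (- d)) ≈⟨ -‿cong (-‿distribʳ-* b d) ⟨
        - - (b * d)   ≈⟨ -‿involutive (b * d) ⟩
        b * d         ∎

    neg-difference : ∀ a b → b - a ≈ - (a - b)
    neg-difference a b = sym (trans (sym (⁻¹-∙-comm a (- b))) (trans (+-congˡ (-‿involutive b)) (+-comm _ _)))

    ι-+ : ∀ m n → ι (m ℕ.+ n) ≈ ι m + ι n
    ι-+ = ×-homo-+ 1#

    ι-*+* : ∀ a b c d → ι (a ℕ.* b ℕ.+ c ℕ.* d) ≈ ι a * ι b + ι c * ι d
    ι-*+* a b c d = trans (ι-+ (a ℕ.* b) (c ℕ.* d)) (+-cong (×1-homo-* a b) (×1-homo-* c d))

    ⟦reduce⟧ : ∀ p q → ⟦ reduce p q ⟧ ≈ ι p - ι q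
    ⟦reduce⟧ p q = trans (⟦⟧-diff (p ℕ.∸ q) (q ℕ.∸ p)) (equal-differences
      (trans (sym (ι-+ (p ℕ.∸ q) q)) (trans (reflexive (≡.cong ι (∸-exchange p q))) (ι-+ p (q ℕ.∸ p)))))

    morphism : diffRing -Raw-AlmostCommutative⟶ fromCommutativeRing R
    morphism = record
      { ⟦_⟧    = ⟦_⟧
      ; +-homo = λ (p , q) (p′ , q′) → begin
          ⟦ reduce (p ℕ.+ p′) (q ℕ.+ q′) ⟧ ≈⟨ ⟦reduce⟧ (p ℕ.+ p′) (q ℕ.+ q′) ⟩
          ι (p ℕ.+ p′) - ι (q ℕ.+ q′)   ≈⟨ +-cong (ι-+ p p′) (-‿cong (ι-+ q q′)) ⟩
          (ι p + ι p′) - (ι q + ι q′)   ≈⟨ +-difference _ _ _ _ ⟩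
          (ι p - ι q) + (ι p′ - ι q′)   ≈⟨ +-cong (⟦⟧-diff p q) (⟦⟧-diff p′ q′) ⟨
          ⟦ p , q ⟧ + ⟦ p′ , q′ ⟧       ∎
      ; *-homo = λ (p , q) (p′ , q′) → begin
          ⟦ reduce (p ℕ.* p′ ℕ.+ q ℕ.* q′) (p ℕ.* q′ ℕ.+ q ℕ.* p′) ⟧
            ≈⟨ ⟦reduce⟧ (p ℕ.* p′ ℕ.+ q ℕ.* q′) (p ℕ.* q′ ℕ.+ q ℕ.* p′) ⟩
          ι (p ℕ.* p′ ℕ.+ q ℕ.* q′) - ι (p ℕ.* q′ ℕ.+ q ℕ.* p′)
            ≈⟨ +-cong (ι-*+* p p′ q q′) (-‿cong (ι-*+* p q′ q p′)) ⟩
          (ι p * ι p′ + ι q * ι q′) - (ι p * ι q′ + ι q * ι p′)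
            ≈⟨ *-difference _ _ _ _ ⟩
          (ι p - ι q) * (ι p′ - ι q′)
            ≈⟨ *-cong (⟦⟧-diff p q) (⟦⟧-diff p′ q′) ⟨
          ⟦ p , q ⟧ * ⟦ p′ , q′ ⟧ ∎
      ; -‿homo = λ (p , q) → begin
          ⟦ q , p ⟧       ≈⟨ ⟦⟧-diff q p ⟩
          ι q - ι p       ≈⟨ neg-difference (ι p) (ι q) ⟩
          - (ι p - ι q)   ≈⟨ -‿cong (⟦⟧-diff p q) ⟨
          - ⟦ p , q ⟧     ∎
      ; 0-homo = refl
      ; 1-homo = refl
      }

    ≟-coefficient : ∀ c c′ → Maybe (⟦ c ⟧ ≈ ⟦ c′ ⟧)
    ≟-coefficient (p , q) (p′ , q′) with p ℕ.+ q′ ℕ.≟ p′ ℕ.+ q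
    ... | no  _ = nothing
    ... | yes e = just (begin
      ⟦ p , q ⟧     ≈⟨ ⟦⟧-diff p q ⟩
      ι p - ι q     ≈⟨ equal-differences (trans (sym (ι-+ p q′)) (trans (reflexive (≡.cong ι e)) (ι-+ p′ q))) ⟩
      ι p′ - ι q′   ≈⟨ ⟦⟧-diff p′ q′ ⟨
      ⟦ p′ , q′ ⟧   ∎)

  open RingSolver diffRing (fromCommutativeRing R) morphism ≟-coefficient public
    using (solve; _:=_; _:+_; _:*_; _:-_; :-_; con; Polynomial)

  :0 :1 : ∀ {n} → Polynomial n
  :0 = con (0 , 0)
  :1 = con (1 , 0)

-- Inequalities in an ordered field

-- Lemmas are opaque throughout: otherwise with-abstractions normalise the proof
-- terms produced by the ring solver.
module OrderedField (ℝ : CompleteOrderedField) where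
  open CompleteOrderedField ℝ hiding (zero)
  open DifferenceSolver commutativeRing
  open SquareRoot ℝ using (square-nonNegative)
  open Euclidean ℝ using (fromℕ)
  private module M = SemiringMult semiring

  opaque
    0≤⇒≤ : ∀ {x y} → 0# ≤ y - x → x ≤ y
    0≤⇒≤ {x} {y} p = ≤-trans (≤-reflexive (sym (+-identityˡ x)))
      (≤-trans (+-monoˡ-≤ x p) (≤-reflexive (solve 2 (λ x y → (y :- x) :+ x := y) refl x y)))

    ≤⇒0≤ : ∀ {x y} → x ≤ y → 0# ≤ y - x
    ≤⇒0≤ {x} {y} p = ≤-trans (≤-reflexive (sym (-‿inverseʳ x))) (+-monoˡ-≤ (- x) p)

    -- Inequalities are proved by exhibiting y − x as a combination of
    -- nonnegative terms, which leaves a ring identity.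
    ≤-from : ∀ {x y e} → 0# ≤ e → e ≈ y - x → x ≤ y
    ≤-from p e = 0≤⇒≤ (≤-trans p (≤-reflexive e))

    +-nonNegative : ∀ {x y} → 0# ≤ x → 0# ≤ y → 0# ≤ x + y
    +-nonNegative {x} {y} p q = ≤-trans q (≤-trans (≤-reflexive (sym (+-identityˡ y))) (+-monoˡ-≤ y p))

    ≤-resp₂ : ∀ {x x′ y y′} → x ≈ x′ → y ≈ y′ → x ≤ y → x′ ≤ y′
    ≤-resp₂ p q r = ≤-trans (≤-reflexive (sym p)) (≤-trans r (≤-reflexive q))

    0≤-resp : ∀ {x y} → x ≈ y → 0# ≤ x → 0# ≤ y
    0≤-resp = ≤-resp₂ refl

    +-mono-≤ : ∀ {x y u v} → x ≤ y → u ≤ v → x + u ≤ y + v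
    +-mono-≤ {x} {y} {u} {v} p q = ≤-from (+-nonNegative (≤⇒0≤ p) (≤⇒0≤ q))
      (solve 4 (λ x y u v → (y :- x) :+ (v :- u) := (y :+ v) :- (x :+ u)) refl x y u v)

    *-monoˡ-≤ : ∀ {x y z} → 0# ≤ z → x ≤ y → z * x ≤ z * y
    *-monoˡ-≤ {x} {y} {z} 0≤z p = ≤-from (*-nonNegative 0≤z (≤⇒0≤ p))
      (solve 3 (λ x y z → z :* (y :- x) := z :* y :- z :* x) refl x y z)

    *-monoʳ-≤ : ∀ {x y z} → 0# ≤ z → x ≤ y → x * z ≤ y * z
    *-monoʳ-≤ {x} {y} {z} 0≤z p = ≤-resp₂ (*-comm z x) (*-comm z y) (*-monoˡ-≤ 0≤z p)

    *-mono-≤ : ∀ {x y u v} → 0# ≤ y → 0# ≤ u → x ≤ y → u ≤ v → x * u ≤ y * v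
    *-mono-≤ 0≤y 0≤u p q = ≤-trans (*-monoʳ-≤ 0≤u p) (*-monoˡ-≤ 0≤y q)

    neg-mono-≤ : ∀ {x y} → x ≤ y → - y ≤ - x
    neg-mono-≤ {x} {y} p = ≤-from (≤⇒0≤ p) (solve 2 (λ x y → y :- x := :- x :- :- y) refl x y)

    0≤-x : ∀ {x} → x ≤ 0# → 0# ≤ - x
    0≤-x {x} p = 0≤-resp (+-identityˡ (- x)) (≤⇒0≤ p)

    ≰⇒> : ∀ {x y} → ¬ x ≤ y → y < x
    ≰⇒> = ToStrict.≰⇒> _≈_ _≤_ sym ≤-reflexive total

    <⇒≱ : ∀ {x y} → x < y → ¬ y ≤ x
    <⇒≱ = ToStrict.<⇒≱ _≈_ _≤_ antisym

    <⇒≤ : ∀ {x y} → x < y → x ≤ y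
    <⇒≤ = proj₁

    pos⇒≉0 : ∀ {x} → 0# < x → ¬ x ≈ 0#
    pos⇒≉0 (_ , p) e = p (sym e)

    0≤1 : 0# ≤ 1#
    0≤1 = 0≤-resp (*-identityˡ 1#) (square-nonNegative 1#)

    0<1 : 0# < 1#
    0<1 = 0≤1 , 0≉1

    *-inverseˡ : ∀ {x} → ¬ x ≈ 0# → x ⁻¹ * x ≈ 1#
    *-inverseˡ p = trans (*-comm _ _) (*-inverseʳ p)

    -- The inverse equals `x` times the square of `x ⁻¹`.
    inverse-nonNegative : ∀ {x} → 0# < x → 0# ≤ x ⁻¹
    inverse-nonNegative {x} 0<x@(0≤x , _) = 0≤-resp
      (trans (solve 2 (λ x i → x :* (i :* i) := (x :* i) :* i) refl x (x ⁻¹))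
             (trans (*-congʳ (*-inverseʳ (pos⇒≉0 0<x))) (*-identityˡ _)))
      (*-nonNegative 0≤x (square-nonNegative (x ⁻¹)))

    *-cancelˡ-0 : ∀ {x z} → ¬ z ≈ 0# → z * x ≈ 0# → x ≈ 0#
    *-cancelˡ-0 {x} {z} z≉0 e = begin
      x              ≈⟨ *-identityˡ x ⟨
      1# * x         ≈⟨ *-congʳ (*-inverseˡ z≉0) ⟨
      (z ⁻¹ * z) * x ≈⟨ *-assoc _ _ _ ⟩
      z ⁻¹ * (z * x) ≈⟨ *-congˡ e ⟩
      z ⁻¹ * 0#      ≈⟨ zeroʳ _ ⟩
      0#             ∎
      where open import Relation.Binary.Reasoning.Setoid setoid

    *-cancelˡ-≈ : ∀ {x y z} → ¬ z ≈ 0# → z * x ≈ z * y → x ≈ y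
    *-cancelˡ-≈ {x} {y} {z} z≉0 e = trans (solve 2 (λ x y → x := (x :- y) :+ y) refl x y)
      (trans (+-congʳ (*-cancelˡ-0 z≉0 (trans (solve 3 (λ x y z → z :* (x :- y) := z :* x :- z :* y) refl x y z)
        (trans (+-congʳ e) (-‿inverseʳ _))))) (+-identityˡ y))

    *-pos : ∀ {x y} → 0# < x → 0# < y → 0# < x * y
    *-pos p q = *-nonNegative (<⇒≤ p) (<⇒≤ q) , λ e → pos⇒≉0 q (*-cancelˡ-0 (pos⇒≉0 p) (sym e))

    *-cancelˡ-≤ : ∀ {x y z} → 0# < z → z * x ≤ z * y → x ≤ y
    *-cancelˡ-≤ {x} {y} {z} 0<z p = ≤-resp₂ (shift x) (shift y) (*-monoˡ-≤ (inverse-nonNegative 0<z) p)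
      where
      shift : ∀ x → z ⁻¹ * (z * x) ≈ x
      shift x = trans (sym (*-assoc _ _ _)) (trans (*-congʳ (*-inverseˡ (pos⇒≉0 0<z))) (*-identityˡ x))

    square-cancel-≤ : ∀ {x y} → 0# ≤ y → x * x ≤ y * y → x ≤ y
    square-cancel-≤ {x} {y} 0≤y p with x ≤? y
    ... | yes q = q
    ... | no ¬q = ⊥-elim (<⇒≱ (*-pos 0<x-y 0<x+y) (≤-from (≤⇒0≤ p)
        (solve 2 (λ x y → y :* y :- x :* x := :0 :- (x :- y) :* (x :+ y)) refl x y)))
      where
      0<x-y : 0# < x - y
      0<x-y = ≰⇒> λ r → ¬q (≤-from (0≤-x r) (solve 2 (λ x y → :- (x :- y) := y :- x) refl x y))
      0<x+y : 0# < x + y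
      0<x+y = ≰⇒> λ r → ¬q (≤-from (+-nonNegative (+-nonNegative 0≤y 0≤y) (0≤-x r))
        (solve 2 (λ x y → (y :+ y) :+ :- (x :+ y) := y :- x) refl x y))

    fromℕ-+ : ∀ m n → fromℕ (m ℕ.+ n) ≈ fromℕ m + fromℕ n
    fromℕ-+ = M.×-homo-+ 1#

    fromℕ-* : ∀ m n → fromℕ (m ℕ.* n) ≈ fromℕ m * fromℕ n
    fromℕ-* = M.×1-homo-*

    fromℕ-nonNegative : ∀ n → 0# ≤ fromℕ n
    fromℕ-nonNegative zero    = ≤-refl
    fromℕ-nonNegative (suc n) = +-nonNegative 0≤1 (fromℕ-nonNegative n)

    fromℕ-mono : ∀ {m n} → m ℕ.≤ n → fromℕ m ≤ fromℕ n
    fromℕ-mono {n = n} z≤n = fromℕ-nonNegative n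
    fromℕ-mono (s≤s p)     = +-mono-≤ ≤-refl (fromℕ-mono p)

    fromℕ-1 : fromℕ 1 ≈ 1#
    fromℕ-1 = +-identityʳ 1#

    1≤fromℕ : ∀ n → 1# ≤ fromℕ (suc n)
    1≤fromℕ n = ≤-trans (≤-reflexive (sym fromℕ-1)) (fromℕ-mono {1} {suc n} (s≤s z≤n))

    fromℕ-pos : ∀ n → 0# < fromℕ (suc n)
    fromℕ-pos n = ≰⇒> λ p → <⇒≱ 0<1 (≤-trans (1≤fromℕ n) p)

-- Finite sums, inner products, norms and convex cones

module Vectors (ℝ : CompleteOrderedField) where
  open CompleteOrderedField ℝ hiding (zero)
  open Euclidean ℝ using (fromℕ; ℝ^; _≈ᵥ_; 0ᵥ; _+ᵥ_; _*ᵥ_; sumOfSquares-nonNegative; ‖_‖)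
  open DifferenceSolver commutativeRing
  open SquareRoot ℝ using (sqrt-exists; square-nonNegative)
  open OrderedField ℝ
  open SemiringSum semiring hiding (∑-permute)

  infix 4 ∣_∣≤_
  ∣_∣≤_ : Carrier → Carrier → Set
  ∣ x ∣≤ t = - t ≤ x × x ≤ t

  opaque
    half-nonNegative : ∀ {x} → 0# ≤ x + x → 0# ≤ x
    half-nonNegative {x} p with total 0# x
    ... | inj₁ q = q
    ... | inj₂ q = ≤-from (+-nonNegative p (0≤-x q)) (solve 1 (λ x → (x :+ x) :+ :- x := x :- :0) refl x)

    ∣∣≤-resp : ∀ {x y s t} → x ≈ y → s ≈ t → ∣ x ∣≤ s → ∣ y ∣≤ t
    ∣∣≤-resp p q (l , u) = ≤-resp₂ (-‿cong q) p l , ≤-resp₂ p q u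

    ∣∣≤-weaken : ∀ {x s t} → s ≤ t → ∣ x ∣≤ s → ∣ x ∣≤ t
    ∣∣≤-weaken p (l , u) = ≤-trans (neg-mono-≤ p) l , ≤-trans u p

    ∣∣≤-+ : ∀ {x y s t} → ∣ x ∣≤ s → ∣ y ∣≤ t → ∣ x + y ∣≤ s + t
    ∣∣≤-+ (l , u) (l′ , u′) =
      ≤-trans (≤-reflexive (solve 2 (λ s t → :- (s :+ t) := :- s :+ :- t) refl _ _)) (+-mono-≤ l l′) , +-mono-≤ u u′

    ∣∣≤-neg : ∀ {x s} → ∣ x ∣≤ s → ∣ - x ∣≤ s
    ∣∣≤-neg (l , u) = neg-mono-≤ u , ≤-trans (neg-mono-≤ l) (≤-reflexive (solve 1 (λ s → :- :- s := s) refl _))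

    -- Twice `s * t + x * y` is `(s - x) * (t - y) + (s + x) * (t + y)`, a sum of products of
    -- nonnegative factors; exchanging the signs in the second factors gives `s * t - x * y`. This
    -- avoids a case distinction on the signs of `x` and `y`.
    ∣∣≤-* : ∀ {x y s t} → ∣ x ∣≤ s → ∣ y ∣≤ t → ∣ x * y ∣≤ s * t
    ∣∣≤-* {x} {y} {s} {t} (l , u) (l′ , u′) =
        0≤⇒≤ (half-nonNegative (0≤-resp
          (solve 4 (λ x y s t → (s :- x) :* (t :- y) :+ (x :- :- s) :* (y :- :- t)
            := (x :* y :- :- (s :* t)) :+ (x :* y :- :- (s :* t))) refl x y s t)
          (+-nonNegative (*-nonNegative (≤⇒0≤ u) (≤⇒0≤ u′)) (*-nonNegative (≤⇒0≤ l) (≤⇒0≤ l′)))))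
      , 0≤⇒≤ (half-nonNegative (0≤-resp
          (solve 4 (λ x y s t → (s :- x) :* (y :- :- t) :+ (x :- :- s) :* (t :- y)
            := (s :* t :- x :* y) :+ (s :* t :- x :* y)) refl x y s t)
          (+-nonNegative (*-nonNegative (≤⇒0≤ u) (≤⇒0≤ l′)) (*-nonNegative (≤⇒0≤ l) (≤⇒0≤ u′)))))

    ∣0∣≤ : ∀ {x t} → x ≈ 0# → 0# ≤ t → ∣ x ∣≤ t
    ∣0∣≤ e p = ≤-trans (≤-from p (solve 1 (λ t → t := :0 :- :- t) refl _)) (≤-reflexive (sym e)) , ≤-trans (≤-reflexive e) p

    nonNegative⇒∣∣≤ : ∀ {x t} → 0# ≤ x → x ≤ t → ∣ x ∣≤ t
    nonNegative⇒∣∣≤ p q = ≤-trans (proj₁ (∣0∣≤ refl (≤-trans p q))) p , q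

    square⇒∣∣≤ : ∀ {x t} → 0# ≤ t → x * x ≤ t * t → ∣ x ∣≤ t
    square⇒∣∣≤ {x} {t} 0≤t p =
        ≤-trans (neg-mono-≤ (square-cancel-≤ 0≤t (≤-trans (≤-reflexive (solve 1 (λ x → (:- x) :* (:- x) := x :* x) refl x)) p)))
                (≤-reflexive (solve 1 (λ x → :- :- x := x) refl x))
      , square-cancel-≤ 0≤t p

    ∣∣≤⇒square : ∀ {x t} → ∣ x ∣≤ t → x * x ≤ t * t
    ∣∣≤⇒square p = proj₂ (∣∣≤-* p p)

    divide : ∀ {z} → 0# < z → ∀ {x} → 0# ≤ x → ∃[ q ] (0# ≤ q × q * z ≈ x)
    divide {z} 0<z {x} 0≤x = x * z ⁻¹ , *-nonNegative 0≤x (inverse-nonNegative 0<z) ,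
      trans (*-assoc _ _ _) (trans (*-congˡ (*-inverseˡ (pos⇒≉0 0<z))) (*-identityʳ x))

  -- Opaque, so that unification recovers the summand.
  opaque
    ∑ : ∀ n → (Fin n → Carrier) → Carrier
    ∑ n f = sum f

    ∑≈sum : ∀ {n} (f : Fin n → Carrier) → ∑ n f ≈ sum f
    ∑≈sum f = refl

    ∑-empty : ∀ {f} → ∑ 0 f ≈ 0#
    ∑-empty = refl

    ∑-suc : ∀ {n} {f : Fin (suc n) → Carrier} → ∑ (suc n) f ≈ f zero + ∑ n (λ i → f (suc i))
    ∑-suc = refl

    ∑-cong : ∀ {n} {f g : Fin n → Carrier} → (∀ i → f i ≈ g i) → ∑ n f ≈ ∑ n g
    ∑-cong = sum-cong-≋

    ∑-+ : ∀ {n} (f g : Fin n → Carrier) → ∑ n (λ i → f i + g i) ≈ ∑ n f + ∑ n g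
    ∑-+ = ∑-distrib-+

    *-∑ : ∀ {n} x (f : Fin n → Carrier) → x * ∑ n f ≈ ∑ n (λ i → x * f i)
    *-∑ = *-distribˡ-sum

    ∑-swap : ∀ {m n} (f : Fin m → Fin n → Carrier) → ∑ m (λ i → ∑ n (f i)) ≈ ∑ n (λ j → ∑ m (λ i → f i j))
    ∑-swap = ∑-comm

    ∑-permute : ∀ {m n} (f : Fin n → Carrier) (π : Permutation m n) → ∑ n f ≈ ∑ m (λ i → f (π ⟨$⟩ʳ i))
    ∑-permute = sum-permute

    ∑-remove : ∀ {n} (f : Fin (suc n) → Carrier) i → ∑ (suc n) f ≈ f i + ∑ n (λ j → f (punchIn i j))
    ∑-remove f i = sum-remove f

    ∑-nonNegative : ∀ {n} {f : Fin n → Carrier} → (∀ i → 0# ≤ f i) → 0# ≤ ∑ n f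
    ∑-nonNegative {zero}  p = ≤-refl
    ∑-nonNegative {suc n} p = +-nonNegative (p zero) (∑-nonNegative (λ i → p (suc i)))

    ∑-mono-≤ : ∀ {n} {f g : Fin n → Carrier} → (∀ i → f i ≤ g i) → ∑ n f ≤ ∑ n g
    ∑-mono-≤ {zero}  p = ≤-refl
    ∑-mono-≤ {suc n} p = +-mono-≤ (p zero) (∑-mono-≤ (λ i → p (suc i)))

    ∑-const : ∀ n x → ∑ n (λ _ → x) ≈ fromℕ n * x
    ∑-const zero    x = sym (zeroˡ x)
    ∑-const (suc n) x = trans (+-congˡ (∑-const n x)) (solve 2 (λ x k → x :+ k :* x := (:1 :+ k) :* x) refl x (fromℕ n))

  opaque
    ∑-zero : ∀ {n} {f : Fin n → Carrier} → (∀ i → f i ≈ 0#) → ∑ n f ≈ 0#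
    ∑-zero {n} p = trans (∑-cong p) (trans (∑-const n 0#) (zeroʳ _))

    ∑-*ʳ : ∀ {n} x (f : Fin n → Carrier) → ∑ n f * x ≈ ∑ n (λ i → f i * x)
    ∑-*ʳ x f = trans (*-comm _ _) (trans (*-∑ x f) (∑-cong λ i → *-comm _ _))

    ∑-neg : ∀ {n} (f : Fin n → Carrier) → ∑ n (λ i → - f i) ≈ - ∑ n f
    ∑-neg f = trans (∑-cong λ i → solve 1 (λ x → :- x := (:- :1) :* x) refl (f i))
      (trans (sym (*-∑ (- 1#) f)) (solve 1 (λ x → (:- :1) :* x := :- x) refl _))

    ∑-- : ∀ {n} (f g : Fin n → Carrier) → ∑ n (λ i → f i - g i) ≈ ∑ n f - ∑ n g
    ∑-- f g = trans (∑-+ f (λ i → - g i)) (+-congˡ (∑-neg g))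

    term≤∑ : ∀ {n} {f : Fin n → Carrier} → (∀ i → 0# ≤ f i) → ∀ i → f i ≤ ∑ n f
    term≤∑ {suc n} {f} p i = ≤-from (∑-nonNegative (λ j → p (punchIn i j)))
      (trans (solve 2 (λ x y → y := (x :+ y) :- x) refl (f i) _) (+-congʳ (sym (∑-remove f i))))

  dot : ∀ {m} → ℝ^ m → ℝ^ m → Carrier
  dot {m} x y = ∑ m (λ i → x i * y i)

  opaque
    dot-cong : ∀ {m} {x x′ y y′ : ℝ^ m} → x ≈ᵥ x′ → y ≈ᵥ y′ → dot x y ≈ dot x′ y′
    dot-cong p q = ∑-cong λ i → *-cong (p i) (q i)

    dot-comm : ∀ {m} (x y : ℝ^ m) → dot x y ≈ dot y x
    dot-comm x y = ∑-cong λ i → *-comm _ _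

    dot-+ʳ : ∀ {m} (g x y : ℝ^ m) → dot g (x +ᵥ y) ≈ dot g x + dot g y
    dot-+ʳ g x y = trans (∑-cong λ i → distribˡ (g i) (x i) (y i)) (∑-+ _ _)

    dot-*ʳ : ∀ {m} (g : ℝ^ m) l x → dot g (l *ᵥ x) ≈ l * dot g x
    dot-*ʳ g l x = trans (∑-cong λ i → solve 3 (λ g l x → g :* (l :* x) := l :* (g :* x)) refl (g i) l (x i))
      (sym (*-∑ l _))

    dot-linear : ∀ {m} (g : ℝ^ m) {x l v y} → x ≈ᵥ l *ᵥ v +ᵥ y → dot g x ≈ l * dot g v + dot g y
    dot-linear g {l = l} {v} {y} e =
      trans (dot-cong (λ _ → refl) e) (trans (dot-+ʳ g (l *ᵥ v) y) (+-congʳ (dot-*ʳ g l v)))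

    dot-+ˡ : ∀ {m} (x y g : ℝ^ m) → dot (x +ᵥ y) g ≈ dot x g + dot y g
    dot-+ˡ x y g = trans (dot-comm _ g) (trans (dot-+ʳ g x y) (+-cong (dot-comm g x) (dot-comm g y)))

    dot-*ˡ : ∀ {m} l (x g : ℝ^ m) → dot (l *ᵥ x) g ≈ l * dot x g
    dot-*ˡ l x g = trans (dot-comm _ g) (trans (dot-*ʳ g l x) (*-congˡ (dot-comm g x)))

    dot-zeroʳ : ∀ {m} (g : ℝ^ m) {x} → x ≈ᵥ 0ᵥ → dot g x ≈ 0#
    dot-zeroʳ g e = ∑-zero λ i → trans (*-congˡ (e i)) (zeroʳ _)

    dot-suc : ∀ {m} (x y : ℝ^ (suc m)) → dot x y ≈ x zero * y zero + dot (x ∘ suc) (y ∘ suc)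
    dot-suc x y = ∑-suc

    dot-square-+ : ∀ {m} (x y : ℝ^ m) → dot (x +ᵥ y) (x +ᵥ y) ≈ (dot x x + (dot x y + dot x y)) + dot y y
    dot-square-+ x y = trans (dot-+ˡ x y _) (trans (+-cong (dot-+ʳ x x y) (dot-+ʳ y x y))
      (trans (+-congˡ (+-congʳ (dot-comm y x)))
        (solve 3 (λ a b c → (a :+ b) :+ (b :+ c) := (a :+ (b :+ b)) :+ c) refl _ _ _)))

    -- Opaque, so that the supremum defining the square root is never unfolded.
    ∥_∥ : ∀ {m} → ℝ^ m → Carrier
    ∥ x ∥ = ‖ x ‖

    ∥∥≈‖‖ : ∀ {m} (x : ℝ^ m) → ∥ x ∥ ≈ ‖ x ‖
    ∥∥≈‖‖ x = refl

    ∥∥-nonNegative : ∀ {m} (x : ℝ^ m) → 0# ≤ ∥ x ∥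
    ∥∥-nonNegative x = proj₁ (proj₂ (sqrt-exists (sumOfSquares-nonNegative x)))

    ∥∥-square : ∀ {m} (x : ℝ^ m) → ∥ x ∥ * ∥ x ∥ ≈ dot x x
    ∥∥-square x = trans (proj₂ (proj₂ (sqrt-exists (sumOfSquares-nonNegative x)))) (sym (∑≈sum _))

    ∥∥-≤ : ∀ {m} (x : ℝ^ m) {t} → 0# ≤ t → dot x x ≤ t * t → ∥ x ∥ ≤ t
    ∥∥-≤ x 0≤t p = square-cancel-≤ 0≤t (≤-trans (≤-reflexive (∥∥-square x)) p)

    ∥∥-unique : ∀ {m} (x : ℝ^ m) {t} → 0# ≤ t → dot x x ≈ t * t → ∥ x ∥ ≈ t
    ∥∥-unique x 0≤t e = antisym (∥∥-≤ x 0≤t (≤-reflexive e))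
      (square-cancel-≤ (∥∥-nonNegative x) (≤-reflexive (trans (sym e) (sym (∥∥-square x)))))

    ∥∥-cong : ∀ {m} {x y : ℝ^ m} → x ≈ᵥ y → ∥ x ∥ ≈ ∥ y ∥
    ∥∥-cong {x = x} {y} e = ∥∥-unique x (∥∥-nonNegative y) (trans (dot-cong e e) (sym (∥∥-square y)))

    ∥∥-* : ∀ {m} l (x : ℝ^ m) → 0# ≤ l → ∥ l *ᵥ x ∥ ≈ l * ∥ x ∥
    ∥∥-* l x 0≤l = ∥∥-unique (l *ᵥ x) (*-nonNegative 0≤l (∥∥-nonNegative x))
      (trans (dot-*ˡ l x _) (trans (*-congˡ (dot-*ʳ x l x)) (trans (*-congˡ (*-congˡ (sym (∥∥-square x))))
        (solve 2 (λ l n → l :* (l :* (n :* n)) := (l :* n) :* (l :* n)) refl l ∥ x ∥))))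

    entry≤∥∥ : ∀ {m} (x : ℝ^ m) i → ∣ x i ∣≤ ∥ x ∥
    entry≤∥∥ x i = square⇒∣∣≤ (∥∥-nonNegative x)
      (≤-trans (term≤∑ (λ j → square-nonNegative (x j)) i) (≤-reflexive (sym (∥∥-square x))))

  -- The generators form a predicate rather than a family, so that they can carry inequalities such
  -- as `Above` and be restricted by sign. A derivation lists the weighted generators one by one,
  -- which is what elimination recurses on.
  data Cone {m} (P : ℝ^ m → Set) (x : ℝ^ m) : Set where
    origin : x ≈ᵥ 0ᵥ → Cone P x
    add    : ∀ l v y → 0# ≤ l → P v → Cone P y → x ≈ᵥ l *ᵥ v +ᵥ y → Cone P x

  module _ {m} {P : ℝ^ m → Set} where
    opaque

        cone-resp : ∀ {x y} → x ≈ᵥ y → Cone P x → Cone P y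
        cone-resp e (origin z)          = origin λ i → trans (sym (e i)) (z i)
        cone-resp e (add l v y p q c f) = add l v y p q c λ i → trans (sym (e i)) (f i)

        cone-map : ∀ {k} {Q : ℝ^ k → Set} (F : ℝ^ m → ℝ^ k) →
                   (∀ {x} → x ≈ᵥ 0ᵥ → F x ≈ᵥ 0ᵥ) →
                   (∀ {x l v y} → x ≈ᵥ l *ᵥ v +ᵥ y → F x ≈ᵥ l *ᵥ F v +ᵥ F y) →
                   (∀ {v} → P v → Q (F v)) → ∀ {x} → Cone P x → Cone Q (F x)
        cone-map F F0 F+ g (origin z)          = origin (F0 z)
        cone-map F F0 F+ g (add l v y p q c f) = add l (F v) (F y) p (g q) (cone-map F F0 F+ g c) (F+ f)

        cone-⊆ : ∀ {Q : ℝ^ m → Set} → (∀ {v} → P v → Q v) → ∀ {x} → Cone P x → Cone Q x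
        cone-⊆ = cone-map (λ x → x) (λ z → z) (λ f → f)

        cone-+ : ∀ {x y} → Cone P x → Cone P y → Cone P (x +ᵥ y)
        cone-+ (origin z) d = cone-resp (λ i → sym (trans (+-congʳ (z i)) (+-identityˡ _))) d
        cone-+ (add l v y p q c f) d = add l v _ p q (cone-+ c d) λ i → trans (+-congʳ (f i)) (+-assoc _ _ _)

        cone-* : ∀ {x} a → 0# ≤ a → Cone P x → Cone P (a *ᵥ x)
        cone-* a 0≤a (origin z) = origin λ i → trans (*-congˡ (z i)) (zeroʳ a)
        cone-* a 0≤a (add l v y p q c f) = add (a * l) v (a *ᵥ y) (*-nonNegative 0≤a p) q (cone-* a 0≤a c)
          λ i → trans (*-congˡ (f i)) (solve 4 (λ a l v y → a :* (l :* v :+ y) := (a :* l) :* v :+ a :* y) refl a l (v i) (y i))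

        cone-generator : ∀ {x} → P x → Cone P x
        cone-generator {x} p = add 1# x 0ᵥ 0≤1 p (origin λ _ → refl) λ i → sym (trans (+-identityʳ _) (*-identityˡ _))

        cone-∑ : ∀ {n} {f : Fin n → ℝ^ m} → (∀ i → Cone P (f i)) → Cone P (λ j → ∑ n (λ i → f i j))
        cone-∑ {zero}  c = origin λ _ → ∑-empty
        cone-∑ {suc n} c = cone-resp (λ _ → sym ∑-suc) (cone-+ (c zero) (cone-∑ (c ∘ suc)))

        linear-bound : (L : ℝ^ m → Carrier) → (∀ {x} → x ≈ᵥ 0ᵥ → L x ≈ 0#) →
                       (∀ {x l v y} → x ≈ᵥ l *ᵥ v +ᵥ y → L x ≈ l * L v + L y) →
                       (∀ {v} → P v → 0# ≤ L v) → ∀ {x} → Cone P x → 0# ≤ L x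
        linear-bound L L0 L+ g (origin z) = ≤-reflexive (sym (L0 z))
        linear-bound L L0 L+ g (add l v y p q c f) =
          0≤-resp (sym (L+ f)) (+-nonNegative (*-nonNegative p (g q)) (linear-bound L L0 L+ g c))

-- Quantitative Fourier-Motzkin elimination

module ConeBounds (ℝ : CompleteOrderedField) where
  open CompleteOrderedField ℝ hiding (zero)
  open Euclidean ℝ using (ℝ^; _≈ᵥ_; 0ᵥ; _+ᵥ_; _*ᵥ_)
  open DifferenceSolver commutativeRing
  open OrderedField ℝ
  open Vectors ℝ

  Above : ∀ {m} → (ℝ^ m → Set) → ℝ^ m → Carrier → ℝ^ m → Set
  Above P g s v = P v × - s ≤ dot g v

  -- A quantitative form of Farkas' lemma. The constant `M` is independent of the weights in the
  -- cone, and one `M` serves every `g`, although `g` decides which elements of `P` may be used as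
  -- generators.
  ConeBounded : ∀ {m} → (ℝ^ m → Set) → Carrier → Set
  ConeBounded {m} P M = ∀ g s t x → 0# ≤ s → 0# ≤ t → Cone (Above P g s) x →
    (∀ i → ∣ x i ∣≤ t) → - (M * (s * t)) ≤ dot g x

  private opaque
      cancel-low : ∀ {α A B v μ w z l y} → α * A ≈ l → y ≈ μ * w + z →
                   l * v + y ≈ α * (B * w + A * v) + ((μ - α * B) * w + z)
      cancel-low {α} {A} {B} {v} {μ} {w} {z} p q = trans (+-cong (*-congʳ (sym p)) q)
        (solve 7 (λ α A B v μ w z → (α :* A) :* v :+ (μ :* w :+ z)
          := α :* (B :* w :+ A :* v) :+ ((μ :- α :* B) :* w :+ z)) refl α A B v μ w z)

      cancel-high : ∀ {β A B v μ w z l y y′ z′} → β * B ≈ μ → y ≈ μ * w + z → (l - β * A) * v + z ≈ y′ + z′ →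
                    l * v + y ≈ (β * (B * w + A * v) + y′) + z′
      cancel-high {β} {A} {B} {v} {μ} {w} {z} {l} p q h = trans (+-congˡ (trans q (+-congʳ (*-congʳ (sym p)))))
        (trans (solve 7 (λ l v β B w z A → l :* v :+ ((β :* B) :* w :+ z)
            := β :* (B :* w :+ A :* v) :+ ((l :- β :* A) :* v :+ z)) refl l v β B w z A)
          (trans (+-congˡ h) (sym (+-assoc _ _ _))))

      rotate : ∀ a b c → (a * b) * c ≈ b * (a * c)
      rotate = solve 3 (λ a b c → (a :* b) :* c := b :* (a :* c)) refl

      left-comm : ∀ x y z → x + (y + z) ≈ y + (x + z)
      left-comm = solve 3 (λ x y z → x :+ (y :+ z) := y :+ (x :+ z)) refl

      mixed-identity : ∀ b s hv hw gw gv →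
        ((b - hv) * s + (b - hw) * s) + (hv * (gw - - s) + hw * (gv - - s)) ≈ (hv * gw + hw * gv) - - ((b + b) * s)
      mixed-identity = solve 6 (λ b s hv hw gw gv →
        ((b :- hv) :* s :+ (b :- hw) :* s) :+ (hv :* (gw :- :- s) :+ hw :* (gv :- :- s))
        := (hv :* gw :+ hw :* gv) :- :- ((b :+ b) :* s)) refl

  -- The generators in A have positive height hA and those in B positive
  -- height hB, where hB = − hA; a positive combination of one of each has height zero.
  module Cancellation {m} {A B Z : ℝ^ m → Set} (hA hB : ℝ^ m → Carrier)
    (A-pos : ∀ {v} → A v → 0# < hA v) (B-pos : ∀ {v} → B v → 0# < hB v)
    (combine : ∀ {w v} → A w → B v → Z (hB v *ᵥ w +ᵥ hA w *ᵥ v)) where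

    Split : ℝ^ m → Set
    Split x = ∃[ y ] ∃[ z ] (Cone Z y × (Cone A z ⊎ Cone B z) × x ≈ᵥ y +ᵥ z)

    -- The new generator `v` is paired with the first generator `w` of the opposite side, in the
    -- ratio of total height zero, until one of the two weights is used up. If that of `v` runs out,
    -- the rest stays on side `A`; otherwise `w` is gone and the recursion goes on with the
    -- remaining weight of `v`.
    cancel : ∀ {l v z} → 0# ≤ l → B v → Cone A z → Split (l *ᵥ v +ᵥ z)
    cancel {l} {v} {z} 0≤l b (origin e) =
      0ᵥ , l *ᵥ v , origin (λ _ → refl) ,
      inj₂ (add l v 0ᵥ 0≤l b (origin λ _ → refl) (λ i → sym (+-identityʳ _))) ,
      λ i → trans (+-comm _ _) (+-congʳ (e i))
    cancel {l} {v} {z} 0≤l b (add μ w z₁ 0≤μ a c e) with l * hB v ≤? μ * hA w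
    ... | yes p with divide (A-pos a) 0≤l
    ...   | α , 0≤α , αhA≈l =
      α *ᵥ u , (μ - α * hB v) *ᵥ w +ᵥ z₁ ,
      cone-* α 0≤α (cone-generator (combine a b)) ,
      inj₁ (add _ w z₁ (≤⇒0≤ αhB≤μ) a c (λ _ → refl)) ,
      λ i → cancel-low αhA≈l (e i)
      where
      u = hB v *ᵥ w +ᵥ hA w *ᵥ v
      αhB≤μ : α * hB v ≤ μ
      αhB≤μ = *-cancelˡ-≤ (A-pos a) (≤-resp₂
        (trans (*-congʳ (sym αhA≈l)) (rotate α (hA w) (hB v)))
        (*-comm _ _) p)
    cancel {l} {v} {z} 0≤l b (add μ w z₁ 0≤μ a c e) | no ¬p with divide (B-pos b) 0≤μ
    ...   | β , 0≤β , βhB≈μ with cancel {l - β * hA w} (≤⇒0≤ βhA≤l) b c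
      where
      βhA≤l : β * hA w ≤ l
      βhA≤l = *-cancelˡ-≤ (B-pos b) (≤-resp₂
        (trans (*-congʳ (sym βhB≈μ)) (rotate β (hB v) (hA w)))
        (*-comm _ _) (<⇒≤ (≰⇒> ¬p)))
    ...     | y , z′ , y∈ , z′∈ , f =
      β *ᵥ u +ᵥ y , z′ , cone-+ (cone-* β 0≤β (cone-generator (combine a b))) y∈ , z′∈ ,
      λ i → cancel-high βhB≈μ (e i) (f i)
      where u = hB v *ᵥ w +ᵥ hA w *ᵥ v

  -- One elimination step, removing the coordinate `zero`, here called the height. By `gap` a
  -- nonzero height is at least `1 / b` in absolute value; without this, generators of tiny height
  -- could carry arbitrarily large weight. `Q` has to contain what survives: generators of height
  -- zero, and height-zero combinations of a positive and a negative one.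
  module Elimination {m} (P : ℝ^ (suc m) → Set) (Q : ℝ^ m → Set) (b : Carrier) (1≤b : 1# ≤ b)
    (entries : ∀ {v} → P v → ∀ i → ∣ v i ∣≤ b)
    (gap : ∀ {v} → P v → v zero ≈ 0# ⊎ 1# ≤ b * v zero ⊎ 1# ≤ b * - v zero)
    (Q-resp : ∀ {x y} → x ≈ᵥ y → Q x → Q y)
    (flat : ∀ {v} → P v → v zero ≈ 0# → Q (v ∘ suc))
    (mixed : ∀ {w v} → P w → P v → 1# ≤ b * w zero → 1# ≤ b * - v zero →
             Q ((λ i → (- v zero * w i) + w zero * v i) ∘ suc)) where

    private
      0≤b : 0# ≤ b
      0≤b = ≤-trans 0≤1 1≤b

      up down : ℝ^ (suc m) → Carrier
      up v = v zero
      down v = - v zero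

      pos-height : ∀ {h} → 1# ≤ b * h → 0# < h
      pos-height {h} p = ≰⇒> λ h≤0 → <⇒≱ 0<1 (≤-trans p (≤-trans (*-monoˡ-≤ 0≤b h≤0) (≤-reflexive (zeroʳ b))))

    module _ (g : ℝ^ (suc m)) (s : Carrier) (0≤s : 0# ≤ s) where

      private
        -- A height-zero combination weights two generators by each other's heights. These are at
        -- most `b`, and each generator lies above `- s`.
        s′ : Carrier
        s′ = (b + b) * s

        R Up Down Flat : ℝ^ (suc m) → Set
        R = Above P g s
        Up v = R v × 1# ≤ b * up v
        Down v = R v × 1# ≤ b * down v
        Flat u = u zero ≈ 0# × Q (u ∘ suc) × - s′ ≤ dot g u

        mixed-bound : ∀ {w v hv hw} → R w → R v → ∣ hv ∣≤ b → ∣ hw ∣≤ b → 0# ≤ hv → 0# ≤ hw →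
                      - s′ ≤ dot g (hv *ᵥ w +ᵥ hw *ᵥ v)
        mixed-bound {w} {v} {hv} {hw} (_ , lw) (_ , lv) (_ , hv≤b) (_ , hw≤b) 0≤hv 0≤hw = ≤-trans
          (≤-from (+-nonNegative
              (+-nonNegative (*-nonNegative (≤⇒0≤ hv≤b) 0≤s) (*-nonNegative (≤⇒0≤ hw≤b) 0≤s))
              (+-nonNegative (*-nonNegative 0≤hv (≤⇒0≤ lw)) (*-nonNegative 0≤hw (≤⇒0≤ lv))))
            (mixed-identity b s hv hw (dot g w) (dot g v)))
          (≤-reflexive (sym (trans (dot-+ʳ g _ _) (+-cong (dot-*ʳ g hv w) (dot-*ʳ g hw v)))))

        combine-down-up : ∀ {w v} → Down w → Up v → Flat (up v *ᵥ w +ᵥ down w *ᵥ v)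
        combine-down-up {w} {v} (rw , p) (rv , q) =
            solve 2 (λ v w → v :* w :+ (:- w) :* v := :0) refl (v zero) (w zero)
          , Q-resp (λ i → +-comm _ _) (mixed (proj₁ rv) (proj₁ rw) q p)
          , mixed-bound rw rv (entries (proj₁ rv) zero) (∣∣≤-neg (entries (proj₁ rw) zero))
              (<⇒≤ (pos-height q)) (<⇒≤ (pos-height p))

        combine-up-down : ∀ {w v} → Up w → Down v → Flat (down v *ᵥ w +ᵥ up w *ᵥ v)
        combine-up-down {w} {v} (rw , p) (rv , q) =
            solve 2 (λ v w → (:- v) :* w :+ w :* v := :0) refl (v zero) (w zero)
          , mixed (proj₁ rw) (proj₁ rv) p q
          , mixed-bound rw rv (∣∣≤-neg (entries (proj₁ rv) zero)) (entries (proj₁ rw) zero)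
              (<⇒≤ (pos-height q)) (<⇒≤ (pos-height p))

        module DU = Cancellation {A = Down} {Up} {Flat} down up (pos-height ∘ proj₂) (pos-height ∘ proj₂) combine-down-up
        module UD = Cancellation {A = Up} {Down} {Flat} up down (pos-height ∘ proj₂) (pos-height ∘ proj₂) combine-up-down

        Split : ℝ^ (suc m) → Set
        Split x = ∃[ y ] ∃[ z ] (Cone Flat y × (Cone Up z ⊎ Cone Down z) × x ≈ᵥ y +ᵥ z)

        shift-split : ∀ {x y l v z} y₁ → Cone Flat y → x ≈ᵥ l *ᵥ v +ᵥ y₁ → y₁ ≈ᵥ y +ᵥ z →
                      Split (l *ᵥ v +ᵥ z) → Split x
        shift-split {x} {y} {l} {v} {z} y₁ y∈ e f (y′ , z′ , y′∈ , z′∈ , h) =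
          y +ᵥ y′ , z′ , cone-+ y∈ y′∈ , z′∈ , λ i → trans (e i) (trans (+-congˡ (f i))
            (trans (left-comm (l * v i) (y i) (z i))
              (trans (+-congˡ (h i)) (sym (+-assoc _ _ _)))))

        swap-sides : ∀ {x} → DU.Split x → Split x
        swap-sides (y , z , y∈ , inj₁ z∈ , e) = y , z , y∈ , inj₂ z∈ , e
        swap-sides (y , z , y∈ , inj₂ z∈ , e) = y , z , y∈ , inj₁ z∈ , e

        -- Generators enter one at a time, and one whose sign is opposite to that of the remainder
        -- is cancelled against it at once. So the remainder never mixes signs.
        split : ∀ {x} → Cone R x → Split x
        split (origin e) = 0ᵥ , 0ᵥ , origin (λ _ → refl) , inj₁ (origin λ _ → refl) ,
          λ i → trans (e i) (sym (+-identityˡ _))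
        split (add l v y₁ 0≤l r c e) with split c | gap (proj₁ r)
        ... | y , z , y∈ , z∈ , f | inj₁ v₀≈0 =
          l *ᵥ v +ᵥ y , z , add l v y 0≤l (v₀≈0 , flat (proj₁ r) v₀≈0 , ≤-trans s≤s′ (proj₂ r)) y∈ (λ _ → refl) , z∈ ,
          λ i → trans (e i) (trans (+-congˡ (f i)) (sym (+-assoc _ _ _)))
          where
          s≤s′ : - s′ ≤ - s
          s≤s′ = ≤-from (*-nonNegative (+-nonNegative (≤⇒0≤ 1≤b) 0≤b) 0≤s)
            (solve 2 (λ b s → ((b :- :1) :+ b) :* s := (:- s) :- :- ((b :+ b) :* s)) refl b s)
        ... | y , z , y∈ , inj₁ z∈ , f | inj₂ (inj₁ p) = shift-split y₁ y∈ e f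
          (0ᵥ , l *ᵥ v +ᵥ z , origin (λ _ → refl) , inj₁ (add l v z 0≤l (r , p) z∈ (λ _ → refl)) , λ i → sym (+-identityˡ _))
        ... | y , z , y∈ , inj₂ z∈ , f | inj₂ (inj₁ p) = shift-split y₁ y∈ e f (swap-sides (DU.cancel 0≤l (r , p) z∈))
        ... | y , z , y∈ , inj₁ z∈ , f | inj₂ (inj₂ p) = shift-split y₁ y∈ e f (UD.cancel 0≤l (r , p) z∈)
        ... | y , z , y∈ , inj₂ z∈ , f | inj₂ (inj₂ p) = shift-split y₁ y∈ e f
          (0ᵥ , l *ᵥ v +ᵥ z , origin (λ _ → refl) , inj₂ (add l v z 0≤l (r , p) z∈ (λ _ → refl)) , λ i → sym (+-identityˡ _))

        -- On a cone generated by vectors of one sign, the height h = ε z₀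
        -- controls the total weight, hence both g and the entries.
        module Side (ε : Carrier) where
          Sd : ℝ^ (suc m) → Set
          Sd v = R v × 1# ≤ b * (ε * v zero)

          dot-bound : ∀ {z} → Cone Sd z → - (s * (b * (ε * z zero))) ≤ dot g z
          dot-bound {z} c = 0≤⇒≤ (linear-bound L L0 L+ Lv c)
            where
            L : ℝ^ (suc m) → Carrier
            L z = dot g z - - (s * (b * (ε * z zero)))
            L0 : ∀ {x} → x ≈ᵥ 0ᵥ → L x ≈ 0#
            L0 e = trans (+-cong (dot-zeroʳ g e) (-‿cong (-‿cong (*-congˡ (*-congˡ (*-congˡ (e zero)))))))
              (solve 3 (λ s b ε → :0 :- :- (s :* (b :* (ε :* :0))) := :0) refl s b ε)
            L+ : ∀ {x l v y} → x ≈ᵥ l *ᵥ v +ᵥ y → L x ≈ l * L v + L y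
            L+ {x} {l} {v} {y} e = trans (+-cong (dot-linear g e) (-‿cong (-‿cong (*-congˡ (*-congˡ (*-congˡ (e zero)))))))
              (solve 8 (λ l gv gy s b ε v y → (l :* gv :+ gy) :- :- (s :* (b :* (ε :* (l :* v :+ y))))
                := l :* (gv :- :- (s :* (b :* (ε :* v)))) :+ (gy :- :- (s :* (b :* (ε :* y)))))
                refl l (dot g v) (dot g y) s b ε (v zero) (y zero))
            Lv : ∀ {v} → Sd v → 0# ≤ L v
            Lv {v} ((_ , p) , q) = ≤⇒0≤ (≤-trans
              (≤-from (*-nonNegative 0≤s (≤⇒0≤ q)) (solve 2 (λ s h → s :* (h :- :1) := (:- s) :- :- (s :* h)) refl s (b * (ε * v zero)))) p)

          entry-bound : ∀ {z} → Cone Sd z → ∀ i → ∣ z i ∣≤ b * (b * (ε * z zero))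
          entry-bound {z} c i =
              ≤-from (bound 1#  (λ (l , _) → ≤-trans l (≤-reflexive (sym (*-identityˡ _))))) (solve 2 (λ h z → h :+ :1 :* z := z :- :- h) refl _ _)
            , ≤-from (bound (- 1#) (λ (_ , u) → ≤-trans (neg-mono-≤ u) (≤-reflexive (solve 1 (λ z → :- z := (:- :1) :* z) refl _))))
                (solve 2 (λ h z → h :+ (:- :1) :* z := h :- z) refl _ _)
            where
            bound : ∀ δ → (∀ {x t} → ∣ x ∣≤ t → - t ≤ δ * x) → 0# ≤ b * (b * (ε * z zero)) + δ * z i
            bound δ f = linear-bound L L0 L+ Lv c
              where
              L : ℝ^ (suc m) → Carrier
              L z = b * (b * (ε * z zero)) + δ * z i
              L0 : ∀ {x} → x ≈ᵥ 0ᵥ → L x ≈ 0#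
              L0 e = trans (+-cong (*-congˡ (*-congˡ (*-congˡ (e zero)))) (*-congˡ (e i)))
                (solve 3 (λ b ε δ → b :* (b :* (ε :* :0)) :+ δ :* :0 := :0) refl b ε δ)
              L+ : ∀ {x l v y} → x ≈ᵥ l *ᵥ v +ᵥ y → L x ≈ l * L v + L y
              L+ {x} {l} {v} {y} e = trans (+-cong (*-congˡ (*-congˡ (*-congˡ (e zero)))) (*-congˡ (e i)))
                (solve 8 (λ b ε δ l v y vi yi → b :* (b :* (ε :* (l :* v :+ y))) :+ δ :* (l :* vi :+ yi)
                  := l :* (b :* (b :* (ε :* v)) :+ δ :* vi) :+ (b :* (b :* (ε :* y)) :+ δ :* yi))
                  refl b ε δ l (v zero) (y zero) (v i) (y i))
              Lv : ∀ {v} → Sd v → 0# ≤ L v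
              Lv {v} ((p , _) , q) = 0≤-resp (solve 2 (λ h x → h :- (:- x) := h :+ x) refl _ _)
                (≤⇒0≤ (≤-trans (≤-trans (neg-mono-≤ (f (entries p i))) (≤-reflexive (solve 1 (λ b → :- :- b := b :* :1) refl b)))
                  (*-monoˡ-≤ 0≤b q)))

      -- In `x = y + z` with `y` of height zero, the one-sided part `z` has the height of `x`, at
      -- most `t` in absolute value. This bounds its contribution by `s * (b * t)` and its entries
      -- by `b * (b * t)`. Hence `y` has entries at most `t + b * (b * t)` and generators above
      -- `- s′`, and the bound for `Q` supplies the other summand of the constant.
      step : ∀ {M′ t x} → 0# ≤ M′ → 0# ≤ t → ConeBounded Q M′ → Cone R x → (∀ i → ∣ x i ∣≤ t) →
             - ((b + (b + b) * ((1# + b * b) * M′)) * (s * t)) ≤ dot g x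
      step {M′} {t} {x} 0≤M′ 0≤t bounded c x≤t = go (split c)
        where
        0≤s′ : 0# ≤ s′
        0≤s′ = *-nonNegative (+-nonNegative 0≤b 0≤b) 0≤s
        side : ∀ ε → (∀ {u} → ∣ u ∣≤ t → ε * u ≤ t) → ∀ {y z} → Cone Flat y → Cone (Side.Sd ε) z → x ≈ᵥ y +ᵥ z →
               - ((b + (b + b) * ((1# + b * b) * M′)) * (s * t)) ≤ dot g x
        side ε εu≤t {y} {z} y∈ z∈ e = ≤-trans
          (≤-trans (≤-reflexive (solve 4 (λ b M s t → :- ((b :+ (b :+ b) :* ((:1 :+ b :* b) :* M)) :* (s :* t))
              := :- (M :* (((b :+ b) :* s) :* (t :+ b :* (b :* t)))) :+ :- (s :* (b :* t))) refl b M′ s t))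
            (+-mono-≤ y-bound z-bound))
          (≤-reflexive (sym (trans (dot-cong (λ _ → refl) e) (dot-+ʳ g y z))))
          where
          y₀≈0 : y zero ≈ 0#
          y₀≈0 = zero-on-cone y∈
            where
            zero-on-cone : ∀ {y} → Cone Flat y → y zero ≈ 0#
            zero-on-cone (origin e) = e zero
            zero-on-cone (add l v y p q c f) = trans (f zero) (trans (+-cong (trans (*-congˡ (proj₁ q)) (zeroʳ l)) (zero-on-cone c)) (+-identityˡ _))
          εz₀≤t : ε * z zero ≤ t
          εz₀≤t = ≤-trans (≤-reflexive (*-congˡ (sym (trans (e zero) (trans (+-congʳ y₀≈0) (+-identityˡ _)))))) (εu≤t (x≤t zero))
          z-bound : - (s * (b * t)) ≤ dot g z
          z-bound = ≤-trans (neg-mono-≤ (*-monoˡ-≤ 0≤s (*-monoˡ-≤ 0≤b εz₀≤t))) (Side.dot-bound ε z∈)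
          y≤ : ∀ i → ∣ y (suc i) ∣≤ t + b * (b * t)
          y≤ i = ∣∣≤-resp
            (trans (+-congʳ (e (suc i))) (solve 2 (λ y z → (y :+ z) :+ :- z := y) refl _ _)) refl
            (∣∣≤-+ (x≤t (suc i)) (∣∣≤-neg (∣∣≤-weaken (*-monoˡ-≤ 0≤b (*-monoˡ-≤ 0≤b εz₀≤t)) (Side.entry-bound ε z∈ (suc i)))))
          y-bound : - (M′ * (s′ * (t + b * (b * t)))) ≤ dot g y
          y-bound = ≤-trans (bounded (g ∘ suc) s′ (t + b * (b * t)) (y ∘ suc) 0≤s′
              (+-nonNegative 0≤t (*-nonNegative 0≤b (*-nonNegative 0≤b 0≤t)))
              (cone-map (_∘ suc) (λ e i → e (suc i)) (λ e i → e (suc i)) (λ (u₀≈0 , q , p) → q , ≤-trans p (≤-reflexive (drop u₀≈0))) y∈) y≤)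
            (≤-reflexive (sym (drop y₀≈0)))
            where
            drop : ∀ {u} → u zero ≈ 0# → dot g u ≈ dot (g ∘ suc) (u ∘ suc)
            drop {u} e = trans (dot-suc g u) (trans (+-congʳ (trans (*-congˡ e) (zeroʳ _))) (+-identityˡ _))
        go : Split x → - ((b + (b + b) * ((1# + b * b) * M′)) * (s * t)) ≤ dot g x
        go (y , z , y∈ , inj₁ z∈ , e) = side 1# (λ (_ , u) → ≤-trans (≤-reflexive (*-identityˡ _)) u) y∈
          (cone-⊆ (λ (r , p) → r , ≤-trans p (≤-reflexive (*-congˡ (sym (*-identityˡ _))))) z∈) e
        go (y , z , y∈ , inj₂ z∈ , e) = side (- 1#)
          (λ (l , _) → ≤-trans (≤-reflexive (solve 1 (λ x → (:- :1) :* x := :- x) refl _)) (≤-trans (neg-mono-≤ l) (≤-reflexive (solve 1 (λ x → :- :- x := x) refl _)))) y∈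
          (cone-⊆ (λ (r , p) → r , ≤-trans p (≤-reflexive (*-congˡ (solve 1 (λ x → :- x := (:- :1) :* x) refl _)))) z∈) e

    eliminate : ∀ {M′} → 0# ≤ M′ → ConeBounded Q M′ → ConeBounded P (b + (b + b) * ((1# + b * b) * M′))
    eliminate 0≤M′ bounded g s t x 0≤s 0≤t c x≤t = step g s 0≤s 0≤M′ 0≤t bounded c x≤t

  coneBounded-0 : ∀ (P : ℝ^ 0 → Set) → ConeBounded P 0#
  coneBounded-0 P g s t x _ _ _ _ = ≤-reflexive (trans (solve 1 (λ u → :- (:0 :* u) := :0) refl (s * t)) (sym ∑-empty))

-- Cone bounds for integer boxes and for finite lists

-- The constant of `eliminate`, iterated. Eliminating from integer vectors within `b` leaves integer
-- vectors within `4 * (b * b)`, since each part of such a difference is a sum of four products.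
boxConstant : ℕ → ℕ → ℕ
boxConstant zero    b = 0
boxConstant (suc m) b = b ℕ.+ (b ℕ.+ b) ℕ.* ((1 ℕ.+ b ℕ.* b) ℕ.* boxConstant m (4 ℕ.* (b ℕ.* b)))

module Instances (ℝ : CompleteOrderedField) where
  open CompleteOrderedField ℝ hiding (zero)
  open Euclidean ℝ using (fromℕ; ℝ^; _≈ᵥ_)
  open DifferenceSolver commutativeRing
  open OrderedField ℝ
  open Vectors ℝ
  open ConeBounds ℝ

  -- Both terms of the difference are bounded, not only its absolute value: changes of counts arise
  -- in this form, products expand within it, and the finitely many pairs can be listed.
  IntegerWithin : ℕ → Carrier → Set
  IntegerWithin b x = ∃[ p ] ∃[ q ] (p ℕ.≤ b × q ℕ.≤ b × x ≈ fromℕ p - fromℕ q)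

  Box : ∀ {m} → ℕ → ℝ^ m → Set
  Box b v = ∀ i → IntegerWithin b (v i)

  opaque
    integer-bound : ∀ {b x} → IntegerWithin b x → ∣ x ∣≤ fromℕ b
    integer-bound (p , q , p≤b , q≤b , e) =
        ≤-trans (≤-from (+-nonNegative (fromℕ-nonNegative p) (≤⇒0≤ (fromℕ-mono q≤b)))
          (solve 3 (λ p q b → p :+ (b :- q) := (p :- q) :- :- b) refl _ _ _)) (≤-reflexive (sym e))
      , ≤-trans (≤-reflexive e) (≤-from (+-nonNegative (fromℕ-nonNegative q) (≤⇒0≤ (fromℕ-mono p≤b)))
          (solve 3 (λ p q b → q :+ (b :- p) := b :- (p :- q)) refl _ _ _))

    1≤difference : ∀ {p q} → p ℕ.< q → 1# ≤ fromℕ q - fromℕ p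
    1≤difference {p} {q} p<q = ≤-from (≤⇒0≤ (fromℕ-mono p<q))
      (solve 2 (λ p q → q :- (:1 :+ p) := (q :- p) :- :1) refl (fromℕ p) (fromℕ q))

    enlarge : ∀ {b x} → 1 ℕ.≤ b → 1# ≤ x → 1# ≤ fromℕ b * x
    enlarge {b} 1≤b p = ≤-trans (≤-reflexive (sym (*-identityˡ 1#))) (*-mono-≤ (fromℕ-nonNegative b) 0≤1
      (≤-trans (≤-reflexive (sym fromℕ-1)) (fromℕ-mono 1≤b)) p)

    integer-gap : ∀ {b x} → 1 ℕ.≤ b → IntegerWithin b x → x ≈ 0# ⊎ 1# ≤ fromℕ b * x ⊎ 1# ≤ fromℕ b * - x
    integer-gap {b} {x} 1≤b (p , q , _ , _ , e) with ℕ.<-cmp p q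
    ... | tri≈ _ ≡.refl _ = inj₁ (trans e (-‿inverseʳ _))
    ... | tri> _ _ q<p = inj₂ (inj₁ (enlarge 1≤b (≤-trans (1≤difference q<p) (≤-reflexive (sym e)))))
    ... | tri< p<q _ _ = inj₂ (inj₂ (enlarge 1≤b (≤-trans (1≤difference p<q)
        (≤-reflexive (trans (solve 2 (λ p q → q :- p := :- (p :- q)) refl _ _) (-‿cong (sym e)))))))

    integer-mixed : ∀ {b v w x y} → IntegerWithin b v → IntegerWithin b w → IntegerWithin b x → IntegerWithin b y →
                    IntegerWithin (4 ℕ.* (b ℕ.* b)) (- v * x + w * y)
    integer-mixed {b} (p , q , p≤ , q≤ , e) (p′ , q′ , p′≤ , q′≤ , e′) (a , c , a≤ , c≤ , f) (a′ , c′ , a′≤ , c′≤ , f′) =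
      (q ℕ.* a ℕ.+ p ℕ.* c) ℕ.+ (p′ ℕ.* a′ ℕ.+ q′ ℕ.* c′) ,
      (q ℕ.* c ℕ.+ p ℕ.* a) ℕ.+ (p′ ℕ.* c′ ℕ.+ q′ ℕ.* a′) ,
      four q≤ a≤ p≤ c≤ p′≤ a′≤ q′≤ c′≤ , four q≤ c≤ p≤ a≤ p′≤ c′≤ q′≤ a′≤ ,
      trans (+-cong (*-cong (-‿cong e) f) (*-cong e′ f′))
        (trans (solve 8 (λ p q p′ q′ a c a′ c′ → (:- (p :- q)) :* (a :- c) :+ (p′ :- q′) :* (a′ :- c′)
            := ((q :* a :+ p :* c) :+ (p′ :* a′ :+ q′ :* c′)) :- ((q :* c :+ p :* a) :+ (p′ :* c′ :+ q′ :* a′)))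
            refl (fromℕ p) (fromℕ q) (fromℕ p′) (fromℕ q′) (fromℕ a) (fromℕ c) (fromℕ a′) (fromℕ c′))
          (sym (+-cong (expand q a p c p′ a′ q′ c′) (-‿cong (expand q c p a p′ c′ q′ a′)))))
      where
      four : ∀ {x₁ y₁ x₂ y₂ x₃ y₃ x₄ y₄} → x₁ ℕ.≤ b → y₁ ℕ.≤ b → x₂ ℕ.≤ b → y₂ ℕ.≤ b →
             x₃ ℕ.≤ b → y₃ ℕ.≤ b → x₄ ℕ.≤ b → y₄ ℕ.≤ b →
             (x₁ ℕ.* y₁ ℕ.+ x₂ ℕ.* y₂) ℕ.+ (x₃ ℕ.* y₃ ℕ.+ x₄ ℕ.* y₄) ℕ.≤ 4 ℕ.* (b ℕ.* b)
      four a b′ c d e f g h = ℕ.≤-trans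
        (ℕ.+-mono-≤ (ℕ.+-mono-≤ (ℕ.*-mono-≤ a b′) (ℕ.*-mono-≤ c d)) (ℕ.+-mono-≤ (ℕ.*-mono-≤ e f) (ℕ.*-mono-≤ g h)))
        (ℕ.≤-reflexive (ℕSolver.+-*-Solver.solve 1 (λ x → (x :ℕ+ x) :ℕ+ (x :ℕ+ x) :ℕ= con4 :ℕ* x) ≡.refl (b ℕ.* b)))
        where
        open ℕSolver.+-*-Solver using () renaming (_:+_ to _:ℕ+_; _:*_ to _:ℕ*_; _:=_ to _:ℕ=_; con to conℕ)
        con4 : ∀ {n} → ℕSolver.+-*-Solver.Polynomial n
        con4 = conℕ 4
      expand : ∀ a b c d e f g h → fromℕ ((a ℕ.* b ℕ.+ c ℕ.* d) ℕ.+ (e ℕ.* f ℕ.+ g ℕ.* h))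
        ≈ (fromℕ a * fromℕ b + fromℕ c * fromℕ d) + (fromℕ e * fromℕ f + fromℕ g * fromℕ h)
      expand a b c d e f g h = trans (fromℕ-+ (a ℕ.* b ℕ.+ c ℕ.* d) (e ℕ.* f ℕ.+ g ℕ.* h))
        (+-cong (two a b c d) (two e f g h))
        where
        two : ∀ a b c d → fromℕ (a ℕ.* b ℕ.+ c ℕ.* d) ≈ fromℕ a * fromℕ b + fromℕ c * fromℕ d
        two a b c d = trans (fromℕ-+ (a ℕ.* b) (c ℕ.* d)) (+-cong (fromℕ-* a b) (fromℕ-* c d))

    integer-weaken : ∀ {b c x} → b ℕ.≤ c → IntegerWithin b x → IntegerWithin c x
    integer-weaken b≤c (p , q , p≤b , q≤b , e) = p , q , ℕ.≤-trans p≤b b≤c , ℕ.≤-trans q≤b b≤c , e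

    ConeBounded-cong : ∀ {m} {P : ℝ^ m → Set} {M M′} → M ≈ M′ → ConeBounded P M → ConeBounded P M′
    ConeBounded-cong e f g s t x p q c d = ≤-trans (≤-reflexive (-‿cong (*-congʳ (sym e)))) (f g s t x p q c d)

    -- Integrality keeps the constant explicit. A nonzero integer has absolute value at least one,
    -- so the entry bound `b` also serves for the gap, at every stage of the elimination.
    box-coneBounded : ∀ m b → 1 ℕ.≤ b → ConeBounded (Box {m} b) (fromℕ (boxConstant m b))
    box-coneBounded zero    b 1≤b = coneBounded-0 (Box b)
    box-coneBounded (suc m) b 1≤b = ConeBounded-cong constant
      (Elimination.eliminate (Box b) (Box b′) (fromℕ b) (≤-trans (≤-reflexive (sym fromℕ-1)) (fromℕ-mono 1≤b))
        (λ v∈ i → integer-bound (v∈ i)) (λ v∈ → integer-gap 1≤b (v∈ zero))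
        (λ e x∈ i → let p , q , p≤ , q≤ , f = x∈ i in p , q , p≤ , q≤ , trans (sym (e i)) f)
        (λ v∈ _ i → integer-weaken b≤b′ (v∈ (suc i)))
        (λ w∈ v∈ _ _ i → integer-mixed (v∈ zero) (w∈ zero) (w∈ (suc i)) (v∈ (suc i)))
        (fromℕ-nonNegative M′) (box-coneBounded m b′ (ℕ.≤-trans 1≤b b≤b′)))
      where
      b′ M′ : ℕ
      b′ = 4 ℕ.* (b ℕ.* b)
      M′ = boxConstant m b′
      b≤b′ : b ℕ.≤ b′
      b≤b′ = ℕ.≤-trans (ℕ.≤-trans (ℕ.≤-reflexive (≡.sym (ℕ.*-identityʳ b))) (ℕ.*-monoʳ-≤ b 1≤b)) (ℕ.m≤n*m (b ℕ.* b) 4)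
      constant : fromℕ b + (fromℕ b + fromℕ b) * ((1# + fromℕ b * fromℕ b) * fromℕ M′) ≈ fromℕ (boxConstant (suc m) b)
      constant = sym (trans (fromℕ-+ b ((b ℕ.+ b) ℕ.* ((1 ℕ.+ b ℕ.* b) ℕ.* M′))) (+-congˡ
        (trans (fromℕ-* (b ℕ.+ b) ((1 ℕ.+ b ℕ.* b) ℕ.* M′)) (*-cong (fromℕ-+ b b)
          (trans (fromℕ-* (1 ℕ.+ b ℕ.* b) M′) (*-congʳ (+-congˡ (fromℕ-* b b))))))))

  Listed : ∀ {m} → List (ℝ^ m) → ℝ^ m → Set
  Listed L v = Any (v ≈ᵥ_) L

  Separated : ∀ {m} → Carrier → ℝ^ m → Set
  Separated b v = (∀ i → ∣ v i ∣≤ b) × (∀ i → v i ≈ 0# ⊎ 1# ≤ b * v i ⊎ 1# ≤ b * - v i)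

  opaque
    scale-gap : ∀ {b c x} → 0# ≤ b → b ≤ c → 1# ≤ b * x → 1# ≤ c * x
    scale-gap {b} {c} {x} 0≤b b≤c p = ≤-trans p (*-monoʳ-≤ 0≤x b≤c)
      where
      0≤x : 0# ≤ x
      0≤x with total 0# x
      ... | inj₁ q = q
      ... | inj₂ q = ⊥-elim (<⇒≱ 0<1 (≤-trans p (≤-trans (*-monoˡ-≤ 0≤b q) (≤-reflexive (zeroʳ b)))))

    separated-weaken : ∀ {m b c} {v : ℝ^ m} → 0# ≤ b → b ≤ c → Separated b v → Separated c v
    separated-weaken {b = b} {c} {v} 0≤b b≤c (p , q) = (λ i → ∣∣≤-weaken b≤c (p i)) , λ i → gap i (q i)
      where
      gap : ∀ i → v i ≈ 0# ⊎ 1# ≤ b * v i ⊎ 1# ≤ b * - v i → v i ≈ 0# ⊎ 1# ≤ c * v i ⊎ 1# ≤ c * - v i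
      gap i (inj₁ e)        = inj₁ e
      gap i (inj₂ (inj₁ r)) = inj₂ (inj₁ (scale-gap 0≤b b≤c r))
      gap i (inj₂ (inj₂ r)) = inj₂ (inj₂ (scale-gap 0≤b b≤c r))

    -- The number `1 + y + y ⁻¹`, for `y` the absolute value of a nonzero `x`, bounds `x` and the
    -- inverse of its distance from zero at the same time.
    separate-scalar : ∀ x → ∃[ b ] (1# ≤ b × ∣ x ∣≤ b × (x ≈ 0# ⊎ 1# ≤ b * x ⊎ 1# ≤ b * - x))
    separate-scalar x with x ≟ 0#
    ... | yes x≈0 = 1# , ≤-refl , ∣0∣≤ x≈0 0≤1 , inj₁ x≈0
    ... | no  x≉0 with total 0# x
    ...   | inj₁ 0≤x = 1# + (x + x ⁻¹)
            , ≤-from (+-nonNegative 0≤x 0≤x⁻¹) (solve 2 (λ x i → x :+ i := (:1 :+ (x :+ i)) :- :1) refl x (x ⁻¹))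
            , nonNegative⇒∣∣≤ 0≤x (≤-from (+-nonNegative 0≤1 0≤x⁻¹) (solve 2 (λ x i → :1 :+ i := (:1 :+ (x :+ i)) :- x) refl x (x ⁻¹)))
            , inj₂ (inj₁ (≤-from (*-nonNegative (+-nonNegative 0≤1 0≤x) 0≤x)
                (trans (solve 2 (λ x i → (:1 :+ x) :* x := (:1 :+ (x :+ i)) :* x :- x :* i) refl x (x ⁻¹))
                       (+-congˡ (-‿cong (*-inverseʳ x≉0))))))
      where
      0≤x⁻¹ : 0# ≤ x ⁻¹
      0≤x⁻¹ = inverse-nonNegative (0≤x , x≉0 ∘ sym)
    ...   | inj₂ x≤0 = 1# + (y + y ⁻¹)
            , ≤-from (+-nonNegative 0≤y 0≤y⁻¹) (solve 2 (λ x i → x :+ i := (:1 :+ (x :+ i)) :- :1) refl y (y ⁻¹))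
            , ∣∣≤-resp (solve 1 (λ x → :- :- x := x) refl x) refl (∣∣≤-neg {y} (nonNegative⇒∣∣≤ 0≤y
                (≤-from (+-nonNegative 0≤1 0≤y⁻¹) (solve 2 (λ x i → :1 :+ i := (:1 :+ (x :+ i)) :- x) refl y (y ⁻¹)))))
            , inj₂ (inj₂ (≤-from (*-nonNegative (+-nonNegative 0≤1 0≤y) 0≤y)
                (trans (solve 2 (λ x i → (:1 :+ x) :* x := (:1 :+ (x :+ i)) :* x :- x :* i) refl y (y ⁻¹))
                       (+-congˡ (-‿cong (*-inverseʳ y≉0))))))
      where
      y : Carrier
      y = - x
      0≤y : 0# ≤ y
      0≤y = 0≤-x x≤0
      y≉0 : ¬ y ≈ 0#
      y≉0 e = x≉0 (trans (solve 1 (λ x → x := :- :- x) refl x) (trans (-‿cong e) (solve 0 (:- :0 := :0) refl)))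
      0≤y⁻¹ : 0# ≤ y ⁻¹
      0≤y⁻¹ = inverse-nonNegative (0≤y , y≉0 ∘ sym)

    separate-vector : ∀ {m} (v : ℝ^ m) → ∃[ b ] (1# ≤ b × Separated b v)
    separate-vector {zero}  v = 1# , ≤-refl , (λ ()) , (λ ())
    separate-vector {suc m} v with separate-scalar (v zero) | separate-vector (v ∘ suc)
    ... | b , 1≤b , p , q | c , 1≤c , r = b + c , ≤-trans 1≤b b≤b+c ,
      (λ { zero → ∣∣≤-weaken b≤b+c p ; (suc i) → proj₁ r′ i }) , λ { zero → proj₂ q′ zero ; (suc i) → proj₂ r′ i }
      where
      0≤b : 0# ≤ b
      0≤b = ≤-trans 0≤1 1≤b
      0≤c : 0# ≤ c
      0≤c = ≤-trans 0≤1 1≤c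
      b≤b+c : b ≤ b + c
      b≤b+c = ≤-from 0≤c (solve 2 (λ b c → c := (b :+ c) :- b) refl b c)
      r′ : Separated (b + c) (v ∘ suc)
      r′ = separated-weaken 0≤c (≤-from 0≤b (solve 2 (λ b c → b := (b :+ c) :- c) refl b c)) r
      q′ : Separated {1} (b + c) (λ _ → v zero)
      q′ = separated-weaken 0≤b b≤b+c ((λ _ → p) , (λ _ → q))

    separate-list : ∀ {m} (L : List (ℝ^ m)) → ∃[ b ] (1# ≤ b × (∀ {v} → Listed L v → Separated b v))
    separate-list []      = 1# , ≤-refl , λ ()
    separate-list (u ∷ L) with separate-vector u | separate-list L
    ... | b , 1≤b , p | c , 1≤c , q = b + c , ≤-trans 1≤b b≤b+c , λ
      { (here e)  → separated-resp e (separated-weaken 0≤b b≤b+c p)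
      ; (there m) → separated-weaken 0≤c (≤-from 0≤b (solve 2 (λ b c → b := (b :+ c) :- c) refl b c)) (q m) }
      where
      0≤b : 0# ≤ b
      0≤b = ≤-trans 0≤1 1≤b
      0≤c : 0# ≤ c
      0≤c = ≤-trans 0≤1 1≤c
      b≤b+c : b ≤ b + c
      b≤b+c = ≤-from 0≤c (solve 2 (λ b c → c := (b :+ c) :- b) refl b c)
      separated-resp : ∀ {v} → v ≈ᵥ u → Separated (b + c) u → Separated (b + c) v
      separated-resp {v} e (p , q) = (λ i → ∣∣≤-resp (sym (e i)) refl (p i)) , λ i → gap i (q i)
        where
        gap : ∀ i → u i ≈ 0# ⊎ 1# ≤ (b + c) * u i ⊎ 1# ≤ (b + c) * - u i →
              v i ≈ 0# ⊎ 1# ≤ (b + c) * v i ⊎ 1# ≤ (b + c) * - v i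
        gap i (inj₁ f)        = inj₁ (trans (e i) f)
        gap i (inj₂ (inj₁ f)) = inj₂ (inj₁ (≤-trans f (≤-reflexive (*-congˡ (sym (e i))))))
        gap i (inj₂ (inj₂ f)) = inj₂ (inj₂ (≤-trans f (≤-reflexive (*-congˡ (-‿cong (sym (e i)))))))

    -- For real vectors the gap comes from finiteness instead of integrality. Elimination turns a
    -- finite list into another finite list, so a new gap is available in each dimension, though
    -- without an explicit value.
    list-coneBounded : ∀ {m} (L : List (ℝ^ m)) → ∃[ M ] (0# ≤ M × ConeBounded (Listed L) M)
    list-coneBounded {zero}  L = 0# , ≤-refl , coneBounded-0 _
    list-coneBounded {suc m} L with separate-list L
    ... | b , 1≤b , separated with list-coneBounded (List.map (_∘ suc) L List.++ List.cartesianProductWith mix L L)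
      where
      mix : ℝ^ (suc m) → ℝ^ (suc m) → ℝ^ m
      mix w v i = - v zero * w (suc i) + w zero * v (suc i)
    ...   | M′ , 0≤M′ , bounded = _ , nonNegative ,
      Elimination.eliminate (Listed L) (Listed _) b 1≤b (λ v∈ → proj₁ (separated v∈)) (λ v∈ → proj₂ (separated v∈) zero)
        (λ e → Any.map λ f i → trans (sym (e i)) (f i))
        (λ v∈ _ → Any.++⁺ˡ (Any.map⁺ (Any.map (_∘ suc) v∈)))
        (λ w∈ v∈ _ _ → Any.++⁺ʳ _ (Any.cartesianProductWith⁺ _
          (λ e f i → +-cong (*-cong (-‿cong (f zero)) (e (suc i))) (*-cong (e zero) (f (suc i)))) w∈ v∈))
        0≤M′ bounded
      where
      0≤b : 0# ≤ b
      0≤b = ≤-trans 0≤1 1≤b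
      nonNegative : 0# ≤ b + (b + b) * ((1# + b * b) * M′)
      nonNegative = +-nonNegative 0≤b (*-nonNegative (+-nonNegative 0≤b 0≤b)
        (*-nonNegative (+-nonNegative 0≤1 (*-nonNegative 0≤b 0≤b)) 0≤M′))

-- Confinement of the colour sum: arbitrary finite colour sets

-- The second factor is `1 + R`, where `R = 2 k b²` bounds the squared length of the change of
-- colour sum caused by one shift of a simplex colouring.
simplexConstant : ℕ → ℕ → ℕ
simplexConstant k b = boxConstant k b ℕ.* (1 ℕ.+ 2 ℕ.* (k ℕ.* (b ℕ.* b)))

module Confinement (ℝ : CompleteOrderedField) where
  open CompleteOrderedField ℝ hiding (zero)
  open Euclidean ℝ using (fromℕ; ℝ^; _≈ᵥ_; 0ᵥ; _+ᵥ_; _-ᵥ_; _*ᵥ_; ‖_‖; ∑ᵥ; AffinelyIndependent; IsRegularSimplex)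
  open DifferenceSolver commutativeRing
  open OrderedField ℝ
  open Vectors ℝ
  open ConeBounds ℝ
  open Instances ℝ

  -- Change of the colour counts under one move. The sum vanishes because a move keeps the number of
  -- edges.
  Shift : ∀ {k} → ℕ → ℝ^ k → Set
  Shift {k} b a = ∑ k a ≈ 0# × Box b a

  module _ {k d} (S : Fin k → ℝ^ d) where

    combination : ℝ^ k → ℝ^ d
    combination x i = ∑ k (λ j → x j * S j i)

    NonDecreasing : ℕ → ℝ^ d → ℝ^ k → Set
    NonDecreasing b σ a = Shift b a × dot σ σ - 1# ≤ dot (σ +ᵥ combination a) (σ +ᵥ combination a)

    -- The interface between the geometry of the colours and the combinatorics of the factors: all
    -- that is asked of `S` from here on is such an `M`, which may not depend on `σ`.
    Confined : ℕ → Carrier → Set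
    Confined b M = ∀ σ {x} → Cone (NonDecreasing b σ) x → - (M * ∥ combination x ∥) ≤ dot σ (combination x)

    opaque
      combination-cong : ∀ {x y} → x ≈ᵥ y → combination x ≈ᵥ combination y
      combination-cong e i = ∑-cong λ j → *-congʳ (e j)

    opaque
      combination-zero : ∀ {x} → x ≈ᵥ 0ᵥ → combination x ≈ᵥ 0ᵥ
      combination-zero e i = ∑-zero λ j → trans (*-congʳ (e j)) (zeroˡ _)

    opaque
      combination-linear : ∀ {x l v y} → x ≈ᵥ l *ᵥ v +ᵥ y → combination x ≈ᵥ l *ᵥ combination v +ᵥ combination y
      combination-linear {x} {l} {v} {y} e i = trans
        (∑-cong λ j → trans (*-congʳ (e j)) (solve 4 (λ l v y s → (l :* v :+ y) :* s := l :* (v :* s) :+ y :* s) refl l (v j) (y j) (S j i)))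
        (trans (∑-+ _ _) (+-congʳ (sym (*-∑ l _))))

    opaque
      dot-combination : ∀ g x → dot g (combination x) ≈ ∑ k (λ j → x j * dot g (S j))
      dot-combination g x = trans (∑-cong λ i → *-∑ (g i) _) (trans (∑-swap _) (∑-cong λ j →
        trans (∑-cong λ i → solve 3 (λ g x s → g :* (x :* s) := x :* (g :* s)) refl (g i) (x j) (S j i)) (sym (*-∑ (x j) _))))

  opaque
    -- Expanding the square gives `2 ⟨σ, v⟩ ≥ - 1 - ‖v‖²`, and the right-hand side is at least
    -- `- (1 + R)`. Giving away a factor two avoids halves.
    near-minimal-bound : ∀ {d R} {σ v : ℝ^ d} → dot σ σ - 1# ≤ dot (σ +ᵥ v) (σ +ᵥ v) → dot v v ≤ R → - (1# + R) ≤ dot σ v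
    near-minimal-bound {R = R} {σ} {v} p q = 0≤⇒≤ (half-nonNegative (0≤-resp
      (solve 4 (λ s c n R → ((((s :+ (c :+ c)) :+ n) :- (s :- :1)) :+ ((R :- n) :+ R)) :+ :1 := (c :- :- (:1 :+ R)) :+ (c :- :- (:1 :+ R)))
        refl (dot σ σ) (dot σ v) (dot v v) R)
      (+-nonNegative (+-nonNegative
        (≤⇒0≤ (≤-trans p (≤-reflexive (dot-square-+ σ v))))
        (+-nonNegative (≤⇒0≤ q) (≤-trans (∑-nonNegative (λ i → square-nonNegative (v i))) q))) 0≤1)))
      where open SquareRoot ℝ using (square-nonNegative)

  opaque
    combination-list : ∀ {k d} (S : Fin k → ℝ^ d) (b : ℕ) → ∃[ L ] (∀ {a} → Box b a → Listed L (combination S a))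
    combination-list {zero}  S b = 0ᵥ ∷ [] , λ _ → here λ i → ∑-empty
    combination-list {suc k} S b with combination-list (S ∘ suc) b
    ... | L , listed = List.cartesianProductWith (λ x u i → x * S zero i + u i) integers L , λ {a} box →
      Any.cartesianProductWith⁺ _ (λ e f i → trans ∑-suc (+-cong (*-congʳ e) (f i))) (integers-complete (box zero)) (listed (box ∘ suc))
      where
      integers : List Carrier
      integers = List.cartesianProductWith (λ p q → fromℕ p - fromℕ q) (List.upTo (suc b)) (List.upTo (suc b))
      naturals-complete : ∀ {p} → p ℕ.≤ b → Any (p ≡_) (List.upTo (suc b))
      naturals-complete {p} p≤b = Any.applyUpTo⁺ (λ x → x) ≡.refl (s≤s p≤b)
      integers-complete : ∀ {x} → IntegerWithin b x → Any (x ≈_) integers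
      integers-complete (p , q , p≤b , q≤b , e) = Any.cartesianProductWith⁺ _
        (λ e₁ e₂ → trans e (+-cong (reflexive (≡.cong fromℕ e₁)) (-‿cong (reflexive (≡.cong fromℕ e₂)))))
        (naturals-complete p≤b) (naturals-complete q≤b)

  opaque
    -- The elimination takes place in the colour space, on the finitely many vectors
    -- `combination S a`. Only the entries of `combination S x` need a bound there, and its norm
    -- bounds them; the coefficients `x` themselves may be large when the colours are dependent.
    finite-confined : ∀ {k d} (S : Fin k → ℝ^ d) b → ∃[ M ] (0# ≤ M × Confined S b M)
    finite-confined {k} {d} S b with combination-list S b
    ... | L , listed with separate-list L | list-coneBounded L
    ...   | c , 1≤c , separated | M , 0≤M , bounded = M * (1# + R) , *-nonNegative 0≤M 0≤s , λ σ {x} x∈ →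
      ≤-trans (≤-reflexive (-‿cong (*-assoc M (1# + R) _)))
        (bounded σ (1# + R) ∥ combination S x ∥ (combination S x) 0≤s (∥∥-nonNegative (combination S x))
          (cone-map (combination S) (combination-zero S) (combination-linear S)
            (λ ((_ , box) , p) → listed box , near-minimal-bound p (small (listed box))) x∈)
          (entry≤∥∥ (combination S x)))
      where
      R : Carrier
      R = fromℕ d * (c * c)
      0≤c : 0# ≤ c
      0≤c = ≤-trans 0≤1 1≤c
      0≤s : 0# ≤ 1# + R
      0≤s = +-nonNegative 0≤1 (*-nonNegative (fromℕ-nonNegative d) (*-nonNegative 0≤c 0≤c))
      small : ∀ {v} → Listed L v → dot v v ≤ R
      small v∈ = ≤-trans (∑-mono-≤ λ i → ∣∣≤⇒square (proj₁ (separated v∈) i)) (≤-reflexive (∑-const d (c * c)))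

  opaque
    -- Gaussian elimination on the coordinate `zero`. If it vanishes on all vectors, the first
    -- vector gets coefficient zero and the others are treated one dimension lower. Otherwise `v j`
    -- is a pivot: the others are reduced by cross-multiplication, and the coefficient of `v j` is
    -- chosen to cancel the coordinate `zero`.
    dependent : ∀ {m} (v : Fin (suc m) → ℝ^ m) → ∃[ a ] ((∃[ j ] ¬ a j ≈ 0#) × combination v a ≈ᵥ 0ᵥ)
    dependent {zero}  v = (λ _ → 1#) , (zero , 0≉1 ∘ sym) , λ ()
    dependent {suc m} v with Fin.any? (λ j → ¬? (v j zero ≟ 0#))
    ... | no all-zero with dependent (λ j → v (suc j) ∘ suc)
    ...   | a , (j , aj≉0) , e = (λ { zero → 0# ; (suc i) → a i }) , (suc j , aj≉0) , λ
      { zero    → ∑-zero λ j → trans (*-congˡ (decidable-stable (v j zero ≟ 0#) λ p → all-zero (j , p))) (zeroʳ _)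
      ; (suc i) → trans ∑-suc (trans (+-congʳ (zeroˡ _)) (trans (+-identityˡ _) (e i))) }
    dependent {suc m} v | yes (j , p≉0) with dependent (λ i l → v j zero * v (punchIn j i) (suc l) - v (punchIn j i) zero * v j (suc l))
    ...   | a , (i , ai≉0) , e = a′ , (punchIn j i , λ f → ai≉0 (*-cancelˡ-0 p≉0 (trans (sym (a′-others i)) f))) , vanishes
      where
      p : Carrier
      p = v j zero
      c : Fin (suc m) → Carrier
      c i = v (punchIn j i) zero
      a′ : Fin (suc (suc m)) → Carrier
      a′ = insertAt (λ i → p * a i) j (- ∑ (suc m) (λ i → a i * c i))
      a′-others : ∀ i → a′ (punchIn j i) ≈ p * a i
      a′-others i = reflexive (Vector.insertAt-punchIn (λ i → p * a i) j _ i)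
      expand : ∀ l → combination v a′ l ≈ ∑ (suc m) (λ i → a i * (p * v (punchIn j i) l - c i * v j l))
      expand l = trans (∑-remove _ j) (trans (+-cong
        (trans (*-congʳ (reflexive (Vector.insertAt-lookup (λ i → p * a i) j _)))
          (trans (solve 2 (λ s x → (:- s) :* x := s :* (:- x)) refl _ _) (∑-*ʳ _ _)))
        (∑-cong λ i → *-congʳ (a′-others i)))
        (trans (sym (∑-+ _ _)) (∑-cong λ i → solve 5 (λ a c x p y → (a :* c) :* (:- x) :+ (p :* a) :* y := a :* (p :* y :- c :* x))
          refl (a i) (c i) (v j l) p (v (punchIn j i) l))))
      vanishes : combination v a′ ≈ᵥ 0ᵥ
      vanishes zero    = trans (expand zero) (∑-zero λ i → trans (*-congˡ (solve 2 (λ p c → p :* c :- c :* p := :0) refl p (c i))) (zeroʳ _))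
      vanishes (suc l) = trans (expand (suc l)) (e l)

  opaque
    ∑ᵥ-tabulate : ∀ {A : Set} {d n} (g : Fin n → A) (F : A → ℝ^ d) i → ∑ᵥ (List.tabulate g) F i ≈ ∑ n (λ j → F (g j) i)
    ∑ᵥ-tabulate {n = zero}  g F i = sym ∑-empty
    ∑ᵥ-tabulate {n = suc n} g F i = trans (+-congˡ (∑ᵥ-tabulate (g ∘ suc) F i)) (sym ∑-suc)

  opaque
    ∑-others : ∀ {n} (f : Fin n → Carrier) (t : Fin n → Carrier) i {c} → (∀ j → j ≢ i → t j ≈ c) →
               ∑ n (λ j → f j * t j) ≈ f i * t i + (∑ n f - f i) * c
    ∑-others {suc n} f t i {c} e = trans (∑-remove _ i) (+-congˡ (trans
      (∑-cong λ j → *-congˡ (e (punchIn i j) (Fin.punchInᵢ≢i i j)))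
      (trans (sym (∑-*ʳ c _)) (*-congʳ (trans (solve 2 (λ x y → y := (x :+ y) :- x) refl (f i) _) (+-congʳ (sym (∑-remove f i))))))))

  -- Confinement for a regular simplex

  module Simplex {k d} (S : Fin k → ℝ^ d) (unit : ∀ i → ‖ S i ‖ ≈ 1#) (regular : IsRegularSimplex S) (2≤k : 2 ℕ.≤ k) (1≤d : 1 ℕ.≤ d) where

    private
      ℓ : Carrier
      ℓ = proj₁ (proj₂ (proj₂ regular))

      i₀ i₁ : Fin k
      i₀ = Fin.fromℕ< 2≤k₀ where 2≤k₀ = ℕ.≤-trans (s≤s z≤n) 2≤k
      i₁ = Fin.fromℕ< 2≤k

      t : Carrier
      t = dot (S i₀) (S i₁)

      opaque
        i₀≢i₁ : i₀ ≢ i₁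
        i₀≢i₁ e with ≡.trans (≡.sym (Fin.toℕ-fromℕ< _)) (≡.trans (≡.cong Fin.toℕ e) (Fin.toℕ-fromℕ< 2≤k))
        ... | ()

      opaque
        square-unit : ∀ i → dot (S i) (S i) ≈ 1#
        square-unit i = trans (sym (∥∥-square (S i))) (trans (*-cong unit′ unit′) (*-identityˡ 1#))
          where
          unit′ : ∥ S i ∥ ≈ 1#
          unit′ = trans (∥∥≈‖‖ (S i)) (unit i)

      opaque
        distance : ∀ {i j} → i ≢ j → dot (S i) (S j) + dot (S i) (S j) ≈ (1# + 1#) - ℓ * ℓ
        distance {i} {j} i≢j = trans
          (solve 2 (λ x n → x :+ x := (:1 :+ :1) :- (((:1 :+ (:- x :+ :- x)) :+ :1))) refl (dot (S i) (S j)) ℓ)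
          (+-congˡ (-‿cong (trans (sym expand) (trans (sym (∥∥-square (S i -ᵥ S j))) (*-cong length length)))))
          where
          length : ∥ S i -ᵥ S j ∥ ≈ ℓ
          length = trans (∥∥≈‖‖ (S i -ᵥ S j)) (proj₂ (proj₂ (proj₂ regular)) i j i≢j)
          negated : dot (S i) ((- 1#) *ᵥ S j) ≈ - dot (S i) (S j)
          negated = trans (dot-*ʳ (S i) (- 1#) (S j)) (solve 1 (λ x → (:- :1) :* x := :- x) refl _)
          expand : dot (S i -ᵥ S j) (S i -ᵥ S j) ≈ (1# + (- dot (S i) (S j) + - dot (S i) (S j))) + 1#
          expand = trans (dot-cong neg neg) (trans (dot-square-+ (S i) ((- 1#) *ᵥ S j))
            (+-cong (+-cong (square-unit i) (+-cong negated negated))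
              (trans (dot-*ˡ (- 1#) (S j) _) (trans (*-congˡ (trans (dot-*ʳ (S j) (- 1#) (S j)) (*-congˡ (square-unit j))))
                (solve 0 ((:- :1) :* ((:- :1) :* :1) := :1) refl)))))
            where
            neg : S i -ᵥ S j ≈ᵥ S i +ᵥ (- 1#) *ᵥ S j
            neg l = +-congˡ (solve 1 (λ x → :- x := (:- :1) :* x) refl (S j l))

      opaque
        double-cancel : ∀ {x y} → x + x ≈ y + y → x ≈ y
        double-cancel {x} {y} e = *-cancelˡ-≈ {z = 1# + 1#} 1+1≉0
          (trans (double x) (trans e (sym (double y))))
          where
          double : ∀ x → (1# + 1#) * x ≈ x + x
          double = solve 1 (λ x → (:1 :+ :1) :* x := x :+ x) refl
          1+1≉0 : ¬ 1# + 1# ≈ 0#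
          1+1≉0 e = <⇒≱ 0<1 (≤-trans (≤-from 0≤1 (solve 0 (:1 := (:1 :+ :1) :- :1) refl)) (≤-reflexive e))

      opaque
        gram : ∀ {i j} → i ≢ j → dot (S i) (S j) ≈ t
        gram i≢j = double-cancel (trans (distance i≢j) (sym (distance i₀≢i₁)))

      opaque
        dot-vertex : ∀ x i → dot (S i) (combination S x) ≈ (1# - t) * x i + t * ∑ k x
        dot-vertex x i = trans (dot-combination S (S i) x) (trans (∑-others x (λ j → dot (S i) (S j)) i (λ j j≢i → gram (j≢i ∘ ≡.sym)))
          (trans (+-congʳ (*-congˡ (square-unit i))) (solve 3 (λ x s t → x :* :1 :+ (s :- x) :* t := (:1 :- t) :* x :+ t :* s) refl (x i) (∑ k x) t)))

      opaque
        -- A linear relation exists because there are `d + 1` vectors; if its coefficients summed to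
        -- zero, affine independence would make all of them vanish.
        dependence : ∃[ a ] (¬ ∑ k a ≈ 0# × combination S a ≈ᵥ 0ᵥ)
        dependence = find (proj₁ regular) S (proj₁ (proj₂ regular))
          where
          find : ∀ {k} → k ≡ suc d → (S : Fin k → ℝ^ d) → AffinelyIndependent S → ∃[ a ] (¬ ∑ k a ≈ 0# × combination S a ≈ᵥ 0ᵥ)
          find ≡.refl S independent with dependent S
          ... | a , (j , aj≉0) , e = a , (λ s → aj≉0 (independent a (trans (sym (∑≈sum a)) s)
            (λ i → trans (∑ᵥ-tabulate (λ j → j) (λ j → a j *ᵥ S j) i) (e i)) j)) , e

      opaque
        -- Pairing the linear relation `a` with every vertex and adding up yields
        -- `A * (1 + d * t) = 0`, where the total `A` of `a` is nonzero. So the common inner product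
        -- is `- 1 / d`.
        relation : 1# + fromℕ d * t ≈ 0#
        relation = *-cancelˡ-0 (proj₁ (proj₂ dependence)) (trans (sym total-zero) (∑-zero λ i →
            trans (sym (dot-vertex a i)) (dot-zeroʳ (S i) (proj₂ (proj₂ dependence)))))
          where
          a : ℝ^ k
          a = proj₁ dependence
          A : Carrier
          A = ∑ k a
          k≈ : fromℕ k ≈ 1# + fromℕ d
          k≈ = reflexive (≡.cong fromℕ (proj₁ regular))
          total-zero : ∑ k (λ i → (1# - t) * a i + t * A) ≈ A * (1# + fromℕ d * t)
          total-zero = trans (∑-+ _ _) (trans (+-cong (sym (*-∑ _ _)) (trans (∑-const k _) (*-congʳ k≈)))
            (solve 3 (λ A t d → (:1 :- t) :* A :+ (:1 :+ d) :* (t :* A) := A :* (:1 :+ d :* t)) refl A t (fromℕ d)))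

      opaque
        t≤0 : t ≤ 0#
        t≤0 with total t 0#
        ... | inj₁ p = p
        ... | inj₂ p = ⊥-elim (<⇒≱ 0<1 (≤-trans (≤-from (*-nonNegative (fromℕ-nonNegative d) p)
          (solve 1 (λ x → x := (:1 :+ x) :- :1) refl _)) (≤-reflexive relation)))

      opaque
        -t≤1 : - t ≤ 1#
        -t≤1 = ≤-from (*-nonNegative (≤⇒0≤ (fromℕ-mono 1≤d)) (0≤-x t≤0))
          (trans (*-congʳ (+-congˡ (-‿cong fromℕ-1))) (trans (solve 2 (λ d t → (d :- :1) :* (:- t) := (:1 :- :- t) :- (:1 :+ d :* t)) refl (fromℕ d) t)
            (trans (+-congˡ (-‿cong relation)) (solve 1 (λ x → x :- :0 := x) refl _))))

      opaque
        -- The Gram matrix of the vertices is `(1 - t) I + t J` with `J` the all-ones matrix, and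
        -- `J` kills vectors of sum zero.
        square-combination : ∀ x → ∑ k x ≈ 0# → dot (combination S x) (combination S x) ≈ (1# - t) * dot x x
        square-combination x e = trans (dot-combination S _ x) (trans (∑-cong λ j → trans
          (*-congˡ (trans (dot-comm _ _) (trans (dot-vertex x j) (trans (+-congˡ (trans (*-congˡ e) (zeroʳ t))) (+-identityʳ _)))))
          (solve 2 (λ w x → x :* (w :* x) := w :* (x :* x)) refl (1# - t) (x j))) (sym (*-∑ _ _)))

    opaque
      -- Here the elimination takes place in the space of coefficients, where generators are
      -- integral, with the functional `dot σ (S j)`. On sum-zero vectors the squared norm is scaled
      -- by `1 - t`, which lies between 1 and 2: the upper bound gives `R`, and the lower bound
      -- controls the entries of `x` by the norm of `combination S x`.
      simplex-confined : ∀ b → 1 ℕ.≤ b → Confined S b (fromℕ (simplexConstant k b))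
      simplex-confined b 1≤b σ {x} x∈ = ≤-trans (≤-reflexive constant) (≤-trans
        (box-coneBounded k b 1≤b (λ j → dot σ (S j)) s ∥ combination S x ∥ x 0≤s (∥∥-nonNegative (combination S x))
          (cone-⊆ (λ {a} ((a∑ , box) , p) → box , ≤-trans (near-minimal-bound p (small a∑ box))
            (≤-reflexive (trans (dot-combination S σ a) (dot-comm a _)))) x∈) entries)
        (≤-reflexive (trans (dot-comm _ x) (sym (dot-combination S σ x)))))
        where
        R s : Carrier
        R = (1# + 1#) * (fromℕ k * (fromℕ b * fromℕ b))
        s = 1# + R
        0≤R : 0# ≤ R
        0≤R = *-nonNegative (+-nonNegative 0≤1 0≤1) (*-nonNegative (fromℕ-nonNegative k) (*-nonNegative (fromℕ-nonNegative b) (fromℕ-nonNegative b)))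
        0≤s : 0# ≤ s
        0≤s = +-nonNegative 0≤1 0≤R
        constant : - (fromℕ (simplexConstant k b) * ∥ combination S x ∥) ≈ - (fromℕ (boxConstant k b) * (s * ∥ combination S x ∥))
        constant = -‿cong (trans (*-congʳ (trans (fromℕ-* (boxConstant k b) _) (*-congˡ (+-congˡ
          (trans (fromℕ-* 2 (k ℕ.* (b ℕ.* b))) (*-cong (+-congˡ fromℕ-1) (trans (fromℕ-* k (b ℕ.* b)) (*-congˡ (fromℕ-* b b))))))))) (*-assoc _ _ _))
        small : ∀ {a} → ∑ k a ≈ 0# → Box b a → dot (combination S a) (combination S a) ≤ R
        small {a} a∑ box = ≤-trans (≤-reflexive (square-combination a a∑))
          (*-mono-≤ (+-nonNegative 0≤1 0≤1) (∑-nonNegative λ i → square-nonNegative (a i)) (+-mono-≤ ≤-refl -t≤1)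
            (≤-trans (∑-mono-≤ λ i → ∣∣≤⇒square (integer-bound (box i))) (≤-reflexive (∑-const k _))))
          where open SquareRoot ℝ using (square-nonNegative)
        x∑ : ∑ k x ≈ 0#
        x∑ = sum-zero x∈
          where
          sum-zero : ∀ {x} → Cone (NonDecreasing S b σ) x → ∑ k x ≈ 0#
          sum-zero (origin e) = ∑-zero e
          sum-zero (add l v y p ((v∑ , _) , _) c e) = trans (∑-cong e) (trans (∑-+ _ _)
            (trans (+-cong (trans (sym (*-∑ l v)) (trans (*-congˡ v∑) (zeroʳ l))) (sum-zero c)) (+-identityˡ _)))
        entries : ∀ i → ∣ x i ∣≤ ∥ combination S x ∥
        entries i = square⇒∣∣≤ (∥∥-nonNegative (combination S x)) (≤-trans (term≤∑ (λ j → square-nonNegative (x j)) i)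
          (≤-trans (≤-from (*-nonNegative (0≤-x t≤0) (∑-nonNegative λ j → square-nonNegative (x j)))
            (solve 2 (λ t n → (:- t) :* n := (:1 :- t) :* n :- n) refl t (dot x x)))
            (≤-reflexive (trans (sym (square-combination x x∑)) (sym (∥∥-square (combination S x)))))))
          where open SquareRoot ℝ using (square-nonNegative)

-- Near-minimisers and completing the square

module Descent (ℝ : CompleteOrderedField) where
  open CompleteOrderedField ℝ hiding (zero)
  open Euclidean ℝ using (ℝ^; _≈ᵥ_; _+ᵥ_; _-ᵥ_; _*ᵥ_)
  open DifferenceSolver commutativeRing
  open OrderedField ℝ
  open Vectors ℝ
  open Confinement ℝ
  open SquareRoot ℝ using (square-nonNegative)

  opaque
    x-1<x : ∀ x → x - 1# < x
    x-1<x x = ≰⇒> λ p → <⇒≱ 0<1 (≤-from (≤⇒0≤ p) (solve 1 (λ s → (s :- :1) :- s := :0 :- :1) refl x))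

    near-below : ∀ {t x y s} → t ≈ - x → s - 1# ≤ t → - y ≤ s → x - 1# ≤ y
    near-below {t} {x} {y} {s} e p q = ≤-from (+-nonNegative (≤⇒0≤ p) (≤⇒0≤ q))
      (trans (+-congʳ (+-congʳ e)) (solve 3 (λ x s y → (:- x :- (s :- :1)) :+ (s :- :- y) := y :- (x :- :1)) refl x s y))

  opaque
    -- Approximates the supremum of the negated squared norms to within one. The type `X` then need
    -- not be enumerated, and the slack costs only a summand in `near-minimal-bound`.
    near-minimiser : ∀ {X : Set} {d} (Q : X → Set) (value : X → ℝ^ d) → ∃ Q →
      ∃[ φ ] (Q φ × (∀ {φ′} → Q φ′ → dot (value φ) (value φ) - 1# ≤ dot (value φ′) (value φ′)))
    near-minimiser {X} Q value (φ₀ , q₀) = conclude (complete P (_ , φ₀ , q₀ , refl) (0# , below-zero))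
      where
      size : X → Carrier
      size φ = dot (value φ) (value φ)
      P : Carrier → Set
      P t = ∃[ φ ] (Q φ × t ≈ - size φ)
      below-zero : IsUpperBound P 0#
      below-zero (φ , _ , e) = ≤-trans (≤-reflexive e) (≤-from (∑-nonNegative λ i → square-nonNegative (value φ i))
        (solve 1 (λ x → x := :0 :- :- x) refl _))
      conclude : ∃ (IsSup P) → ∃[ φ ] (Q φ × (∀ {φ′} → Q φ′ → size φ - 1# ≤ size φ′))
      conclude (s , upper , approximate) = extract (approximate (x-1<x s))
        where
        extract : ∃[ t ] (P t × s - 1# < t) → ∃[ φ ] (Q φ × (∀ {φ′} → Q φ′ → size φ - 1# ≤ size φ′))
        extract (t , (φ , q , e) , s-1<t) = φ , q , λ {φ′} q′ → near-below e (<⇒≤ s-1<t) (upper (φ′ , q′ , refl))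

  private
    opaque
      -- By the bound on `δ`, `Y² ≥ B² s² - 2 B M D + D²`, and the last two terms are
      -- `(D - B M)² - B² M²`. So `B² s² ≤ Y² + B² M²`, whatever the size of `D`; this removes the
      -- norm of the unknown cone element.
      complete-square : ∀ {B δ M D Y s} → Y * Y ≈ (B * (B * (s * s)) + (B * δ + B * δ)) + D * D →
        0# ≤ Y → 0# ≤ B → 0# ≤ M → - (M * D) ≤ δ → (B * s) * (B * s) ≤ (Y + B * M) * (Y + B * M)
      complete-square {B} {δ} {M} {D} {Y} {s} e 0≤Y 0≤B 0≤M p = ≤-from
        (+-nonNegative (+-nonNegative (*-nonNegative (+-nonNegative 0≤B 0≤B) (≤⇒0≤ p)) (square-nonNegative (D - B * M)))
          (*-nonNegative (+-nonNegative 0≤Y 0≤Y) (*-nonNegative 0≤B 0≤M)))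
        (trans (solve 6 (λ B δ M D Y s → ((B :+ B) :* (δ :- :- (M :* D)) :+ (D :- B :* M) :* (D :- B :* M)) :+ (Y :+ Y) :* (B :* M)
            := ((B :* (B :* (s :* s)) :+ (B :* δ :+ B :* δ)) :+ D :* D) :+ (((Y :+ Y) :* (B :* M) :+ (B :* M) :* (B :* M)) :- (B :* s) :* (B :* s)))
            refl B δ M D Y s)
          (trans (+-congʳ (sym e))
            (solve 4 (λ Y B M s → Y :* Y :+ (((Y :+ Y) :* (B :* M) :+ (B :* M) :* (B :* M)) :- (B :* s) :* (B :* s))
              := (Y :+ B :* M) :* (Y :+ B :* M) :- (B :* s) :* (B :* s)) refl Y B M s)))

  opaque
    descend : ∀ {k d} {S : Fin k → ℝ^ d} {b M} → 0# ≤ M → Confined S b M → ∀ {σ x Y B} → 0# < B →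
      Cone (NonDecreasing S b σ) x → combination S x ≈ᵥ Y -ᵥ B *ᵥ σ → B * ∥ σ ∥ ≤ ∥ Y ∥ + B * M
    descend {d = d} {S} {M = M} 0≤M confined {σ} {x} {Y} {B} 0<B x∈ e = square-cancel-≤ {B * ∥ σ ∥} {∥ Y ∥ + B * M}
      (+-nonNegative 0≤Y 0≤BM) (complete-square {B} {dot σ D} {M} {∥ D ∥} {∥ Y ∥} {∥ σ ∥} Y-square 0≤Y 0≤B 0≤M (confined σ {x} x∈))
      where
      D : ℝ^ d
      D = combination S x
      0≤B : 0# ≤ B
      0≤B = <⇒≤ 0<B
      0≤Y : 0# ≤ ∥ Y ∥
      0≤Y = ∥∥-nonNegative Y
      0≤BM : 0# ≤ B * M
      0≤BM = *-nonNegative 0≤B 0≤M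
      Y≈ : Y ≈ᵥ B *ᵥ σ +ᵥ D
      Y≈ i = trans (solve 2 (λ y s → y := s :+ (y :- s)) refl (Y i) (B * σ i)) (+-congˡ (sym (e i)))
      Y-square : ∥ Y ∥ * ∥ Y ∥ ≈ (B * (B * (∥ σ ∥ * ∥ σ ∥)) + (B * dot σ D + B * dot σ D)) + ∥ D ∥ * ∥ D ∥
      Y-square = trans (∥∥-square Y) (trans (dot-cong Y≈ Y≈) (trans (dot-square-+ (B *ᵥ σ) D)
        (+-cong (+-cong (trans (dot-*ˡ B σ _) (*-congˡ (trans (dot-*ʳ σ B σ) (*-congˡ (sym (∥∥-square σ))))))
          (+-cong (dot-*ˡ B σ D) (dot-*ˡ B σ D))) (sym (∥∥-square D)))))

-- Averages over all permutations

-- Enumeration in the factorial number system: `q` is the image of `zero` and `y` encodes the rest.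
-- An average over permutations becomes a sum over `Fin (n !)` that unfolds by recursion on `n`.
permutation : ∀ n → Fin (n !) → Permutation n n
permutation zero    _ = Perm.id
permutation (suc n) x = let q , y = remQuot (n !) x in insert zero q (permutation n y)

module Averaging (ℝ : CompleteOrderedField) where
  open CompleteOrderedField ℝ hiding (zero)
  open Euclidean ℝ using (fromℕ)
  open DifferenceSolver commutativeRing
  open OrderedField ℝ
  open Vectors ℝ

  opaque
    ∑-++ : ∀ m {n} (f : Fin (m ℕ.+ n) → Carrier) → ∑ (m ℕ.+ n) f ≈ ∑ m (λ i → f (i ↑ˡ n)) + ∑ n (λ j → f (m ↑ʳ j))
    ∑-++ zero    f = trans (sym (+-identityˡ _)) (+-congʳ (sym ∑-empty))
    ∑-++ (suc m) f = trans ∑-suc (trans (+-congˡ (∑-++ m (λ i → f (suc i)))) (trans (sym (+-assoc _ _ _)) (+-congʳ (sym ∑-suc))))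

  opaque
    ∑-combine : ∀ m {n} (f : Fin (m ℕ.* n) → Carrier) → ∑ (m ℕ.* n) f ≈ ∑ m (λ i → ∑ n (λ j → f (combine i j)))
    ∑-combine zero        f = trans ∑-empty (sym ∑-empty)
    ∑-combine (suc m) {n} f = trans (∑-++ n f) (trans (+-congˡ (∑-combine m (λ x → f (n ↑ʳ x)))) (sym ∑-suc))

  opaque
    ∑-remQuot : ∀ m {n} (f : Fin m × Fin n → Carrier) → ∑ (m ℕ.* n) (λ x → f (remQuot n x)) ≈ ∑ m (λ i → ∑ n (λ j → f (i , j)))
    ∑-remQuot m f = trans (∑-combine m _) (∑-cong λ i → ∑-cong λ j → reflexive (≡.cong f (Fin.remQuot-combine i j)))

  offDiagonal : ∀ n → (Fin n → Fin n → Carrier) → Carrier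
  offDiagonal n g = ∑ n (λ x → ∑ n (g x)) - ∑ n (λ x → g x x)

  private
    opaque
      ∑-permutation-suc : ∀ n (F : Permutation (suc n) (suc n) → Carrier) →
        ∑ (suc n !) (λ x → F (permutation (suc n) x)) ≈ ∑ (suc n) (λ q → ∑ (n !) (λ y → F (insert zero q (permutation n y))))
      ∑-permutation-suc n F = ∑-remQuot (suc n) (λ (q , y) → F (insert zero q (permutation n y)))

    opaque
      ∑-others : ∀ {n} (f : Fin (suc n) → Carrier) i → ∑ n (λ j → f (punchIn i j)) ≈ ∑ (suc n) f - f i
      ∑-others f i = trans (solve 2 (λ x y → y := (x :+ y) :- x) refl (f i) _) (+-congʳ (sym (∑-remove f i)))

    opaque
      ∑-shifted : ∀ n (f : Fin n → Carrier) c → ∑ n (λ q → c - f q) ≈ fromℕ n * c - ∑ n f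
      ∑-shifted n f c = trans (∑-- _ f) (+-congʳ (∑-const n c))

    opaque
      offDiagonal-punchIn : ∀ {n} (g : Fin (suc n) → Fin (suc n) → Carrier) q →
        offDiagonal n (λ x y → g (punchIn q x) (punchIn q y)) ≈
        offDiagonal (suc n) g - (∑ (suc n) (g q) + ∑ (suc n) (λ x → g x q) - (g q q + g q q))
      offDiagonal-punchIn {n} g q = trans (+-cong
        (trans (∑-cong λ x → ∑-others (g (punchIn q x)) q) (trans (∑-- _ _)
          (+-cong (∑-others (λ x → ∑ (suc n) (g x)) q) (-‿cong (∑-others (λ x → g x q) q)))))
        (-‿cong (∑-others (λ x → g x x) q)))
        (solve 5 (λ T r c D e → ((T :- r) :- (c :- e)) :- (D :- e) := (T :- D) :- ((r :+ c) :- (e :+ e))) refl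
          (∑ (suc n) (λ x → ∑ (suc n) (g x))) (∑ (suc n) (g q)) (∑ (suc n) (λ x → g x q)) (∑ (suc n) (λ x → g x x)) (g q q))

  opaque
    -- Each point is the image of `a` under `n !` of the permutations. In the inductive case, every
    -- point survives the removal of `q` for all `q` but one.
    ∑-permutation₁ : ∀ n (h : Fin (suc n) → Carrier) a →
      ∑ (suc n !) (λ x → h (permutation (suc n) x ⟨$⟩ʳ a)) ≈ fromℕ (n !) * ∑ (suc n) h
    ∑-permutation₁ n h zero = trans (∑-permutation-suc n (λ π → h (π ⟨$⟩ʳ zero)))
      (trans (∑-cong λ q → ∑-const (n !) (h q)) (sym (*-∑ _ _)))
    ∑-permutation₁ (suc n) h (suc a) = trans (∑-permutation-suc (suc n) (λ π → h (π ⟨$⟩ʳ suc a)))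
      (trans (∑-cong λ q → trans (trans (∑-cong λ y → reflexive (≡.cong h (insert-punchIn zero q (permutation (suc n) y) a)))
          (∑-permutation₁ n (λ x → h (punchIn q x)) a)) (*-congˡ (∑-others h q)))
        (trans (sym (*-∑ _ _)) (trans (*-congˡ (∑-shifted (suc (suc n)) h H))
          (trans (solve 3 (λ f n H → f :* ((:1 :+ n) :* H :- H) := (n :* f) :* H) refl (fromℕ (n !)) (fromℕ (suc n)) H)
            (*-congʳ (sym (fromℕ-* (suc n) (n !))))))))
      where
      H : Carrier
      H = ∑ (suc (suc n)) h

  opaque
    -- Each ordered pair of distinct points is the image of `(a , b)` equally often. In the
    -- inductive case, a pair survives the removal of `q` for all but two of the `n + 3` values of
    -- `q`, which turns `n !` into `suc n !`.
    ∑-permutation₂ : ∀ n (g : Fin (suc (suc n)) → Fin (suc (suc n)) → Carrier) a b → a ≢ b →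
      ∑ (suc (suc n) !) (λ x → g (permutation (suc (suc n)) x ⟨$⟩ʳ a) (permutation (suc (suc n)) x ⟨$⟩ʳ b)) ≈
      fromℕ (n !) * offDiagonal (suc (suc n)) g
    ∑-permutation₂ n g zero zero a≢b = ⊥-elim (a≢b ≡.refl)
    ∑-permutation₂ n g zero (suc b) _ = trans (∑-permutation-suc (suc n) (λ π → g (π ⟨$⟩ʳ zero) (π ⟨$⟩ʳ suc b)))
      (trans (∑-cong λ q → trans (∑-cong λ y → reflexive (≡.cong (g q) (insert-punchIn zero q (permutation (suc n) y) b)))
          (trans (∑-permutation₁ n (λ x → g q (punchIn q x)) b) (*-congˡ (∑-others (g q) q))))
        (trans (sym (*-∑ _ _)) (*-congˡ (∑-- _ _))))
    ∑-permutation₂ n g (suc a) zero _ = trans (∑-permutation-suc (suc n) (λ π → g (π ⟨$⟩ʳ suc a) (π ⟨$⟩ʳ zero)))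
      (trans (∑-cong λ q → trans (∑-cong λ y → reflexive (≡.cong (λ x → g x q) (insert-punchIn zero q (permutation (suc n) y) a)))
          (trans (∑-permutation₁ n (λ x → g (punchIn q x) q) a) (*-congˡ (∑-others (λ x → g x q) q))))
        (trans (sym (*-∑ _ _)) (*-congˡ (trans (∑-- _ _) (+-congʳ (sym (∑-swap g)))))))
    ∑-permutation₂ zero g (suc zero) (suc zero) a≢b = ⊥-elim (a≢b ≡.refl)
    ∑-permutation₂ (suc n) g (suc a) (suc b) a≢b = trans (∑-permutation-suc (suc (suc n)) (λ π → g (π ⟨$⟩ʳ suc a) (π ⟨$⟩ʳ suc b)))
      (trans (∑-cong λ q → trans (∑-cong λ y → reflexive (≡.cong₂ g (insert-punchIn zero q (permutation (suc (suc n)) y) a)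
            (insert-punchIn zero q (permutation (suc (suc n)) y) b)))
          (trans (∑-permutation₂ n (λ x y → g (punchIn q x) (punchIn q y)) a b (a≢b ∘ ≡.cong suc)) (*-congˡ (offDiagonal-punchIn g q))))
        (trans (sym (*-∑ _ _)) (trans (*-congˡ (trans (∑-shifted m _ _) (+-congˡ (-‿cong
            (trans (∑-- _ _) (+-cong (trans (∑-+ _ _) (+-congˡ (sym (∑-swap g)))) (-‿cong (∑-+ _ _))))))))
          (trans (solve 4 (λ f n T D → f :* ((:1 :+ (:1 :+ n)) :* (T :- D) :- ((T :+ T) :- (D :+ D))) := (n :* f) :* (T :- D)) refl
              (fromℕ (n !)) (fromℕ (suc n)) (∑ m (λ x → ∑ m (g x))) (∑ m (λ x → g x x)))
            (*-congʳ (sym (fromℕ-* (suc n) (n !))))))))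
      where
      m : ℕ
      m = suc (suc (suc n))

-- Permuting the vertices of the first `m` blocks

module _ (m {n r} : ℕ) where

  private
    rearrange : (Fin (m ℕ.* r) → Fin (m ℕ.* r)) → Fin (m ℕ.+ n) × Fin r → Fin (m ℕ.+ n) × Fin r
    rearrange f (i , a) = [ (λ j → let j′ , a′ = remQuot r (f (combine j a)) in j′ ↑ˡ n , a′) , (λ i′ → m ↑ʳ i′ , a) ]′ (splitAt m i)

    rearrange-inverse : ∀ f g → (∀ x → f (g x) ≡ x) → ∀ x → rearrange f (rearrange g x) ≡ x
    rearrange-inverse f g fg (i , a) with splitAt m i in eq
    ... | inj₁ j rewrite Fin.splitAt-↑ˡ m (proj₁ (remQuot {m} r (g (combine j a)))) n
                       | Fin.combine-remQuot {m} r (g (combine j a))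
                       | fg (combine j a)
                       = ≡.trans (≡.cong (λ (j , a) → j ↑ˡ n , a) (Fin.remQuot-combine j a)) (≡.cong (_, a) (Fin.splitAt⁻¹-↑ˡ eq))
    ... | inj₂ i′ rewrite Fin.splitAt-↑ʳ m n i′ = ≡.cong (_, a) (Fin.splitAt⁻¹-↑ʳ eq)

  -- Used with `m = 2` to exchange vertices between blocks and with `m = 1` to permute the vertices
  -- of one block.
  rearrangement : Permutation (m ℕ.* r) (m ℕ.* r) → (Fin (m ℕ.+ n) × Fin r) ↔ (Fin (m ℕ.+ n) × Fin r)
  rearrangement p = mk↔ₛ′ (rearrange (p ⟨$⟩ʳ_)) (rearrange (p ⟨$⟩ˡ_))
    (rearrange-inverse (p ⟨$⟩ʳ_) (p ⟨$⟩ˡ_) (λ x → Perm.inverseʳ p)) (rearrange-inverse (p ⟨$⟩ˡ_) (p ⟨$⟩ʳ_) (λ x → Perm.inverseˡ p))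

  rearrangement-↑ˡ : ∀ p (j : Fin m) a → Inverse.to (rearrangement p) (j ↑ˡ n , a) ≡
    (proj₁ (remQuot {m} r (p ⟨$⟩ʳ combine j a)) ↑ˡ n , proj₂ (remQuot {m} r (p ⟨$⟩ʳ combine j a)))
  rearrangement-↑ˡ p j a rewrite Fin.splitAt-↑ˡ m j n = ≡.refl

  rearrangement-↑ʳ : ∀ p (i : Fin n) a → Inverse.to (rearrangement p) (m ↑ʳ i , a) ≡ (m ↑ʳ i , a)
  rearrangement-↑ʳ p i a rewrite Fin.splitAt-↑ʳ m n i = ≡.refl

-- The average change of a pair count under moves

module Rearrangements (ℝ : CompleteOrderedField) where
  open CompleteOrderedField ℝ hiding (zero)
  open Euclidean ℝ using (fromℕ)
  open DifferenceSolver commutativeRing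
  open OrderedField ℝ
  open Vectors ℝ
  open Averaging ℝ

  opaque
    -- Multiplied out for sizes such as `m * r`, which are not visibly successors.
    ∑-permutation₁′ : ∀ n (h : Fin n → Carrier) a →
      fromℕ n * ∑ (n !) (λ x → h (permutation n x ⟨$⟩ʳ a)) ≈ fromℕ (n !) * ∑ n h
    ∑-permutation₁′ (suc n) h a = trans (*-congˡ (∑-permutation₁ n h a))
      (trans (sym (*-assoc _ _ _)) (*-congʳ (sym (fromℕ-* (suc n) (n !)))))

  opaque
    ∑-permutation₂′ : ∀ n (g : Fin n → Fin n → Carrier) a b → a ≢ b →
      (fromℕ n * (fromℕ n - 1#)) * ∑ (n !) (λ x → g (permutation n x ⟨$⟩ʳ a) (permutation n x ⟨$⟩ʳ b)) ≈
      fromℕ (n !) * offDiagonal n g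
    ∑-permutation₂′ (suc zero) g zero zero a≢b = ⊥-elim (a≢b ≡.refl)
    ∑-permutation₂′ (suc (suc n)) g a b a≢b = trans (*-congˡ (∑-permutation₂ n g a b a≢b))
      (trans (solve 3 (λ n f o → ((:1 :+ (:1 :+ n)) :* ((:1 :+ (:1 :+ n)) :- :1)) :* (f :* o) := ((:1 :+ (:1 :+ n)) :* ((:1 :+ n) :* f)) :* o)
          refl (fromℕ n) (fromℕ (n !)) (offDiagonal (suc (suc n)) g))
        (*-congʳ (sym (trans (fromℕ-* (suc (suc n)) (suc n !)) (*-congˡ (fromℕ-* (suc n) (n !)))))))

  opaque
    one : ∀ (f : Fin 1 → Carrier) → ∑ 1 f ≈ f zero
    one f = trans ∑-suc (trans (+-congˡ ∑-empty) (+-identityʳ _))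

  module _ {r : ℕ} where

    -- A weight on ordered pairs of positions; in the application, the indicator of one colour.
    -- Working with one colour at a time keeps all averages scalar.
    Pairing : ℕ → Set
    Pairing n = Fin n × Fin r → Fin n × Fin r → Carrier

    block : ∀ {n} → (Fin r → Fin r → Carrier) → Pairing n → Fin n → Carrier
    block h G i = ∑ r (λ a → ∑ r (λ b → h a b * G (i , a) (i , b)))

    within : ∀ {n} → (Fin r → Fin r → Carrier) → Pairing n → Carrier
    within {n} h G = ∑ n (block h G)

    between : ∀ {n} → Pairing n → Fin n → Fin n → Carrier
    between G i i′ = ∑ r (λ a → ∑ r (λ b → G (i , a) (i′ , b)))

    diagonal everything : ∀ {n} → Pairing n → Carrier
    diagonal {n} G = ∑ n (λ i → between G i i)
    everything {n} G = ∑ n (λ i → ∑ n (between G i))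

    onBlocks : ∀ {n} → Permutation n n → (Fin n × Fin r) ↔ (Fin n × Fin r)
    onBlocks ρ = ρ ×-↔ ↔-id (Fin r)

    infixr 9 _∘₂_
    _∘₂_ : ∀ {A : Set} {n} → Pairing n → (A → Fin n × Fin r) → A → A → Carrier
    (G ∘₂ f) x y = G (f x) (f y)

    -- A move shuffles the vertices of the first `m` positions' blocks and then permutes whole
    -- blocks. The block permutation changes no count; its purpose is that averaging over it selects
    -- the `m` affected blocks uniformly.
    module Move (m : ℕ) {n : ℕ} (h : Fin r → Fin r → Carrier) (h-diagonal : ∀ a → h a a ≈ 0#)
                (G : Pairing (m ℕ.+ n)) (G-diagonal : ∀ x → G x x ≈ 0#) where

      private
        T M : ℕ
        T = m ℕ.* r
        M = m ℕ.+ n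
        τ μ e : Carrier
        τ = fromℕ T * (fromℕ T - 1#)
        μ = fromℕ M
        e = ∑ r (λ a → ∑ r (h a))

      move : Fin (M !) → Fin (T !) → (Fin M × Fin r) ↔ (Fin M × Fin r)
      move x y = onBlocks (permutation M x) ↔-∘ rearrangement m (permutation T y)

      moved : Fin (M !) → Fin (T !) → Pairing M
      moved x y = G ∘₂ Inverse.to (move x y)

      position : Fin T → Fin M × Fin r
      position x = proj₁ (remQuot {m} r x) ↑ˡ n , proj₂ (remQuot {m} r x)

      chosen : Permutation M M → Fin T → Fin T → Carrier
      chosen ρ = G ∘₂ (Inverse.to (onBlocks ρ) ∘ position)

      new old : Fin (M !) → Fin (T !) → Carrier
      new x y = ∑ m (λ j → ∑ r (λ a → ∑ r (λ b → h a b *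
        chosen (permutation M x) (permutation T y ⟨$⟩ʳ combine j a) (permutation T y ⟨$⟩ʳ combine j b))))
      old x y = ∑ m (λ j → block h G (permutation M x ⟨$⟩ʳ (j ↑ˡ n)))

      opaque
        within-onBlocks : ∀ (ρ : Permutation M M) → within h (G ∘₂ Inverse.to (onBlocks ρ)) ≈ within h G
        within-onBlocks ρ = sym (∑-permute (block h G) ρ)

      opaque
        -- Relative to the permuted blocks, nothing changes outside the first `m`. This also bounds
        -- the change independently of `n`.
        shift : ∀ x y → within h (moved x y) - within h G ≈ new x y - old x y
        shift x y = trans (+-cong
            (trans (∑-++ m _) (+-cong (∑-cong λ j → ∑-cong λ a → ∑-cong λ b → *-congˡ (reflexive
                (≡.cong₂ G′ (rearrangement-↑ˡ m p j a) (rearrangement-↑ˡ m p j b))))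
              (∑-cong λ i → ∑-cong λ a → ∑-cong λ b → *-congˡ (reflexive
                (≡.cong₂ G′ (rearrangement-↑ʳ m p i a) (rearrangement-↑ʳ m p i b))))))
            (-‿cong (trans (sym (within-onBlocks ρ)) (∑-++ m _))))
          (solve 3 (λ a b c → (a :+ c) :- (b :+ c) := a :- b) refl _ _ _)
          where
          ρ : Permutation M M
          ρ = permutation M x
          p : Permutation T T
          p = permutation T y
          G′ : Pairing M
          G′ = G ∘₂ Inverse.to (onBlocks ρ)

      chosenSum : Fin (M !) → Carrier
      chosenSum x = ∑ m (λ j → ∑ m (λ j′ → between G (permutation M x ⟨$⟩ʳ (j ↑ˡ n)) (permutation M x ⟨$⟩ʳ (j′ ↑ˡ n))))

      opaque
        offDiagonal-chosen : ∀ x → offDiagonal T (chosen (permutation M x)) ≈ chosenSum x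
        offDiagonal-chosen x = trans (+-cong
            (trans (∑-remQuot m (λ (j , a) → ∑ T (λ y → G (ρ j , a) (Inverse.to (onBlocks (permutation M x)) (position y)))))
              (∑-cong λ j → trans (∑-cong λ a → ∑-remQuot m (λ (j′ , b) → G (ρ j , a) (ρ j′ , b))) (∑-swap _)))
            (-‿cong (∑-zero λ y → G-diagonal _)))
          (solve 1 (λ x → x :- :0 := x) refl _)
          where
          ρ : Fin m → Fin M
          ρ j = permutation M x ⟨$⟩ʳ (j ↑ˡ n)

      opaque
        -- As `h` vanishes on the diagonal, only pairs of distinct positions matter, and
        -- permutations of the `T` vertices send such a pair to every other one equally often. Each
        -- of the `m` copies thus receives `e` times the mean of the off-diagonal sum; `τ` clears
        -- its denominator.
        ∑-new : ∀ x → τ * ∑ (T !) (new x) ≈ (fromℕ m * e) * (fromℕ (T !) * chosenSum x)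
        ∑-new x = trans (*-congˡ (trans (∑-swap _) (∑-cong λ j → trans (∑-swap _) (∑-cong λ a → trans (∑-swap _) (∑-cong λ b → sym (*-∑ (h a b) _))))))
          (trans (*-∑ τ _) (trans (∑-cong λ j → trans (*-∑ τ _) (trans (∑-cong λ a → trans (*-∑ τ _) (∑-cong λ b → pair j a b))
              (trans (∑-cong λ a → sym (∑-*ʳ _ _)) (sym (∑-*ʳ _ _)))))
            (trans (∑-const m _) (sym (*-assoc _ _ _)))))
          where
          P : Fin T → Fin T → Carrier
          P u v = ∑ (T !) (λ y → chosen (permutation M x) (permutation T y ⟨$⟩ʳ u) (permutation T y ⟨$⟩ʳ v))
          pair : ∀ (j : Fin m) (a b : Fin r) → τ * (h a b * P (combine j a) (combine j b)) ≈ h a b * (fromℕ (T !) * chosenSum x)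
          pair j a b with a Fin.≟ b
          ... | yes ≡.refl = trans (*-congˡ (trans (*-congʳ (h-diagonal a)) (zeroˡ _)))
            (trans (zeroʳ τ) (sym (trans (*-congʳ (h-diagonal a)) (zeroˡ _))))
          ... | no a≢b = trans (solve 3 (λ τ h p → τ :* (h :* p) := h :* (τ :* p)) refl τ (h a b) (P (combine j a) (combine j b)))
            (*-congˡ (trans (∑-permutation₂′ T (chosen (permutation M x)) (combine j a) (combine j b)
                (a≢b ∘ Fin.combine-injectiveʳ j a j b))
              (*-congˡ (offDiagonal-chosen x))))

      opaque
        ∑-old : μ * ∑ (M !) (λ x → ∑ (T !) (old x)) ≈ (fromℕ (T !) * (fromℕ m * fromℕ (M !))) * within h G
        ∑-old = trans (*-congˡ (trans (∑-cong λ x → ∑-const (T !) _) (trans (sym (*-∑ _ _)) (*-congˡ (∑-swap _)))))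
          (trans (solve 3 (λ μ t s → μ :* (t :* s) := t :* (μ :* s)) refl μ (fromℕ (T !)) _)
            (trans (*-congˡ (trans (*-∑ μ _) (trans (∑-cong λ j → ∑-permutation₁′ M (block h G) (j ↑ˡ n)) (∑-const m _))))
              (solve 4 (λ t m f w → t :* (m :* (f :* w)) := (t :* (m :* f)) :* w) refl _ _ _ _)))

      totalShift : Carrier
      totalShift = ∑ (M !) (λ x → ∑ (T !) (λ y → within h (moved x y) - within h G))

      opaque
        totalShift≈ : τ * totalShift ≈ (fromℕ m * e) * (fromℕ (T !) * ∑ (M !) chosenSum) - τ * ∑ (M !) (λ x → ∑ (T !) (old x))
        totalShift≈ = trans (*-congˡ (trans (∑-cong λ x → trans (∑-cong λ y → shift x y) (∑-- _ _)) (∑-- _ _)))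
          (trans (solve 3 (λ τ a b → τ :* (a :- b) := τ :* a :- τ :* b) refl τ _ _)
            (+-congʳ (trans (*-∑ τ _) (trans (∑-cong ∑-new) (trans (sym (*-∑ _ _)) (*-congˡ (sym (*-∑ _ _))))))))

    opaque
      -- Permuting whole blocks and the vertices inside one of them does not change which vertices
      -- share a block. This is what preserves the result of the first round during the second.
      diagonal-invariant : ∀ {n} h h-diagonal (G : Pairing (1 ℕ.+ n)) (G-diagonal : ∀ x → G x x ≈ 0#) x y →
        diagonal (Move.moved 1 {n} h h-diagonal G G-diagonal x y) ≈ diagonal G
      diagonal-invariant {n} h h-diagonal G G-diagonal x y = trans
        (trans (∑-++ 1 (λ i → between (moved x y) i i)) (+-cong
          (trans (one _) (trans (∑-cong λ a → ∑-cong λ b → reflexive (≡.cong₂ G′ (rearrangement-↑ˡ 1 p zero a) (rearrangement-↑ˡ 1 p zero b)))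
            (trans permuted (trans (∑-cong λ a → ∑-cong λ b → reflexive (≡.cong₂ G′ (position-combine a) (position-combine b))) (sym (one _))))))
          (∑-cong λ i → ∑-cong λ a → ∑-cong λ b → reflexive (≡.cong₂ G′ (rearrangement-↑ʳ 1 p i a) (rearrangement-↑ʳ 1 p i b)))))
        (trans (sym (∑-++ 1 (λ i → between G′ i i))) (sym (∑-permute (λ i → between G i i) ρ)))
        where
        open Move 1 {n} h h-diagonal G G-diagonal
        T : ℕ
        T = 1 ℕ.* r
        ρ : Permutation (suc n) (suc n)
        ρ = permutation (suc n) x
        p : Permutation T T
        p = permutation T y
        G′ : Pairing (suc n)
        G′ = G ∘₂ Inverse.to (onBlocks ρ)
        g : Fin T → Fin T → Carrier
        g = chosen ρ
        at : Fin r → Fin T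
        at a = combine {1} zero a
        flatten : ∀ (f : Fin T → Carrier) → ∑ r (λ a → f (at a)) ≈ ∑ T f
        flatten f = sym (trans (∑-combine 1 f) (one _))
        permuted : ∑ r (λ a → ∑ r (λ b → g (p ⟨$⟩ʳ at a) (p ⟨$⟩ʳ at b))) ≈ ∑ r (λ a → ∑ r (λ b → g (at a) (at b)))
        permuted = trans (∑-cong λ a → trans (flatten (λ v → g (p ⟨$⟩ʳ at a) (p ⟨$⟩ʳ v))) (sym (∑-permute (g (p ⟨$⟩ʳ at a)) p)))
          (trans (flatten (λ u → ∑ T (g (p ⟨$⟩ʳ u)))) (trans (sym (∑-permute (λ u → ∑ T (g u)) p))
            (trans (sym (flatten (λ u → ∑ T (g u)))) (∑-cong λ a → sym (flatten (g (at a)))))))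
        position-combine : ∀ a → position (at a) ≡ (zero , a)
        position-combine a = ≡.cong (λ (j , b) → j ↑ˡ n , b) (Fin.remQuot-combine {1} zero a)

    module _ {n : ℕ} (h : Fin r → Fin r → Carrier) (h-diagonal : ∀ a → h a a ≈ 0#) where

      private
        e : Carrier
        e = ∑ r (λ a → ∑ r (h a))

      opaque
        -- A random placement of `h` inside a block sees every pair of the block equally often, so
        -- on average `within h G` moves towards `e / (r (r - 1))` times `diagonal G`.
        single-total : ∀ (G : Pairing (1 ℕ.+ n)) (G-diagonal : ∀ x → G x x ≈ 0#) → let open Move 1 {n} h h-diagonal G G-diagonal in
          (fromℕ (suc n) * (fromℕ (1 ℕ.* r) * (fromℕ (1 ℕ.* r) - 1#))) * totalShift ≈
          (fromℕ ((1 ℕ.* r) !) * fromℕ (suc n !)) * (e * diagonal G - (fromℕ r * (fromℕ r - 1#)) * within h G)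
        single-total G G-diagonal = trans (*-assoc μ τ totalShift) (trans (*-congˡ totalShift≈)
            (trans (solve 6 (λ μ m e t c τo → μ :* ((m :* e) :* (t :* c) :- τo) := (m :* e) :* (t :* (μ :* c)) :- μ :* τo) refl μ (fromℕ 1) e _ _ _)
              (trans (+-cong (*-cong (trans (*-congʳ fromℕ-1) (*-identityˡ e)) (*-congˡ chosen≈))
                  (-‿cong (trans (solve 3 (λ μ τ o → μ :* (τ :* o) := τ :* (μ :* o)) refl μ τ _)
                    (*-cong τ≈ (trans ∑-old (*-congʳ (*-congˡ (trans (*-congʳ fromℕ-1) (*-identityˡ _)))))))))
                (solve 6 (λ e t f d ρ w → e :* (t :* (f :* d)) :- ρ :* ((t :* f) :* w) := (t :* f) :* (e :* d :- ρ :* w)) refl _ _ _ _ _ _))))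
          where
          open Move 1 {n} h h-diagonal G G-diagonal
          T : ℕ
          T = 1 ℕ.* r
          μ τ : Carrier
          μ = fromℕ (suc n)
          τ = fromℕ T * (fromℕ T - 1#)
          T≈ : fromℕ T ≈ fromℕ r
          T≈ = trans (fromℕ-* 1 r) (trans (*-congʳ fromℕ-1) (*-identityˡ _))
          τ≈ : τ ≈ fromℕ r * (fromℕ r - 1#)
          τ≈ = *-cong T≈ (+-congʳ T≈)
          chosen≈ : μ * ∑ (suc n !) chosenSum ≈ fromℕ (suc n !) * diagonal G
          chosen≈ = trans (*-congˡ (∑-cong λ x → trans (one _) (one _))) (∑-permutation₁′ (suc n) (λ i → between G i i) zero)

      opaque
        -- Two chosen blocks form four ordered pairs of blocks. The two with equal entries
        -- contribute `(N - 1) * diagonal G` each and the two with distinct entries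
        -- `everything G - diagonal G` each, up to a common factor, where `N` is the number of
        -- blocks. The surviving multiple of `diagonal G` is the reason for treating complete `h`
        -- first.
        double-total : ∀ (G : Pairing (2 ℕ.+ n)) (G-diagonal : ∀ x → G x x ≈ 0#) → let open Move 2 {n} h h-diagonal G G-diagonal in
          ((fromℕ (2 ℕ.+ n) * (fromℕ (2 ℕ.+ n) - 1#)) * (fromℕ (2 ℕ.* r) * (fromℕ (2 ℕ.* r) - 1#))) * totalShift ≈
          (((1# + 1#) * (1# + 1#)) * (fromℕ ((2 ℕ.* r) !) * fromℕ ((2 ℕ.+ n) !))) *
            (e * ((fromℕ (2 ℕ.+ n) - (1# + 1#)) * diagonal G + everything G) -
             ((fromℕ r * ((fromℕ r + fromℕ r) - 1#)) * (fromℕ (2 ℕ.+ n) - 1#)) * within h G)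
        double-total G G-diagonal = trans (*-assoc ν τ totalShift) (trans (*-congˡ totalShift≈)
            (trans (solve 6 (λ ν m e t c τo → ν :* ((m :* e) :* (t :* c) :- τo) := (m :* e) :* (t :* (ν :* c)) :- ν :* τo) refl ν (fromℕ 2) e _ _ _)
              (trans (+-cong (*-cong (*-congʳ two≈) (*-congˡ chosen≈))
                  (-‿cong (trans (solve 4 (λ μ μ′ τ o → (μ :* μ′) :* (τ :* o) := (τ :* μ′) :* (μ :* o)) refl μ (μ - 1#) τ _)
                    (*-cong (*-congʳ τ≈) (trans ∑-old (*-congʳ (*-congˡ (*-congʳ two≈))))))))
                (trans (+-congˡ (-‿cong (regroup (fromℕ r) (μ - 1#) (fromℕ (T !)) (fromℕ (N !)) (within h G))))
                  (solve 5 (λ e t f d ρ → ((:1 :+ :1) :* e) :* (t :* (f :* ((:1 :+ :1) :* d))) :- (((:1 :+ :1) :* (:1 :+ :1)) :* (t :* f)) :* ρ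
                    := (((:1 :+ :1) :* (:1 :+ :1)) :* (t :* f)) :* (e :* d :- ρ)) refl
                    e (fromℕ (T !)) (fromℕ (N !)) ((μ - (1# + 1#)) * diagonal G + everything G) _)))))
          where
          open Move 2 {n} h h-diagonal G G-diagonal
          T N : ℕ
          T = 2 ℕ.* r
          N = 2 ℕ.+ n
          μ ν τ : Carrier
          μ = fromℕ N
          ν = μ * (μ - 1#)
          τ = fromℕ T * (fromℕ T - 1#)
          two≈ : fromℕ 2 ≈ 1# + 1#
          two≈ = +-congˡ fromℕ-1
          T≈ : fromℕ T ≈ fromℕ r + fromℕ r
          T≈ = trans (fromℕ-* 2 r) (trans (*-congʳ two≈) (solve 1 (λ r → (:1 :+ :1) :* r := r :+ r) refl _))
          τ≈ : τ ≈ (fromℕ r + fromℕ r) * ((fromℕ r + fromℕ r) - 1#)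
          τ≈ = *-cong T≈ (+-congʳ T≈)
          regroup : ∀ r μ′ t f w → (((r + r) * ((r + r) - 1#)) * μ′) * ((t * ((1# + 1#) * f)) * w) ≈
            (((1# + 1#) * (1# + 1#)) * (t * f)) * (((r * ((r + r) - 1#)) * μ′) * w)
          regroup = solve 5 (λ r μ′ t f w → (((r :+ r) :* ((r :+ r) :- :1)) :* μ′) :* ((t :* ((:1 :+ :1) :* f)) :* w)
            := (((:1 :+ :1) :* (:1 :+ :1)) :* (t :* f)) :* (((r :* ((r :+ r) :- :1)) :* μ′) :* w)) refl
          two : ∀ (f : Fin 2 → Carrier) → ∑ 2 f ≈ f zero + f (suc zero)
          two f = trans ∑-suc (+-congˡ (trans ∑-suc (trans (+-congˡ ∑-empty) (+-identityʳ _))))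
          first second : Fin N
          first = zero
          second = suc zero
          D V : Carrier
          D = diagonal G
          V = everything G
          π : Fin (N !) → Fin N → Fin N
          π x i = permutation N x ⟨$⟩ʳ i
          same : ∀ i → ν * ∑ (N !) (λ x → between G (π x i) (π x i)) ≈ fromℕ (N !) * ((μ - 1#) * D)
          same i = trans (solve 3 (λ μ μ′ s → (μ :* μ′) :* s := μ′ :* (μ :* s)) refl μ (μ - 1#) _)
            (trans (*-congˡ (∑-permutation₁′ N (λ i → between G i i) i)) (solve 3 (λ a b c → a :* (b :* c) := b :* (a :* c)) refl _ _ _))
          distinct : ∀ {i i′} → i ≢ i′ → ν * ∑ (N !) (λ x → between G (π x i) (π x i′)) ≈ fromℕ (N !) * (V - D)
          distinct {i} {i′} i≢i′ = ∑-permutation₂′ N (between G) i i′ i≢i′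
          chosen≈ : ν * ∑ (N !) chosenSum ≈ fromℕ (N !) * ((1# + 1#) * ((μ - (1# + 1#)) * D + V))
          chosen≈ = trans (*-congˡ (trans (∑-cong λ x → trans (two _) (+-cong (two _) (two _))) (trans (∑-+ _ _) (+-cong (∑-+ _ _) (∑-+ _ _)))))
            (trans (solve 5 (λ ν a b c d → ν :* ((a :+ b) :+ (c :+ d)) := (ν :* a :+ ν :* b) :+ (ν :* c :+ ν :* d)) refl ν _ _ _ _)
              (trans (+-cong (+-cong (same first) (distinct {first} {second} λ ())) (+-cong (distinct {second} {first} λ ()) (same second)))
                (solve 4 (λ f μ D V → (f :* ((μ :- :1) :* D) :+ f :* (V :- D)) :+ (f :* (V :- D) :+ f :* ((μ :- :1) :* D))
                  := f :* ((:1 :+ :1) :* ((μ :- (:1 :+ :1)) :* D :+ V))) refl (fromℕ (N !)) μ D V)))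

-- Balancing cliques, then copies of `H`

module Arrangements (ℝ : CompleteOrderedField) where
  open CompleteOrderedField ℝ hiding (zero)
  open Euclidean ℝ using (fromℕ; ℝ^; _≈ᵥ_; _+ᵥ_; _-ᵥ_; _*ᵥ_)
  open DifferenceSolver commutativeRing
  open OrderedField ℝ
  open Vectors ℝ
  open Instances ℝ
  open Confinement ℝ
  open Descent ℝ
  open Averaging ℝ
  open Rearrangements ℝ

  NaturalWithin : ℕ → Carrier → Set
  NaturalWithin b x = ∃[ p ] (p ℕ.≤ b × x ≈ fromℕ p)

  opaque
    natural-* : ∀ {b c x y} → NaturalWithin b x → NaturalWithin c y → NaturalWithin (b ℕ.* c) (x * y)
    natural-* (p , p≤b , e) (q , q≤c , f) = p ℕ.* q , ℕ.*-mono-≤ p≤b q≤c , trans (*-cong e f) (sym (fromℕ-* p q))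

  opaque
    natural-∑ : ∀ {n b} {f : Fin n → Carrier} → (∀ i → NaturalWithin b (f i)) → NaturalWithin (n ℕ.* b) (∑ n f)
    natural-∑ {zero}  p = 0 , z≤n , ∑-empty
    natural-∑ {suc n} p with p zero | natural-∑ (λ i → p (suc i))
    ... | u , u≤b , e | v , v≤ , f = u ℕ.+ v , ℕ.+-mono-≤ u≤b v≤ , trans ∑-suc (trans (+-cong e f) (sym (fromℕ-+ u v)))

  opaque
    bit-≤1 : ∀ {x} → NaturalWithin 1 x → x ≤ 1#
    bit-≤1 (p , p≤1 , e) = ≤-trans (≤-reflexive e) (≤-trans (fromℕ-mono p≤1) (≤-reflexive fromℕ-1))

  opaque
    natural-nonNegative : ∀ {b x} → NaturalWithin b x → 0# ≤ x
    natural-nonNegative (p , _ , e) = 0≤-resp (sym e) (fromℕ-nonNegative p)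

  opaque
    -- Brings the averaging identities, which are multiplied out to avoid division, back to cone
    -- membership.
    cone-rescale : ∀ {m} {P : ℝ^ m → Set} {x y a c} → 0# ≤ a → 0# < c → (∀ j → a * x j ≈ c * y j) → Cone P x → Cone P y
    cone-rescale {x = x} {y} {a} {c} 0≤a 0<c e x∈ = cone-resp
      (λ j → trans (*-congˡ (e j)) (trans (sym (*-assoc _ _ _)) (trans (*-congʳ (*-inverseˡ (pos⇒≉0 0<c))) (*-identityˡ _))))
      (cone-* (c ⁻¹) (inverse-nonNegative 0<c) (cone-* a 0≤a x∈))

  opaque
    fromℕ!-pos : ∀ n → 0# < fromℕ (n !)
    fromℕ!-pos zero    = ≰⇒> λ p → <⇒≱ 0<1 (≤-trans (1≤fromℕ 0) p)
    fromℕ!-pos (suc n) = pos-resp (sym (fromℕ-* (suc n) (n !))) (*-pos (fromℕ-pos n) (fromℕ!-pos n))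
      where
      pos-resp : ∀ {x y} → x ≈ y → 0# < x → 0# < y
      pos-resp e (p , q) = 0≤-resp e p , λ f → q (trans f (sym e))

  opaque
    0≤x[x-1] : ∀ n → 0# ≤ fromℕ n * (fromℕ n - 1#)
    0≤x[x-1] zero    = ≤-reflexive (sym (zeroˡ _))
    0≤x[x-1] (suc n) = *-nonNegative (fromℕ-nonNegative (suc n)) (≤⇒0≤ (1≤fromℕ n))

  module _ {r : ℕ} where

    -- The adjacency matrix of the complete graph on `r` vertices.
    distinct : Fin r → Fin r → Carrier
    distinct a b = if does (a Fin.≟ b) then 0# else 1#

    opaque
      distinct-diagonal : ∀ a → distinct a a ≈ 0#
      distinct-diagonal a with a Fin.≟ a
      ... | yes _ = refl
      ... | no ¬p = ⊥-elim (¬p ≡.refl)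

    opaque
      distinct-off-diagonal : ∀ {a b} → a ≢ b → distinct a b ≈ 1#
      distinct-off-diagonal {a} {b} a≢b with a Fin.≟ b
      ... | yes p = ⊥-elim (a≢b p)
      ... | no _  = refl

    opaque
      distinct-bit : ∀ a b → NaturalWithin 1 (distinct a b)
      distinct-bit a b with a Fin.≟ b
      ... | yes _ = 0 , z≤n , refl
      ... | no _  = 1 , s≤s z≤n , sym fromℕ-1

    opaque
      within-distinct : ∀ {n} (G : Pairing {r} n) → (∀ x → G x x ≈ 0#) → within distinct G ≈ diagonal G
      within-distinct G G-diagonal = ∑-cong λ i → ∑-cong λ a → ∑-cong λ b → entry i a b
        where
        entry : ∀ i a b → distinct a b * G (i , a) (i , b) ≈ G (i , a) (i , b)
        entry i a b with a Fin.≟ b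
        ... | yes ≡.refl = trans (zeroˡ _) (sym (G-diagonal _))
        ... | no  _      = *-identityˡ _

  opaque
    ∑-distinct : ∀ {r} → ∑ r (λ a → ∑ r (distinct a)) ≈ fromℕ r * (fromℕ r - 1#)
    ∑-distinct {r} = trans (∑-cong row) (∑-const r _)
      where
      row : ∀ {r} (a : Fin r) → ∑ r (distinct a) ≈ fromℕ r - 1#
      row {suc r} a = trans (∑-remove (distinct a) a) (trans (+-cong (distinct-diagonal a)
        (trans (∑-cong λ b → distinct-off-diagonal (Fin.punchInᵢ≢i a b ∘ ≡.sym)) (trans (∑-const r 1#) (*-identityʳ _))))
        (solve 1 (λ r → :0 :+ r := (:1 :+ r) :- :1) refl (fromℕ r)))

  module Counting {k N r} (2≤r : 2 ℕ.≤ r) (C : Fin k → Fin N → Fin N → Carrier)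
    (C-bit : ∀ j u v → NaturalWithin 1 (C j u v)) (C-diagonal : ∀ j u → C j u u ≈ 0#)
    (C-total : ∀ {u v} → u ≢ v → ∑ k (λ j → C j u v) ≈ 1#) where

    State : ℕ → Set
    State n = (Fin n × Fin r) ↔ Fin N

    pairing : ∀ {n} → State n → Fin k → Pairing {r} n
    pairing φ j x y = C j (Inverse.to φ x) (Inverse.to φ y)

    pairing-diagonal : ∀ {n} (φ : State n) j x → pairing φ j x x ≈ 0#
    pairing-diagonal φ j x = C-diagonal j _

    -- Pairs of positions are ordered, so every edge is counted twice.
    count : ∀ {n} → (Fin r → Fin r → Carrier) → State n → ℝ^ k
    count h φ j = within h (pairing φ j)

    cliques volume : ∀ {n} → State n → ℝ^ k
    cliques φ j = diagonal (pairing φ j)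
    volume φ j = everything (pairing φ j)

    -- At most two blocks are affected, and the copies in each contain at most `r * r` ordered pairs
    -- of a given colour, before the move and after it.
    b₀ : ℕ
    b₀ = 2 ℕ.* (r ℕ.* r)

    module _ (h : Fin r → Fin r → Carrier) (h-diagonal : ∀ a → h a a ≈ 0#) (h-bit : ∀ a b → NaturalWithin 1 (h a b)) where

      private
        edges : Carrier
        edges = ∑ r (λ a → ∑ r (h a))

      opaque
        edges-nonNegative : 0# ≤ edges
        edges-nonNegative = ∑-nonNegative λ a → ∑-nonNegative λ b → natural-nonNegative (h-bit a b)

      opaque
        edges-≤ : edges ≤ fromℕ r * (fromℕ r - 1#)
        edges-≤ = ≤-trans (∑-mono-≤ λ a → ∑-mono-≤ λ b → compare a b) (≤-reflexive ∑-distinct)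
          where
          compare : ∀ a b → h a b ≤ distinct a b
          compare a b with a Fin.≟ b
          ... | yes ≡.refl = ≤-reflexive (h-diagonal a)
          ... | no  _      = bit-≤1 (h-bit a b)

      opaque
        -- Every pair of distinct vertices has exactly one colour, so the total does not depend on
        -- `φ`. This makes the entries of each shift sum to zero.
        ∑-count : ∀ {n} (φ : State n) → ∑ k (count h φ) ≈ fromℕ n * edges
        ∑-count {n} φ = trans (∑-swap _) (trans (∑-cong λ i → trans (∑-swap _) (∑-cong λ a → trans (∑-swap _) (∑-cong λ b →
            trans (sym (*-∑ (h a b) (λ j → pairing φ j (i , a) (i , b)))) (weight i a b)))) (∑-const n _))
          where
          weight : ∀ i a b → h a b * ∑ k (λ j → pairing φ j (i , a) (i , b)) ≈ h a b
          weight i a b with a Fin.≟ b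
          ... | yes ≡.refl = trans (*-congʳ (h-diagonal a)) (trans (zeroˡ _) (sym (h-diagonal a)))
          ... | no a≢b = trans (*-congˡ (C-total λ e → a≢b (≡.cong proj₂ (Injection.injective (↔⇒↣ φ) e)))) (*-identityʳ _)

      move : ∀ m {n} (φ : State (m ℕ.+ n)) → Fin ((m ℕ.+ n) !) → Fin ((m ℕ.* r) !) → State (m ℕ.+ n)
      move m {n} φ x y = φ ↔-∘ (onBlocks (permutation (m ℕ.+ n) x) ↔-∘ rearrangement m (permutation (m ℕ.* r) y))

      shift-count : ∀ m {n} (φ : State (m ℕ.+ n)) → Fin ((m ℕ.+ n) !) → Fin ((m ℕ.* r) !) → ℝ^ k
      shift-count m φ x y = count h (move m φ x y) -ᵥ count h φ

      opaque
        is-shift : ∀ m {n} → m ℕ.≤ 2 → (φ : State (m ℕ.+ n)) → ∀ x y → Shift b₀ (shift-count m φ x y)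
        is-shift m {n} m≤2 φ x y = trans (∑-- _ _) (trans (+-cong (∑-count (move m φ x y)) (-‿cong (∑-count φ))) (-‿inverseʳ _)) ,
          λ j → within-box j
          where
          size : m ℕ.* (r ℕ.* (r ℕ.* (1 ℕ.* 1))) ℕ.≤ b₀
          size = ℕ.*-mono-≤ m≤2 (ℕ.≤-reflexive (≡.cong (r ℕ.*_) (ℕ.*-identityʳ r)))
          within-box : ∀ j → IntegerWithin b₀ (shift-count m φ x y j)
          within-box j = let p , p≤ , e = new∈ ; q , q≤ , f = old∈ in p , q , ℕ.≤-trans p≤ size , ℕ.≤-trans q≤ size ,
            trans (M.shift x y) (+-cong e (-‿cong f))
            where
            module M = Move m {n} h h-diagonal (pairing φ j) (pairing-diagonal φ j)
            new∈ : NaturalWithin (m ℕ.* (r ℕ.* (r ℕ.* (1 ℕ.* 1)))) (M.new x y)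
            new∈ = natural-∑ λ i → natural-∑ λ a → natural-∑ λ b → natural-* (h-bit a b) (C-bit j _ _)
            old∈ : NaturalWithin (m ℕ.* (r ℕ.* (r ℕ.* (1 ℕ.* 1)))) (M.old x y)
            old∈ = natural-∑ λ i → natural-∑ λ a → natural-∑ λ b → natural-* (h-bit a b) (C-bit j _ _)

      module _ {d} (S : Fin k → ℝ^ d) where

        weight : ∀ {n} → State n → ℝ^ d
        weight φ = combination S (count h φ)

        opaque
          -- Near-minimality is applied to each move separately; the sum of all the shifts then lies
          -- in the cone, although it need not come from any single rearrangement.
          total∈Cone : ∀ m {n} → m ℕ.≤ 2 → (φ : State (m ℕ.+ n)) →
            (∀ x y → dot (weight φ) (weight φ) - 1# ≤ dot (weight (move m φ x y)) (weight (move m φ x y))) →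
            Cone (NonDecreasing S b₀ (weight φ)) (λ j → ∑ ((m ℕ.+ n) !) (λ x → ∑ ((m ℕ.* r) !) (λ y → shift-count m φ x y j)))
          total∈Cone m m≤2 φ near = cone-∑ λ x → cone-∑ λ y → cone-generator (is-shift m m≤2 φ x y ,
            ≤-trans (near x y) (≤-reflexive (dot-cong (moved x y) (moved x y))))
            where
            moved : ∀ x y → weight (move m φ x y) ≈ᵥ weight φ +ᵥ combination S (shift-count m φ x y)
            moved x y i = trans (∑-cong λ j → solve 3 (λ a b s → a :* s := b :* s :+ (a :- b) :* s) refl (count h (move m φ x y) j) (count h φ j) (S j i)) (∑-+ _ _)

        opaque
          combination-difference : ∀ (x y : ℝ^ k) a c → combination S (a *ᵥ x -ᵥ c *ᵥ y) ≈ᵥ a *ᵥ combination S x -ᵥ c *ᵥ combination S y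
          combination-difference x y a c i = trans
            (∑-cong λ j → solve 5 (λ a x c y s → (a :* x :- c :* y) :* s := a :* (x :* s) :- c :* (y :* s)) refl a (x j) c (y j) (S j i))
            (trans (∑-- _ _) (+-cong (sym (*-∑ a _)) (-‿cong (sym (*-∑ c _)))))

        module _ {M} (0≤M : 0# ≤ M) (confined : Confined S b₀ M) where

          opaque
            -- The averaged move is a multiple of `edges * cliques - B * count` with
            -- `B = r (r - 1)`. As `edges ≤ B`, dividing by `B` leaves the clique sum with
            -- coefficient at most one.
            single-descent : ∀ {n} (φ : State (1 ℕ.+ n)) →
              (∀ x y → dot (weight φ) (weight φ) - 1# ≤ dot (weight (move 1 φ x y)) (weight (move 1 φ x y))) →
              ∥ weight φ ∥ ≤ ∥ combination S (cliques φ) ∥ + M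
            single-descent {n} φ near = *-cancelˡ-≤ 0<B (≤-trans bound (≤-trans (+-mono-≤ (≤-trans (≤-reflexive (∥∥-* edges κ edges-nonNegative))
                (*-monoʳ-≤ (∥∥-nonNegative κ) edges-≤)) ≤-refl) (≤-reflexive (sym (distribˡ _ _ _)))))
              where
              κ : ℝ^ d
              κ = combination S (cliques φ)
              B : Carrier
              B = fromℕ r * (fromℕ r - 1#)
              0<B : 0# < B
              0<B = ≰⇒> λ p → <⇒≱ 0<1 (≤-trans (≤-trans (≤-reflexive (sym (*-identityˡ 1#))) (*-mono-≤ (fromℕ-nonNegative r) 0≤1
                (≤-trans (≤-reflexive (sym fromℕ-1)) (fromℕ-mono (ℕ.≤-trans (s≤s z≤n) 2≤r)))
                (≤-trans (≤-reflexive (trans (solve 0 (:1 := (:1 :+ :1) :- :1) refl) (+-congʳ (+-congˡ (sym fromℕ-1))))) (+-mono-≤ (fromℕ-mono 2≤r) ≤-refl)))) p)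
              x∈ : Cone (NonDecreasing S b₀ (weight φ)) (edges *ᵥ cliques φ -ᵥ B *ᵥ count h φ)
              x∈ = cone-rescale {a = fromℕ (suc n) * (fromℕ (1 ℕ.* r) * (fromℕ (1 ℕ.* r) - 1#))}
                (*-nonNegative (fromℕ-nonNegative (suc n)) (0≤x[x-1] (1 ℕ.* r)))
                (*-pos (fromℕ!-pos (1 ℕ.* r)) (fromℕ!-pos (suc n)))
                (λ j → single-total {n = n} h h-diagonal (pairing φ j) (pairing-diagonal φ j)) (total∈Cone 1 (s≤s z≤n) φ near)
              bound : B * ∥ weight φ ∥ ≤ ∥ edges *ᵥ κ ∥ + B * M
              bound = descend {S = S} 0≤M confined 0<B x∈ (combination-difference (cliques φ) (count h φ) edges B)

    opaque
      ∑-state : ∀ {n} (φ : State n) (f : Fin N → Carrier) → ∑ N f ≈ ∑ n (λ i → ∑ r (λ a → f (Inverse.to φ (i , a))))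
      ∑-state {n} φ f = trans (∑-permute f (φ ↔-∘ Fin.*↔×)) (∑-remQuot n (λ x → f (Inverse.to φ x)))

    opaque
      volume≈ : ∀ {n} (φ : State n) j → volume φ j ≈ ∑ N (λ u → ∑ N (C j u))
      volume≈ φ j = sym (trans (∑-state φ _) (∑-cong λ i →
        trans (∑-cong λ a → ∑-state φ _) (∑-swap _)))

    private
      distinct-edges : Carrier
      distinct-edges = ∑ r (λ a → ∑ r (distinct {r} a))

    module _ {d} (S : Fin k → ℝ^ d) {M} (0≤M : 0# ≤ M) (confined : Confined S b₀ M) where

      cliqueWeight : ∀ {n} → State n → ℝ^ d
      cliqueWeight φ = combination S (cliques φ)

      opaque
        distinct-weight : ∀ {n} (φ : State n) → weight distinct distinct-diagonal distinct-bit S φ ≈ᵥ cliqueWeight φ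
        distinct-weight φ = combination-cong S λ j → within-distinct (pairing φ j) (pairing-diagonal φ j)

      opaque
        -- For the complete graph the clique term merges with the count, and a common factor `r`
        -- cancels: the cone element is a multiple of `(r - 1) * volume - (r N - 1) * count`. Since
        -- `N (r - 1) ≤ r N - 1`, division by `r N - 1` gives the bound.
        double-descent : ∀ {n} (φ : State (2 ℕ.+ n)) → let w = weight distinct distinct-diagonal distinct-bit S; N = fromℕ (2 ℕ.+ n) in
          (∀ x y → dot (w φ) (w φ) - 1# ≤ dot (w (move distinct distinct-diagonal distinct-bit 2 φ x y)) (w (move distinct distinct-diagonal distinct-bit 2 φ x y))) →
          N * ∥ cliqueWeight φ ∥ ≤ ∥ combination S (volume φ) ∥ + N * M
        double-descent {n} φ near = *-cancelˡ-≤ 0<B (≤-trans (≤-trans (≤-reflexive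
              (trans (solve 3 (λ B ν κ → B :* (ν :* κ) := ν :* (B :* κ)) refl B ν _) (*-congˡ (*-congˡ (sym (∥∥-cong (distinct-weight φ)))))))
              (*-monoˡ-≤ (fromℕ-nonNegative (2 ℕ.+ n)) bound))
            (≤-trans (≤-reflexive (distribˡ ν _ _)) (≤-trans (+-mono-≤
                (≤-trans (≤-reflexive (trans (*-congˡ (∥∥-* A V 0≤A)) (sym (*-assoc ν A _)))) (*-monoʳ-≤ (∥∥-nonNegative V) νA≤B)) ≤-refl)
              (≤-reflexive (solve 4 (λ B ν v m → B :* v :+ ν :* (B :* m) := B :* (v :+ ν :* m)) refl B ν _ M)))))
          where
          V : ℝ^ d
          V = combination S (volume φ)
          ν A B : Carrier
          ν = fromℕ (2 ℕ.+ n)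
          A = fromℕ r - 1#
          B = fromℕ r * ν - 1#
          1≤r : 1# ≤ fromℕ r
          1≤r = ≤-trans (≤-reflexive (sym fromℕ-1)) (fromℕ-mono (ℕ.≤-trans (s≤s z≤n) 2≤r))
          0<r : 0# < fromℕ r
          0<r = ≰⇒> λ p → <⇒≱ 0<1 (≤-trans 1≤r p)
          0≤A : 0# ≤ A
          0≤A = ≤⇒0≤ 1≤r
          νA≤B : ν * A ≤ B
          νA≤B = ≤-from (≤⇒0≤ (1≤fromℕ (suc n))) (solve 2 (λ ν r → ν :- :1 := (r :* ν :- :1) :- ν :* (r :- :1)) refl ν (fromℕ r))
          0<B : 0# < B
          0<B = ≰⇒> λ p → <⇒≱ 0<1 (≤-trans (≤-from
            (+-nonNegative (*-nonNegative 0≤A (fromℕ-nonNegative (2 ℕ.+ n))) (fromℕ-nonNegative n))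
            (solve 2 (λ r n → (r :- :1) :* (:1 :+ (:1 :+ n)) :+ n := (r :* (:1 :+ (:1 :+ n)) :- :1) :- :1) refl (fromℕ r) (fromℕ n))) p)
          c₀ : Carrier
          c₀ = ((1# + 1#) * (1# + 1#)) * (fromℕ ((2 ℕ.* r) !) * fromℕ ((2 ℕ.+ n) !))
          0<2 : 0# < 1# + 1#
          0<2 = ≰⇒> λ p → <⇒≱ 0<1 (≤-trans (≤-from 0≤1 (solve 0 (:1 := (:1 :+ :1) :- :1) refl)) p)
          0<c₀r : 0# < c₀ * fromℕ r
          0<c₀r = *-pos (*-pos (*-pos 0<2 0<2) (*-pos (fromℕ!-pos (2 ℕ.* r)) (fromℕ!-pos (2 ℕ.+ n)))) 0<r
          w : ℝ^ d
          w = weight distinct distinct-diagonal distinct-bit S φ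
          identity : ∀ j → c₀ * (distinct-edges * ((ν - (1# + 1#)) * cliques φ j + volume φ j) -
              ((fromℕ r * ((fromℕ r + fromℕ r) - 1#)) * (ν - 1#)) * count distinct φ j)
            ≈ (c₀ * fromℕ r) * (A * volume φ j - B * count distinct φ j)
          identity j = trans (*-congˡ (+-congʳ (*-cong ∑-distinct (+-congʳ (*-congˡ (sym (within-distinct (pairing φ j) (pairing-diagonal φ j))))))))
            (solve 5 (λ c r ν D V → c :* ((r :* (r :- :1)) :* ((ν :- (:1 :+ :1)) :* D :+ V) :- ((r :* ((r :+ r) :- :1)) :* (ν :- :1)) :* D)
              := (c :* r) :* ((r :- :1) :* V :- (r :* ν :- :1) :* D)) refl c₀ (fromℕ r) ν (count distinct φ j) (volume φ j))
          x∈ : Cone (NonDecreasing S b₀ w) (A *ᵥ volume φ -ᵥ B *ᵥ count distinct φ)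
          x∈ = cone-rescale {a = (ν * (ν - 1#)) * (fromℕ (2 ℕ.* r) * (fromℕ (2 ℕ.* r) - 1#))}
            (*-nonNegative (0≤x[x-1] (2 ℕ.+ n)) (0≤x[x-1] (2 ℕ.* r))) 0<c₀r
            (λ j → trans (double-total {n = n} distinct distinct-diagonal (pairing φ j) (pairing-diagonal φ j)) (identity j))
            (total∈Cone distinct distinct-diagonal distinct-bit S 2 (s≤s (s≤s z≤n)) φ near)
          bound : B * ∥ w ∥ ≤ ∥ A *ᵥ V ∥ + B * M
          bound = descend {S = S} 0≤M confined 0<B x∈ (combination-difference distinct distinct-diagonal distinct-bit S (volume φ) (count distinct φ) A B)

      opaque
        balanced-cliques : ∀ {n} → 1 ℕ.≤ n → State n → ∃[ φ ] fromℕ n * ∥ cliqueWeight {n} φ ∥ ≤ ∥ combination S (volume φ) ∥ + fromℕ n * M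
        -- A single block is the whole graph, so its clique sum already is the total colour sum; no
        -- second block is available for a move.
        balanced-cliques {suc zero} _ φ = φ , ≤-trans
          (≤-reflexive (trans (*-congʳ fromℕ-1) (trans (*-identityˡ _) (∥∥-cong (combination-cong S λ j → ∑-cong λ { zero → sym (one _) })))))
          (≤-from (*-nonNegative (fromℕ-nonNegative 1) 0≤M) (solve 2 (λ v m → m := (v :+ m) :- v) refl _ _))
        balanced-cliques {suc (suc n)} _ φ₀ =
          let φ , _ , near = near-minimiser {X = State (suc (suc n))} (λ _ → ⊤) (weight distinct distinct-diagonal distinct-bit S {suc (suc n)}) (φ₀ , tt)
          in φ , double-descent φ λ x y → near {move distinct distinct-diagonal distinct-bit 2 φ x y} tt

      module _ (h : Fin r → Fin r → Carrier) (h-diagonal : ∀ a → h a a ≈ 0#) (h-bit : ∀ a b → NaturalWithin 1 (h a b)) where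

        opaque
          -- The minimisation runs only over arrangements with the clique counts of `φ₁`. By
          -- `diagonal-invariant` the moves inside a block stay in this class, so near-minimality
          -- applies to them.
          balanced-copies : ∀ {n} (φ₁ : State (suc n)) → ∃[ φ ] ∥ weight h h-diagonal h-bit S {suc n} φ ∥ ≤ ∥ cliqueWeight φ₁ ∥ + M
          balanced-copies {n} φ₁ =
            let φ , q , near = near-minimiser {X = State (suc n)} Q (weight h h-diagonal h-bit S {suc n}) (φ₁ , λ j → refl)
            in φ , ≤-trans
              (single-descent h h-diagonal h-bit S 0≤M confined φ λ x y → near {move h h-diagonal h-bit 1 φ x y} λ j →
                trans (diagonal-invariant h h-diagonal (pairing φ j) (pairing-diagonal φ j) x y) (q j))
              (≤-reflexive (+-congʳ (∥∥-cong (combination-cong S q))))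
            where
            Q : State (suc n) → Set
            Q φ = ∀ j → cliques φ j ≈ cliques φ₁ j

        opaque
          balanced-arrangement : ∀ {n} → 1 ℕ.≤ n → State n → ∃[ φ ]
            fromℕ n * ∥ weight h h-diagonal h-bit S {n} φ ∥ ≤ ∥ combination S (λ j → ∑ N (λ u → ∑ N (C j u))) ∥ + fromℕ n * (M + M)
          balanced-arrangement {suc n} 1≤n φ₀ =
            let φ₁ , p = balanced-cliques 1≤n φ₀
                φ₂ , q = balanced-copies {n} φ₁
            in φ₂ , ≤-trans (*-monoˡ-≤ (fromℕ-nonNegative (suc n)) q)
              (≤-trans (≤-reflexive (distribˡ ν _ M)) (≤-trans (+-mono-≤ p ≤-refl)
                (≤-reflexive (trans (solve 3 (λ v ν m → (v :+ ν :* m) :+ ν :* m := v :+ ν :* (m :+ m)) refl _ ν M)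
                  (+-congʳ (∥∥-cong (combination-cong S (volume≈ φ₁))))))))
            where
            ν : Carrier
            ν = fromℕ (suc n)

-- From sums over edge lists to sums over ordered pairs

module EdgeSums (ℝ : CompleteOrderedField) where
  open CompleteOrderedField ℝ hiding (zero)
  open Euclidean ℝ hiding (Carrier; _≈_; _≤_; _<_; _+_; _*_; _⁻¹; 0#; 1#; sum)
  open DifferenceSolver commutativeRing
  open OrderedField ℝ
  open Vectors ℝ
  open Confinement ℝ
  open Averaging ℝ
  open Rearrangements ℝ
  open Arrangements ℝ

  indicator : ∀ {P : Set} → Dec P → Carrier
  indicator p = if does p then 1# else 0#

  opaque
    indicator-yes : ∀ {P : Set} (p : Dec P) → P → indicator p ≈ 1#
    indicator-yes (yes _) _ = refl
    indicator-yes (no ¬p) p = ⊥-elim (¬p p)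

  opaque
    indicator-no : ∀ {P : Set} (p : Dec P) → ¬ P → indicator p ≈ 0#
    indicator-no (yes p) ¬p = ⊥-elim (¬p p)
    indicator-no (no _)  _  = refl

  opaque
    indicator-bit : ∀ {P : Set} (p : Dec P) → NaturalWithin 1 (indicator p)
    indicator-bit (yes _) = 1 , s≤s z≤n , sym fromℕ-1
    indicator-bit (no _)  = 0 , z≤n , refl

  opaque
    indicator-⇔ : ∀ {P Q : Set} (p : Dec P) (q : Dec Q) → (P → Q) → (Q → P) → indicator p ≈ indicator q
    indicator-⇔ (yes p) q f g = sym (indicator-yes q (f p))
    indicator-⇔ (no ¬p) q f g = sym (indicator-no q (¬p ∘ g))

  opaque
    indicator-× : ∀ {P Q : Set} (p : Dec P) (q : Dec Q) → indicator (p ×-dec q) ≈ indicator p * indicator q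
    indicator-× (yes _) (yes _) = sym (*-identityˡ _)
    indicator-× (yes _) (no _)  = sym (*-identityˡ _)
    indicator-× (no _)  q       = sym (zeroˡ _)

  opaque
    ∑-indicator : ∀ {n} (i : Fin n) (f : Fin n → Carrier) → ∑ n (λ j → indicator (i Fin.≟ j) * f j) ≈ f i
    ∑-indicator {suc n} i f = trans (∑-remove _ i) (trans (+-cong
        (trans (*-congʳ (indicator-yes (i Fin.≟ i) ≡.refl)) (*-identityˡ _))
        (∑-zero λ j → trans (*-congʳ (indicator-no (i Fin.≟ punchIn i j) (Fin.punchInᵢ≢i i j ∘ ≡.sym))) (zeroˡ _)))
      (+-identityʳ _))

  listSum : ∀ {A : Set} → List A → (A → Carrier) → Carrier
  listSum []       X = 0#
  listSum (x ∷ xs) X = X x + listSum xs X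

  opaque
    listSum-++ : ∀ {A : Set} (xs ys : List A) (X : A → Carrier) → listSum (xs ++ ys) X ≈ listSum xs X + listSum ys X
    listSum-++ []       ys X = sym (+-identityˡ _)
    listSum-++ (x ∷ xs) ys X = trans (+-congˡ (listSum-++ xs ys X)) (sym (+-assoc _ _ _))

  opaque
    listSum-map : ∀ {A B : Set} (f : A → B) xs (X : B → Carrier) → listSum (List.map f xs) X ≈ listSum xs (X ∘ f)
    listSum-map f []       X = refl
    listSum-map f (x ∷ xs) X = +-congˡ (listSum-map f xs X)

  opaque
    listSum-filter : ∀ {A : Set} {P : A → Set} (P? : Decidable P) xs (X : A → Carrier) →
      listSum (filter P? xs) X ≈ listSum xs (λ x → indicator (P? x) * X x)
    listSum-filter P? []       X = refl
    listSum-filter P? (x ∷ xs) X with does (P? x)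
    ... | true  = +-cong (sym (*-identityˡ _)) (listSum-filter P? xs X)
    ... | false = trans (listSum-filter P? xs X) (sym (trans (+-congʳ (zeroˡ _)) (+-identityˡ _)))

  opaque
    listSum-mapMaybe : ∀ {A B : Set} (f : A → Maybe B) xs (X : B → Carrier) →
      listSum (mapMaybe f xs) X ≈ listSum xs (λ x → maybe X 0# (f x))
    listSum-mapMaybe f []       X = refl
    listSum-mapMaybe f (x ∷ xs) X with f x
    ... | just y  = +-congˡ (listSum-mapMaybe f xs X)
    ... | nothing = trans (listSum-mapMaybe f xs X) (sym (+-identityˡ _))

  opaque
    listSum-cartesianProduct : ∀ {A B : Set} (xs : List A) (ys : List B) (X : A × B → Carrier) →
      listSum (cartesianProduct xs ys) X ≈ listSum xs (λ x → listSum ys (λ y → X (x , y)))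
    listSum-cartesianProduct []       ys X = refl
    listSum-cartesianProduct (x ∷ xs) ys X = trans (listSum-++ (List.map (x ,_) ys) _ X)
      (+-cong (listSum-map (x ,_) ys X) (listSum-cartesianProduct xs ys X))

  opaque
    listSum-tabulate : ∀ {A : Set} {n} (g : Fin n → A) (X : A → Carrier) → listSum (List.tabulate g) X ≈ ∑ n (X ∘ g)
    listSum-tabulate {n = zero}  g X = sym ∑-empty
    listSum-tabulate {n = suc n} g X = trans (+-congˡ (listSum-tabulate (g ∘ suc) X)) (sym ∑-suc)

  module _ {N : ℕ} (X : Edge N → Carrier) where

    -- Extension by zero to pairs not in increasing order. The expression repeats the one inside
    -- `allEdges`, so that the sum over that list becomes this double sum.
    upper : Fin N → Fin N → Carrier
    upper u v = maybe X 0# (Maybe.map (λ u<v → edge u v u<v) (dec⇒maybe (u Fin.<? v)))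

    symmetrise : Fin N → Fin N → Carrier
    symmetrise u v = upper u v + upper v u

    opaque
      listSum-allEdges : listSum (allEdges N) X ≈ ∑ N (λ u → ∑ N (upper u))
      listSum-allEdges = trans (listSum-mapMaybe _ (cartesianProduct (allFin N) (allFin N)) X)
        (trans (listSum-cartesianProduct (allFin N) (allFin N) _)
          (trans (listSum-tabulate (λ u → u) _) (∑-cong λ u → listSum-tabulate (λ v → v) (upper u))))

    opaque
      upper-≮ : ∀ {u v} → ¬ u Fin.< v → upper u v ≈ 0#
      upper-≮ {u} {v} u≮v with u Fin.<? v
      ... | yes u<v = ⊥-elim (u≮v u<v)
      ... | no  _   = refl

    opaque
      symmetrise-diagonal : ∀ u → symmetrise u u ≈ 0#
      symmetrise-diagonal u = trans (+-cong (upper-≮ {u} {u} (Fin.<-irrefl ≡.refl)) (upper-≮ {u} {u} (Fin.<-irrefl ≡.refl))) (+-identityˡ 0#)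

  opaque
    -- The order proof stored in an `edge` is irrelevant, so whichever proof the decision procedure
    -- returns yields the same edge.
    upper-< : ∀ {N} (X : Edge N → Carrier) {u v} (u<v : u Fin.< v) → upper X u v ≈ X (edge u v u<v)
    upper-< X {u} {v} u<v with u Fin.<? v
    ... | yes _   = refl
    ... | no  u≮v = ⊥-elim (u≮v u<v)

  opaque
    -- The edge is chosen before `X`: the indicators of all colours are evaluated at the same edge,
    -- where exactly one of them is 1.
    symmetrise-edge : ∀ {N u v} → u ≢ v → ∃[ e ] (∀ (X : Edge N → Carrier) → symmetrise X u v ≈ X e)
    symmetrise-edge {N} {u} {v} u≢v with Fin.<-cmp u v
    ... | tri< u<v _ v≮u = edge u v u<v , λ X → trans (+-cong (upper-< X u<v) (upper-≮ X v≮u)) (+-identityʳ _)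
    ... | tri≈ _ u≡v _   = ⊥-elim (u≢v u≡v)
    ... | tri> u≮v _ v<u = edge v u v<u , λ X → trans (+-cong (upper-≮ X u≮v) (upper-< X v<u)) (+-identityˡ _)

  opaque
    upper-indicator : ∀ {N} (G : Graph N) (X : Edge N → Carrier) u v → let open Graph G using (_~?_) in
      upper (λ e → indicator (Edge.u e ~? Edge.v e) * X e) u v ≈ indicator (u ~? v) * upper X u v
    upper-indicator G X u v with u Fin.<? v
    ... | yes _ = refl
    ... | no  _ = sym (zeroʳ _)

  opaque
    double-listSum : ∀ {N} (G : Graph N) (X : Edge N → Carrier) → let open Graph G using (_~?_) in
      listSum (E G) X + listSum (E G) X ≈ ∑ N (λ u → ∑ N (λ v → indicator (u ~? v) * symmetrise X u v))
    double-listSum {N} G X = trans (+-cong half half) (trans (+-congˡ (∑-swap _)) (trans (sym (∑-+ _ _))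
        (∑-cong λ u → trans (sym (∑-+ _ _)) (∑-cong λ v → trans
          (+-congˡ (*-congʳ (indicator-⇔ (v G.~? u) (u G.~? v) G.sym G.sym))) (sym (distribˡ _ _ _))))))
      where
      module G = Graph G
      half : listSum (E G) X ≈ ∑ N (λ u → ∑ N (λ v → indicator (u G.~? v) * upper X u v))
      half = trans (listSum-filter (λ e → Edge.u e G.~? Edge.v e) (allEdges N) X)
        (trans (listSum-allEdges _) (∑-cong λ u → ∑-cong λ v → upper-indicator G X u v))

  module Colouring {k N} (c : Edge N → Fin k) where

    colour : Fin k → Edge N → Carrier
    colour j e = indicator (c e Fin.≟ j)

    C : Fin k → Fin N → Fin N → Carrier
    C j = symmetrise (colour j)

    opaque
      C-diagonal : ∀ j u → C j u u ≈ 0#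
      C-diagonal j = symmetrise-diagonal (colour j)

    opaque
      C-bit : ∀ j u v → NaturalWithin 1 (C j u v)
      C-bit j u v with u Fin.≟ v
      ... | yes ≡.refl = 0 , z≤n , C-diagonal j u
      ... | no u≢v = let e , f = symmetrise-edge u≢v
                         p , p≤1 , g = indicator-bit (c e Fin.≟ j)
                     in p , p≤1 , trans (f (colour j)) g

    opaque
      C-total : ∀ {u v} → u ≢ v → ∑ k (λ j → C j u v) ≈ 1#
      C-total u≢v = let e , f = symmetrise-edge u≢v in
        trans (∑-cong λ j → trans (f (colour j)) (sym (*-identityʳ _))) (∑-indicator (c e) (λ _ → 1#))

    opaque
      ∑ᵥ-colours : ∀ {d} (S : Fin k → ℝ^ d) xs → ∑ᵥ xs (λ e → S (c e)) ≈ᵥ combination S (λ j → listSum xs (colour j))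
      ∑ᵥ-colours S []       i = sym (∑-zero λ j → zeroˡ _)
      ∑ᵥ-colours S (e ∷ xs) i = trans (+-cong (sym (∑-indicator (c e) (λ j → S j i))) (∑ᵥ-colours S xs i))
        (trans (sym (∑-+ _ _)) (∑-cong λ j → sym (distribʳ _ _ _)))

    opaque
      double-∑ᵥ : ∀ {d} (S : Fin k → ℝ^ d) (G : Graph N) → let open Graph G using (_~?_) in
        (1# + 1#) *ᵥ ∑ᵥ (E G) (λ e → S (c e)) ≈ᵥ combination S (λ j → ∑ N (λ u → ∑ N (λ v → indicator (u ~? v) * C j u v)))
      double-∑ᵥ S G i = trans (*-congˡ (∑ᵥ-colours S (E G) i)) (trans (*-∑ _ _) (∑-cong λ j →
        trans (solve 2 (λ x s → (:1 :+ :1) :* (x :* s) := (x :+ x) :* s) refl _ (S j i)) (*-congʳ (double-listSum G (colour j)))))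

    opaque
      double-∑ᵥ-K : ∀ {d} (S : Fin k → ℝ^ d) →
        (1# + 1#) *ᵥ ∑ᵥ (E (K N)) (λ e → S (c e)) ≈ᵥ combination S (λ j → ∑ N (λ u → ∑ N (C j u)))
      double-∑ᵥ-K S i = trans (double-∑ᵥ S (K N) i) (combination-cong S (λ j → ∑-cong λ u → ∑-cong λ v → entry j u v) i)
        where
        entry : ∀ j u v → indicator (¬? (u Fin.≟ v)) * C j u v ≈ C j u v
        entry j u v with u Fin.≟ v
        ... | yes ≡.refl = trans (zeroˡ _) (sym (C-diagonal j u))
        ... | no  _      = *-identityˡ _

  -- Adjacency is read off through the inverse of `φ` rather than from the existence of a covering
  -- copy, which makes it decidable.
  factor : ∀ {n r N} → Graph r → (Fin n × Fin r) ↔ Fin N → Graph N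
  factor {n} {r} {N} H φ = record
    { _~_    = λ u v → proj₁ (from u) ≡ proj₁ (from v) × proj₂ (from u) H.~ proj₂ (from v)
    ; sym    = λ (p , q) → ≡.sym p , H.sym q
    ; irrefl = λ u≡v (_ , q) → H.irrefl (≡.cong (proj₂ ∘ from) u≡v) q
    ; _~?_   = λ u v → (proj₁ (from u) Fin.≟ proj₁ (from v)) ×-dec (proj₂ (from u) H.~? proj₂ (from v))
    }
    where
    module H = Graph H
    from : Fin N → Fin n × Fin r
    from = Inverse.from φ

  factor-isFactor : ∀ {n r} (H : Graph r) (φ : (Fin n × Fin r) ↔ Fin (n ℕ.* r)) → IsFactor {n} H (factor H φ)
  factor-isFactor H φ = φ , λ u v → mk⇔
    (λ (p , q) → proj₁ (from u) , proj₂ (from u) , proj₂ (from v) , q , Inverse.inverseˡ φ ≡.refl ,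
      ≡.trans (≡.cong (λ i → Inverse.to φ (i , proj₂ (from v))) p) (Inverse.inverseˡ φ ≡.refl))
    λ { (i , a , b , q , ≡.refl , ≡.refl) → subst₂ i a b q (Inverse.inverseʳ φ ≡.refl) (Inverse.inverseʳ φ ≡.refl) }
    where
    module H = Graph H
    from = Inverse.from φ
    subst₂ : ∀ i a b → a H.~ b → ∀ {x y} → x ≡ (i , a) → y ≡ (i , b) → proj₁ x ≡ proj₁ y × proj₂ x H.~ proj₂ y
    subst₂ i a b q ≡.refl ≡.refl = ≡.refl , q

  module Factors {k d r n} (2≤r : 2 ℕ.≤ r) (S : Fin k → ℝ^ d) (H : Graph r) (c : Edge (n ℕ.* r) → Fin k) where
    private
      module H = Graph H
      N : ℕ
      N = n ℕ.* r

    open Colouring c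
    open Counting 2≤r C C-bit C-diagonal C-total

    h : Fin r → Fin r → Carrier
    h a b = indicator (a H.~? b)

    h-diagonal : ∀ a → h a a ≈ 0#
    h-diagonal a = indicator-no (a H.~? a) (H.irrefl ≡.refl)

    h-bit : ∀ a b → NaturalWithin 1 (h a b)
    h-bit a b = indicator-bit (a H.~? b)

    opaque
      -- Vertices are reindexed by positions; adjacency then forces both ends into one block, and
      -- the sum over the second block collapses.
      factor-sum : ∀ (φ : State n) j → let open Graph (factor H φ) using (_~?_) in
        ∑ N (λ u → ∑ N (λ v → indicator (u ~? v) * C j u v)) ≈ count h φ j
      factor-sum φ j = trans (∑-state φ _) (∑-cong λ i → ∑-cong λ a → trans (∑-state φ _) (trans
          (∑-cong λ i′ → trans (∑-cong λ b → trans (*-congʳ (edge-indicator i a i′ b)) (*-assoc _ _ _)) (sym (*-∑ _ _)))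
          (∑-indicator i (λ i′ → ∑ r (λ b → h a b * pairing φ j (i , a) (i′ , b))))))
        where
        open Graph (factor H φ) using (_~?_)
        from : Fin N → Fin n × Fin r
        from = Inverse.from φ
        edge-indicator : ∀ i a i′ b → indicator (Inverse.to φ (i , a) ~? Inverse.to φ (i′ , b)) ≈ indicator (i Fin.≟ i′) * h a b
        edge-indicator i a i′ b = trans
          (indicator-⇔ (Inverse.to φ (i , a) ~? Inverse.to φ (i′ , b)) ((i Fin.≟ i′) ×-dec (a H.~? b))
            (forth (Inverse.inverseʳ φ ≡.refl) (Inverse.inverseʳ φ ≡.refl))
            (back (Inverse.inverseʳ φ ≡.refl) (Inverse.inverseʳ φ ≡.refl)))
          (indicator-× (i Fin.≟ i′) (a H.~? b))
          where
          forth : ∀ {x y} → x ≡ (i , a) → y ≡ (i′ , b) → proj₁ x ≡ proj₁ y × proj₂ x H.~ proj₂ y → i ≡ i′ × a H.~ b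
          forth ≡.refl ≡.refl p = p
          back : ∀ {x y} → x ≡ (i , a) → y ≡ (i′ , b) → i ≡ i′ × a H.~ b → proj₁ x ≡ proj₁ y × proj₂ x H.~ proj₂ y
          back ≡.refl ≡.refl p = p

    opaque
      double-∑ᵥ-factor : ∀ (φ : State n) →
        (1# + 1#) *ᵥ ∑ᵥ (E (factor H φ)) (λ e → S (c e)) ≈ᵥ combination S (count h φ)
      double-∑ᵥ-factor φ i = trans (double-∑ᵥ S (factor H φ) i) (combination-cong S (factor-sum φ) i)

  opaque
    -- Both sides of `balanced-arrangement` count ordered pairs, so all sums are doubled. Halving
    -- turns the two errors `M`, one from each round, into a single `M` and gives `M + α / n`;
    -- positivity of `α` extends this to the stated `2 α / n`.
    confined⇒balanced : ∀ {k r d} → 2 ℕ.≤ r → (S : Fin k → ℝ^ d) → ∀ {M} → 0# ≤ M → Confined S (2 ℕ.* (r ℕ.* r)) M →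
      (H : Graph r) → HasBalancedFactors S H M
    confined⇒balanced {k} {r} {d} 2≤r S {M} 0≤M confined H (suc n) 1≤n α 0<α c V≤α =
      let φ , p = balanced-arrangement S 0≤M confined h h-diagonal h-bit {suc n} 1≤n (↔-sym Fin.*↔×)
      in factor H φ , factor-isFactor {suc n} H φ , ≤-trans (≤-reflexive (sym (∥∥≈‖‖ (σ φ)))) (conclude (∥ σ φ ∥)
        (≤-resp₂ (*-congˡ (trans (sym (∥∥-cong (double-∑ᵥ-factor φ))) (∥∥-* (1# + 1#) (σ φ) 0≤2)))
          (+-congʳ (trans (sym (∥∥-cong (double-∑ᵥ-K S))) (∥∥-* (1# + 1#) V 0≤2))) p))
      where
      open Factors {n = suc n} 2≤r S H c
      open Colouring c
      open Counting 2≤r C C-bit C-diagonal C-total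
      0≤2 : 0# ≤ 1# + 1#
      0≤2 = +-nonNegative 0≤1 0≤1
      V : ℝ^ d
      V = ∑ᵥ (E (K (suc n ℕ.* r))) (λ e → S (c e))
      σ : State (suc n) → ℝ^ d
      σ φ = ∑ᵥ (E (factor H φ)) (λ e → S (c e))
      ν : Carrier
      ν = fromℕ (suc n)
      conclude : ∀ s → ν * ((1# + 1#) * s) ≤ (1# + 1#) * ∥ V ∥ + ν * (M + M) → s ≤ M + (fromℕ 2 * α) * ν ⁻¹
      conclude s p = *-cancelˡ-≤ (fromℕ-pos n) (≤-trans
        (0≤⇒≤ (half-nonNegative (0≤-resp
          (solve 5 (λ ν s v M α → ((((:1 :+ :1) :* v :+ ν :* (M :+ M)) :- ν :* ((:1 :+ :1) :* s)) :+ ((α :- v) :+ (α :- v))) :+ (α :+ α)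
            := ((ν :* M :+ (α :+ α)) :- ν :* s) :+ ((ν :* M :+ (α :+ α)) :- ν :* s)) refl ν s (∥ V ∥) M α)
          (+-nonNegative (+-nonNegative (≤⇒0≤ p) (+-nonNegative (≤⇒0≤ V≤) (≤⇒0≤ V≤))) (+-nonNegative (<⇒≤ 0<α) (<⇒≤ 0<α))))))
        (≤-reflexive (sym (trans (distribˡ ν M _) (+-congˡ (trans
          (solve 3 (λ ν x i → ν :* (x :* i) := x :* (ν :* i)) refl ν (fromℕ 2 * α) (ν ⁻¹))
          (trans (*-congˡ (*-inverseʳ (pos⇒≉0 (fromℕ-pos n)))) (trans (*-identityʳ _)
            (trans (*-congʳ (+-congˡ fromℕ-1)) (solve 1 (λ α → (:1 :+ :1) :* α := α :+ α) refl α))))))))))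
        where
        V≤ : ∥ V ∥ ≤ α
        V≤ = ≤-trans (≤-reflexive (∥∥≈‖‖ V)) V≤α

-- The explicit constant for the simplex

module ConstantBounds where
  open import Data.Nat using (_+_; _*_; _≤_; >-nonZero)
  open import Data.Nat.Properties
  open ≡ using (refl; sym; trans; cong)
  open ℕSolver.+-*-Solver using (solve; _:=_; _:+_; _:*_; con)

  -- In closed form `4 (2^m - 1)`. Each elimination replaces `b` by `4 b²` and so squares the base
  -- `4 b`, which doubles the exponent; the prefactors of `boxConstant` are absorbed by four more
  -- powers.
  exponent : ℕ → ℕ
  exponent zero    = 0
  exponent (suc m) = exponent m + exponent m + 4

  private
    1≤^ : ∀ {y} e → 1 ≤ y → 1 ≤ y ^ e
    1≤^ zero    p = ≤-refl
    1≤^ (suc e) p = *-mono-≤ p (1≤^ e p)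

    square-^ : ∀ e y → (y * y) ^ e ≡ y ^ (e + e)
    square-^ zero    y = refl
    square-^ (suc e) y = trans (cong (y * y *_) (square-^ e y))
      (trans (*-assoc y y _) (cong (λ f → y * y ^ f) (sym (+-suc e e))))

    m≤m*n′ : ∀ m {n} → 1 ≤ n → m ≤ m * n
    m≤m*n′ m p = ≤-trans (≤-reflexive (sym (*-identityʳ m))) (*-monoʳ-≤ m p)

  boxConstant-≤ : ∀ m b → 1 ≤ b → boxConstant m b ≤ (4 * b) ^ exponent m
  boxConstant-≤ zero    b 1≤b = z≤n
  boxConstant-≤ (suc m) b 1≤b = begin
    b + (b + b) * ((1 + b * b) * boxConstant m b′)   ≤⟨ +-mono-≤ b≤y (*-mono-≤ 2b≤y (*-mono-≤ 1+b²≤y² rest)) ⟩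
    y + y * ((y * y) * Z)                            ≤⟨ +-monoˡ-≤ _ y≤ ⟩
    y * ((y * y) * Z) + y * ((y * y) * Z)            ≡⟨ solve 1 (λ x → x :+ x := con 2 :* x) refl (y * ((y * y) * Z)) ⟩
    2 * (y * ((y * y) * Z))                          ≤⟨ *-monoˡ-≤ _ (*-mono-≤ {2} {4} (s≤s (s≤s z≤n)) 1≤b) ⟩
    y * (y * ((y * y) * Z))                          ≡⟨ solve 2 (λ y Z → y :* (y :* ((y :* y) :* Z)) := Z :* (y :* (y :* (y :* (y :* con 1))))) refl y Z ⟩
    Z * y ^ 4                                        ≡⟨ ^-distribˡ-+-* y (exponent m + exponent m) 4 ⟨
    y ^ exponent (suc m)                             ∎
    where
    open ≤-Reasoning
    y b′ Z : ℕ
    y = 4 * b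
    b′ = 4 * (b * b)
    Z = y ^ (exponent m + exponent m)
    1≤y : 1 ≤ y
    1≤y = *-mono-≤ {1} {4} (s≤s z≤n) 1≤b
    b≤y : b ≤ y
    b≤y = m≤n*m b 4
    2b≤y : b + b ≤ y
    2b≤y = ≤-trans (≤-reflexive (solve 1 (λ b → b :+ b := con 2 :* b) refl b)) (*-monoˡ-≤ b {2} {4} (s≤s (s≤s z≤n)))
    1+b²≤y² : 1 + b * b ≤ y * y
    1+b²≤y² = ≤-trans (+-monoˡ-≤ (b * b) (*-mono-≤ 1≤b 1≤b))
      (≤-trans (≤-reflexive (solve 1 (λ x → x :+ x := con 2 :* x) refl (b * b)))
        (≤-trans (*-monoˡ-≤ (b * b) {2} {16} (s≤s (s≤s z≤n))) (≤-reflexive (solve 1 (λ b → con 16 :* (b :* b) := (con 4 :* b) :* (con 4 :* b)) refl b))))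
    y≤ : y ≤ y * ((y * y) * Z)
    y≤ = m≤m*n′ y (*-mono-≤ (*-mono-≤ 1≤y 1≤y) (1≤^ (exponent m + exponent m) 1≤y))
    1≤b′ : 1 ≤ b′
    1≤b′ = *-mono-≤ {1} {4} (s≤s z≤n) (*-mono-≤ 1≤b 1≤b)
    rest : boxConstant m b′ ≤ Z
    rest = ≤-trans (boxConstant-≤ m b′ 1≤b′) (≤-reflexive (trans
      (cong (_^ exponent m) (solve 1 (λ b → con 4 :* (con 4 :* (b :* b)) := (con 4 :* b) :* (con 4 :* b)) refl b))
      (square-^ (exponent m) y)))

  -- The quantity `exponent m + 4` doubles with `m` and equals 8 at `m = 1`, whence the hypothesis
  -- `16 ≤ X`.
  exponent-≤ : ∀ X m → 16 ≤ X → 2 * (exponent (suc m) + 4) ≤ X ^ suc m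
  exponent-≤ X zero    16≤X = ≤-trans 16≤X (≤-reflexive (sym (*-identityʳ X)))
  exponent-≤ X (suc m) 16≤X = begin
    2 * (exponent (suc (suc m)) + 4)   ≡⟨ solve 1 (λ e → con 2 :* ((e :+ e :+ con 4) :+ con 4) := con 2 :* (con 2 :* (e :+ con 4))) refl (exponent (suc m)) ⟩
    2 * (2 * (exponent (suc m) + 4))   ≤⟨ *-mono-≤ (≤-trans (s≤s (s≤s z≤n)) 16≤X) (exponent-≤ X m 16≤X) ⟩
    X * X ^ suc m                      ∎
    where open ≤-Reasoning

  -- As `4 * b = 8 r²` is at most `X * X`, the box constant costs `2 * exponent k` powers of `X`.
  -- The remaining factor costs six, by `k ≤ X` and `b ≤ X * X`. The double exponential reflects the
  -- squaring of the base in each of the `d + 1` eliminations.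
  simplexConstant-≤ : ∀ d r → 2 ≤ d → 2 ≤ r → let X = 8 * d * r in simplexConstant (suc d) (2 * (r * r)) ≤ X ^ (X ^ suc d)
  simplexConstant-≤ d r 2≤d 2≤r = begin
    boxConstant k b * (1 + 2 * (k * (b * b)))   ≤⟨ *-mono-≤ (≤-trans (boxConstant-≤ k b 1≤b) (^-monoˡ-≤ (exponent k) 4b≤X²)) factor≤ ⟩
    (X * X) ^ exponent k * X ^ 6                ≡⟨ cong (_* X ^ 6) (square-^ (exponent k) X) ⟩
    X ^ (exponent k + exponent k) * X ^ 6       ≡⟨ ^-distribˡ-+-* X (exponent k + exponent k) 6 ⟨
    X ^ (exponent k + exponent k + 6)           ≤⟨ ^-monoʳ-≤ X {{>-nonZero 1≤X}} exponent≤ ⟩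
    X ^ (X ^ suc d)                             ∎
    where
    open ≤-Reasoning
    k b X : ℕ
    k = suc d
    b = 2 * (r * r)
    X = 8 * d * r
    1≤d : 1 ≤ d
    1≤d = ≤-trans (s≤s z≤n) 2≤d
    1≤r : 1 ≤ r
    1≤r = ≤-trans (s≤s z≤n) 2≤r
    1≤b : 1 ≤ b
    1≤b = *-mono-≤ {1} {2} (s≤s z≤n) (*-mono-≤ 1≤r 1≤r)
    32≤X : 32 ≤ X
    32≤X = *-mono-≤ {16} {8 * d} (*-monoʳ-≤ 8 2≤d) 2≤r
    1≤X : 1 ≤ X
    1≤X = ≤-trans (s≤s z≤n) 32≤X
    8r≤X : 8 * r ≤ X
    8r≤X = *-monoˡ-≤ r (m≤m*n′ 8 1≤d)
    r≤X : r ≤ X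
    r≤X = ≤-trans (m≤n*m r 8) 8r≤X
    4b≤X² : 4 * b ≤ X * X
    4b≤X² = ≤-trans (≤-reflexive (solve 1 (λ r → con 4 :* (con 2 :* (r :* r)) := (con 8 :* r) :* r) refl r)) (*-mono-≤ 8r≤X r≤X)
    b≤X² : b ≤ X * X
    b≤X² = ≤-trans (m≤n*m b 4) 4b≤X²
    k≤X : k ≤ X
    k≤X = begin
      1 + d       ≤⟨ +-monoˡ-≤ d 1≤d ⟩
      d + d       ≡⟨ solve 1 (λ d → d :+ d := con 2 :* d) refl d ⟩
      2 * d       ≤⟨ *-monoˡ-≤ d {2} {8} (s≤s (s≤s z≤n)) ⟩
      8 * d       ≤⟨ m≤m*n′ (8 * d) 1≤r ⟩
      8 * d * r   ∎
    Y : ℕ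
    Y = X * ((X * X) * (X * X))
    1≤Y : 1 ≤ Y
    1≤Y = *-mono-≤ 1≤X (*-mono-≤ (*-mono-≤ 1≤X 1≤X) (*-mono-≤ 1≤X 1≤X))
    factor≤ : 1 + 2 * (k * (b * b)) ≤ X ^ 6
    factor≤ = begin
      1 + 2 * (k * (b * b))   ≤⟨ +-mono-≤ 1≤Y (*-monoʳ-≤ 2 (*-mono-≤ k≤X (*-mono-≤ b≤X² b≤X²))) ⟩
      Y + 2 * Y               ≡⟨ solve 1 (λ Y → Y :+ con 2 :* Y := con 3 :* Y) refl Y ⟩
      3 * Y                   ≤⟨ *-monoˡ-≤ Y (≤-trans (s≤s (s≤s (s≤s z≤n))) 32≤X) ⟩
      X * Y                   ≡⟨ solve 1 (λ X → X :* (X :* ((X :* X) :* (X :* X))) := X :* (X :* (X :* (X :* (X :* (X :* con 1)))))) refl X ⟩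
      X ^ 6                   ∎
    exponent≤ : exponent k + exponent k + 6 ≤ X ^ suc d
    exponent≤ = begin
      exponent k + exponent k + 6   ≤⟨ +-monoʳ-≤ (exponent k + exponent k) {6} {8} (s≤s (s≤s (s≤s (s≤s (s≤s (s≤s z≤n)))))) ⟩
      exponent k + exponent k + 8   ≡⟨ solve 1 (λ e → e :+ e :+ con 8 := con 2 :* (e :+ con 4)) refl (exponent k) ⟩
      2 * (exponent k + 4)          ≤⟨ exponent-≤ X d (≤-trans (m≤m+n 16 16) 32≤X) ⟩
      X ^ suc d                     ∎

theorem1p2 : (ℝ : CompleteOrderedField) → let open Euclidean ℝ in
    (k r d : ℕ) → 2 ≤ℕ k → 2 ≤ℕ r → 2 ≤ℕ d →
    (S : Fin k → ℝ^ d) → Injective _≡_ _≈ᵥ_ S → (∀ i → ‖ S i ‖ ≈ 1#) →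
    (∃[ C ] ((H : Graph r) → HasBalancedFactors S H C))
    × (IsRegularSimplex S → (H : Graph r) →
    HasBalancedFactors S H (fromℕ ((8 *ℕ d *ℕ r) ^ ((8 *ℕ d *ℕ r) ^ suc d))))
theorem1p2 ℝ k r d 2≤k 2≤r 2≤d S _ unit = existence , simplex
  where
  open Euclidean ℝ
  module O = OrderedField ℝ
  module F = CompleteOrderedField ℝ
  open Confinement ℝ
  open EdgeSums ℝ using (confined⇒balanced)

  existence : ∃[ C ] ((H : Graph r) → HasBalancedFactors S H C)
  -- The bound `2 r²` on the shifts holds for every graph on `r` vertices, so `M` is fixed before
  -- `H` is chosen.
  existence = let M , 0≤M , confined = finite-confined S (2 *ℕ (r *ℕ r)) in
    M , confined⇒balanced 2≤r S 0≤M confined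

  simplex : IsRegularSimplex S → (H : Graph r) →
    HasBalancedFactors S H (fromℕ ((8 *ℕ d *ℕ r) ^ ((8 *ℕ d *ℕ r) ^ suc d)))
  simplex regular H n 1≤n α 0<α c V≤α =
    let F , isFactor , bound = confined⇒balanced 2≤r S (O.fromℕ-nonNegative M) confined H n 1≤n α 0<α c V≤α
    in F , isFactor , F.≤-trans bound (F.+-monoˡ-≤ _ (O.fromℕ-mono M≤))
    where
    M : ℕ
    M = simplexConstant k (2 *ℕ (r *ℕ r))
    1≤b : 1 ≤ℕ 2 *ℕ (r *ℕ r)
    1≤b = ℕ.*-mono-≤ {1} {2} (s≤s z≤n) (ℕ.*-mono-≤ 1≤r 1≤r)
      where
      1≤r : 1 ≤ℕ r
      1≤r = ℕ.≤-trans (s≤s z≤n) 2≤r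
    confined : Confined S (2 *ℕ (r *ℕ r)) (fromℕ M)
    confined = Simplex.simplex-confined S unit regular 2≤k (ℕ.≤-trans (s≤s z≤n) 2≤d) (2 *ℕ (r *ℕ r)) 1≤b
    M≤ : M ≤ℕ (8 *ℕ d *ℕ r) ^ ((8 *ℕ d *ℕ r) ^ suc d)
    M≤ = ℕ.≤-trans (ℕ.≤-reflexive (≡.cong (λ k → simplexConstant k (2 *ℕ (r *ℕ r))) (proj₁ regular)))
      (ConstantBounds.simplexConstant-≤ d r 2≤d 2≤r)
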